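{- Let $n$ be a positive integer and $\zeta_n$ a primitive $n$-th root of unity. For integers $k,l$ with $k\geq l\geq 0$, we have $$G_n^t(k,l;\zeta_n)=\sum_{m=0}^k\frac{(-1)^m}{n^{m+1}}\sum\prod_{a=0}^m\binom{n}{j_a+1}\,(1-t)^{i_0}(-t)^{l-i_0},$$ where the inner sum runs over all integers $i_0,\ldots,i_m,j_0,\ldots,j_m$ satisfying $i_0+\cdots+i_m=l$, $j_0+\cdots+j_m=k$, $0\leq i_a\leq j_a\leq n-1$ for $a=0,\ldots,m$, and $j_1,\ldots,j_m\geq 1$; and $$G_n^t(k,l;\zeta_n)=-\sum_{m=0}^k\frac{1}{n^{m+1}}\sum\left(\prod_{a=0}^m\binom{n}{j_a+1}\overline{z}_n(l_a;\zeta_n)\right)(1-t)^{i_0}(-t)^{l-i_0},$$ where the inner sum runs over all integers $i_0,\ldots,i_m,j_0,\ldots,j_m,l_0,\ldots,l_m$ satisfying $i_0+\cdots+i_m=l$, $l_0+\cdots+l_m+j_0+\cdots+j_m=k$, $0\leq i_0\leq j_0\leq n-1$, $1\leq i_a\leq j_a\leq n-1$ for $a=1,\ldots,m$, and $l_0,\ldots,l_m\geq 0$. Here the convention $\overline{z}_n(0;\zeta_n)=-1$ is used.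
   Context: $\mathbb{N}$ is the set of positive integers and $t$ is a formal parameter. For a multi-index $\mathbf{k}=(k_1,\ldots,k_l)\in\mathbb{N}^l$ define the weight $\mathrm{wt}(\mathbf{k})=k_1+\cdots+k_l$ and the depth $\mathrm{dep}(\mathbf{k})=l$. Let $q$ be a complex number with $q^m\ne1$ for every positive integer $m<n$ (e.g. $q=\zeta_n$). For $\mathbf{k}\in\mathbb{N}^l$ with $l\ge 1$, $$\overline{z}_n(\mathbf{k};q)=\sum_{n>m_1>\cdots>m_l>0}\frac{q^{(k_1-1)m_1+\cdots+(k_l-1)m_l}}{(1-q^{m_1})^{k_1}\cdots(1-q^{m_l})^{k_l}},$$ and its interpolated version is $$\overline{z}_n^t(\mathbf{k};q)=\sum_{\mathbf{p}}\overline{z}_n(\mathbf{p};q)\,t^{l-\mathrm{dep}(\mathbf{p})},$$ where the sum runs over all $3^{l-1}$ ways of forming $\mathbf{p}=(k_1\Box\cdots\Box k_l)$ by filling each $\Box$ with "," (comma), "$+$" or "$-1+$". For nonnegative integers $k,l$, $G_n^t(k,l;q)$ is the sum of $\overline{z}_n^t(\mathbf{k};q)$ over all multi-indices $\mathbf{k}$ of weight $k$ and depth $l$; it is $0$ when there are no such multi-indices, except that $G_n^t(0,0;q)=1$. -}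

module Defs where

open import Level using (_⊔_)
open import Algebra.Bundles using (RawRing; CommutativeRing)
open import Algebra.Apartness.Bundles using (HeytingField; HeytingCommutativeRing)
import Algebra.Definitions.RawSemiring as RawSemiringDefs
open import Data.Fin.Base as Fin using (Fin; toℕ)
import Data.Fin.Properties as Fin
open import Data.List.Base as List using (List; []; _∷_; _++_; upTo; allFin)
open import Data.Nat.Base as ℕ using (ℕ; zero; suc; pred; NonZero; _∸_; _≤_; _<_; s≤s; z≤n)
open import Data.Nat.Properties as ℕ using (_≟_; _≤?_; pred-cancel-<)
open import Data.Product.Base using (_×_; _,_; proj₁)
open import Data.Vec.Base as Vec using (Vec; []; _∷_; tail)
open import Data.Vec.Relation.Binary.Pointwise.Inductive as Pointwise using (Pointwise)
open import Data.Vec.Relation.Unary.All as All using (All)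
open import Data.Vec.Relation.Unary.Linked as Linked using (Linked)
open import Relation.Binary.PropositionalEquality.Core using (_≡_)
open import Relation.Nullary.Decidable using (_×-dec_)
open import Relation.Unary using (Decidable)

------------------------------------------------------------------------
-- Polynomials in one formal variable t.  A list holds the coefficients
-- starting from the constant one; trailing zeros are allowed, and
-- equality is equality of all coefficients.

module Polynomial {c ℓ} (R : RawRing c ℓ) where

  private module R = RawRing R

  Poly : Set c
  Poly = List R.Carrier

  coeff : Poly → ℕ → R.Carrier
  coeff []      _       = R.0#
  coeff (a ∷ _) zero    = a
  coeff (_ ∷ p) (suc d) = coeff p d

  infix 4 _≈ₚ_
  _≈ₚ_ : Poly → Poly → Set ℓ
  p ≈ₚ q = ∀ d → coeff p d R.≈ coeff q d

  infixl 6 _+ₚ_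
  _+ₚ_ : Poly → Poly → Poly
  []      +ₚ q       = q
  (a ∷ p) +ₚ []      = a ∷ p
  (a ∷ p) +ₚ (b ∷ q) = (a R.+ b) ∷ (p +ₚ q)

  infix 8 -ₚ_
  -ₚ_ : Poly → Poly
  -ₚ_ = List.map R.-_

  infixl 7 _*ₚ_
  _*ₚ_ : Poly → Poly → Poly
  []      *ₚ q = []
  (a ∷ p) *ₚ q = List.map (a R.*_) q +ₚ (R.0# ∷ (p *ₚ q))

  const : R.Carrier → Poly
  const a = a ∷ []

  0ₚ 1ₚ t : Poly
  0ₚ = []
  1ₚ = const R.1#
  t  = R.0# ∷ R.1# ∷ []

  rawRingₚ : RawRing c ℓ
  rawRingₚ = record
    { Carrier = Poly ; _≈_ = _≈ₚ_ ; _+_ = _+ₚ_ ; _*_ = _*ₚ_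
    ; -_ = -ₚ_ ; 0# = 0ₚ ; 1# = 1ₚ }

  open RawSemiringDefs (RawRing.rawSemiring rawRingₚ) public
    using () renaming (_^_ to infixr 8 _^ₚ_)

  Σₚ : ∀ {a} {A : Set a} → List A → (A → Poly) → Poly
  Σₚ xs f = List.foldr _+ₚ_ 0ₚ (List.map f xs)

------------------------------------------------------------------------
-- Finite index sets.  Each is a box of tuples, large enough to contain
-- every solution of the stated conditions, filtered by these conditions.

tuples : ∀ {a} {A : Set a} → List A → (r : ℕ) → List (Vec A r)
tuples xs zero    = [] ∷ []
tuples xs (suc r) = List.cartesianProductWith _∷_ xs (tuples xs r)

IsMultiIndex : ∀ {l} → ℕ → Vec ℕ l → Set
IsMultiIndex k ks = (Vec.sum ks ≡ k) × All (1 ≤_) ks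

isMultiIndex? : ∀ {l} k → Decidable (IsMultiIndex {l} k)
isMultiIndex? k ks = (Vec.sum ks ≟ k) ×-dec All.all? (1 ≤?_) ks

multiIndices : (k l : ℕ) → List (Vec ℕ l)
multiIndices k l = List.filter (isMultiIndex? k) (tuples (upTo (suc k)) l)

-- fillings k₁ (k₂ , … , k_l) lists all k₁ □ k₂ □ ⋯ □ k_l, where each box is
-- ",", "+" or "-1+", with repetitions.  As the entries are positive, the
-- truncated subtraction is the ordinary one.

fillings : ∀ {r} → ℕ → Vec ℕ r → List (List ℕ)
fillings k []        = (k ∷ []) ∷ []
fillings k (k′ ∷ ks) =  List.map (k ∷_) (fillings k′ ks)
                     ++ fillings (k ℕ.+ k′) ks
                     ++ fillings (k ℕ.+ k′ ∸ 1) ks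

-- In a tuple (x₀ , … , x_m) the entries x₁, …, x_m form its tail.

Index₁ : (n k l m : ℕ) → Vec ℕ (suc m) × Vec ℕ (suc m) → Set
Index₁ n k l m (i , j) =
    (Vec.sum i ≡ l)
  × (Vec.sum j ≡ k)
  × Pointwise _≤_ i j
  × All (_≤ n ∸ 1) j
  × All (1 ≤_) (tail j)

index₁? : ∀ n k l m → Decidable (Index₁ n k l m)
index₁? n k l m (i , j) =
        (Vec.sum i ≟ l)
  ×-dec (Vec.sum j ≟ k)
  ×-dec Pointwise.decidable _≤?_ i j
  ×-dec All.all? (_≤? n ∸ 1) j
  ×-dec All.all? (1 ≤?_) (tail j)

indices₁ : (n k l m : ℕ) → List (Vec ℕ (suc m) × Vec ℕ (suc m))
indices₁ n k l m = List.filter (index₁? n k l m)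
  (List.cartesianProduct (tuples (upTo (suc l)) (suc m))
                         (tuples (upTo (suc k)) (suc m)))

Index₂ : (n k l m : ℕ) → Vec ℕ (suc m) × Vec ℕ (suc m) × Vec ℕ (suc m) → Set
Index₂ n k l m (i , j , ls) =
    (Vec.sum i ≡ l)
  × (Vec.sum ls ℕ.+ Vec.sum j ≡ k)
  × Pointwise _≤_ i j
  × All (_≤ n ∸ 1) j
  × All (1 ≤_) (tail i)

index₂? : ∀ n k l m → Decidable (Index₂ n k l m)
index₂? n k l m (i , j , ls) =
        (Vec.sum i ≟ l)
  ×-dec (Vec.sum ls ℕ.+ Vec.sum j ≟ k)
  ×-dec Pointwise.decidable _≤?_ i j
  ×-dec All.all? (_≤? n ∸ 1) j
  ×-dec All.all? (1 ≤?_) (tail i)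

indices₂ : (n k l m : ℕ) → List (Vec ℕ (suc m) × Vec ℕ (suc m) × Vec ℕ (suc m))
indices₂ n k l m = List.filter (index₂? n k l m)
  (List.cartesianProduct (tuples (upTo (suc l)) (suc m))
    (List.cartesianProduct (tuples (upTo (suc k)) (suc m))
                           (tuples (upTo (suc k)) (suc m))))

------------------------------------------------------------------------
-- Fields of characteristic zero stand in for ℂ.  In a HeytingField, x # y
-- says that x - y is invertible; over a discrete field it is x ≢ y.

module FieldNotions {c ℓ₁ ℓ₂} (F : HeytingField c ℓ₁ ℓ₂) where

  open HeytingField F public
    using (Carrier; _≈_; _#_; _+_; _*_; -_; 0#; 1#)
  open HeytingField F using (#-sym; #⇒invertible)

  rawRing : RawRing c ℓ₁
  rawRing = CommutativeRing.rawRing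
    (HeytingCommutativeRing.commutativeRing (HeytingField.heytingCommutativeRing F))

  private module K = RawSemiringDefs (RawRing.rawSemiring rawRing)

  open K public using (_^_)

  fromℕ : ℕ → Carrier
  fromℕ a = a K.× 1#

  CharacteristicZero : Set ℓ₂
  CharacteristicZero = ∀ a → .{{_ : NonZero a}} → fromℕ a # 0#

  -- 1/(x - y)
  recip- : ∀ {x y} → x # y → Carrier
  recip- x#y = proj₁ (#⇒invertible x#y)

  record IsPrimitiveRoot (n : ℕ) (ζ : Carrier) : Set (ℓ₁ ⊔ ℓ₂) where
    field
      power-n  : ζ ^ n ≈ 1#
      power-#1 : ∀ m → 1 ≤ m → m < n → ζ ^ m # 1#

  sumOver : ∀ {a} {A : Set a} → List A → (A → Carrier) → Carrier
  sumOver xs f = List.foldr _+_ 0# (List.map f xs)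

  prod : ∀ {r} → Vec Carrier r → Carrier
  prod = Vec.foldr′ _*_ 1#

  open Polynomial rawRing public

  module MultipleHarmonicSums
    (n : ℕ) (q : Carrier) (q^m#1 : ∀ m → 1 ≤ m → m < n → q ^ m # 1#)
    where

    -- The index i : Fin (pred n) represents the integer m = suc (toℕ i),
    -- which ranges over 0 < m < n.

    summand : ℕ → Fin (pred n) → Carrier
    summand k i = q ^ ((k ∸ 1) ℕ.* m) * recip- 1#q^m ^ k
      where
      m     = suc (toℕ i)
      1#q^m = #-sym (q^m#1 m (s≤s z≤n) (pred-cancel-< (Fin.toℕ<n i)))

    -- n > m₁ > ⋯ > m_l > 0
    decreasing : (l : ℕ) → List (Vec (Fin (pred n)) l)
    decreasing l = List.filter (Linked.linked? (λ i j → j Fin.<? i))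
                               (tuples (allFin (pred n)) l)

    z̄ : List ℕ → Carrier
    z̄ ks = sumOver (decreasing (List.length ks)) λ ms →
      prod (Vec.zipWith summand (Vec.fromList ks) ms)

    -- z̄(a) for a single argument a ≥ 0, with the convention z̄(0) = -1
    z̄₁ : ℕ → Carrier
    z̄₁ zero      = - 1#
    z̄₁ a@(suc _) = z̄ (a ∷ [])

    z̄ᵗ : ∀ {r} → Vec ℕ (suc r) → Poly
    z̄ᵗ {r} (k ∷ ks) = Σₚ (fillings k ks) λ p →
      const (z̄ p) *ₚ t ^ₚ (suc r ∸ List.length p)

    G : (k l : ℕ) → Poly
    G zero    zero    = 1ₚ
    G (suc _) zero    = 0ₚ
    G k       (suc r) = Σₚ (multiIndices k (suc r)) z̄ᵗ

{-# OPTIONS --safe #-}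

module Submission where

-- Write u = q^m / (1 - q^m), so that the m-th summand of exponent k is
-- s(k) = u^(k-1) + u^k.  Then s(k) s(k′) = s(k+k′) + s(k+k′-1), and therefore the
-- sum over all fillings is a sum over m₁ ≥ ⋯ ≥ m_l weighted by a factor t for each
-- equality.  Adding one value of m at a time, the generating function
-- Σ G(k,l) X^k Y^l becomes the product over 0 < m < n of
--
--   (1 + (1-t) X Y - q^m (1+X)) / (1 - t X Y - q^m (1+X)).
--
-- For q = ζ_n the product of all A - q^m B is Σ_{i<n} A^i B^(n-1-i).  With
-- A = 1 + w X Y and B = 1 + X this is
--
--   D(w) = Σ_j C(n,j+1) X^j Σ_{i≤j} (w Y)^i,
--
-- so the generating function is D(1-t) / D(-t).  Both formulas expand 1 / D(-t) as
-- a geometric series: the first one around its constant coefficient n, the second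
-- one around the part D₀ of D(-t) free of Y, whose inverse is - Z / n for
-- Z = Σ_a z̄(a) X^a.  The latter holds because D₀ times the m-th term of 1 + Z is
-- - Σ_{i<n} (q^m (1+X))^i, and Σ_{m<n} q^(m i) vanishes for 0 < i < n.
--
-- Power series are truncated at the degrees of the coefficient to be compared, and
-- a sum over filtered tuples is read off as a coefficient of a product of sums.

open import Defs
open import Algebra.Apartness.Bundles using (HeytingField; HeytingCommutativeRing)
open import Algebra.Bundles using (CommutativeRing; RawRing)
import Algebra.Definitions.RawSemiring
import Algebra.Morphism.Construct.Composition as Composition
open import Algebra.Morphism.Structures using (IsRingHomomorphism)
import Algebra.Properties.AbelianGroup
import Algebra.Properties.CommutativeSemiring.Exp
import Algebra.Properties.Monoid.Mult
import Algebra.Properties.Ring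
import Algebra.Properties.Semiring.Exp
import Algebra.Properties.Semiring.Mult
import Algebra.Solver.Ring
open import Algebra.Solver.Ring.AlmostCommutativeRing
  using (fromCommutativeRing; _-Raw-AlmostCommutative⟶_)
open import Data.Bool.Base using (Bool; true; false; _∧_)
open import Data.Empty using (⊥-elim)
open import Data.Fin.Base as Fin using (Fin; toℕ; fromℕ<)
import Data.Fin.Properties as Fin
open import Data.Integer.Base as ℤ using (ℤ; +_; -[1+_])
import Data.Integer.Properties as ℤ
open import Data.List.Base as List
  using (List; []; _∷_; _++_; length; upTo; applyUpTo; allFin; tabulate; filter; cartesianProduct; cartesianProductWith)
import Data.List.Relation.Unary.All as ListAll
import Data.List.Relation.Unary.All.Properties as ListAll
open import Data.Maybe.Base using (Maybe; just; nothing)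
open import Data.Nat.Base as ℕ using (ℕ; zero; suc; NonZero; _∸_; _≤_; _<_; z≤n; s≤s)
open import Data.Nat.Combinatorics using (_C_; nCk+nC[k+1]≡[n+1]C[k+1]; k>n⇒nCk≡0; nC1≡n)
import Data.Nat.Properties as ℕ
open import Data.Nat.Properties using (_≤?_; _<?_; _≟_; pred-cancel-<)
open import Algebra.Properties.CommutativeSemigroup ℕ.+-commutativeSemigroup using (interchange)
open import Data.Product.Base using (_×_; _,_; ∃; proj₂)
import Data.Sign.Base as Sign
open import Data.Vec.Base as Vec using (Vec; []; _∷_; head; tail; map; zipWith)
import Data.Vec.Relation.Binary.Pointwise.Inductive as Pointwise
import Data.Vec.Relation.Unary.Linked as Linked
open import Data.Vec.Relation.Unary.All as All using (All; []; _∷_)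
open import Function.Base using (_∘_; id)
open import Level using (Level)
open import Relation.Binary.PropositionalEquality as ≡ using (_≡_)
import Relation.Binary.Reasoning.Setoid
open import Relation.Nullary using (Dec; does; yes; no; ¬_)
open import Relation.Nullary.Decidable using (dec-true)
open import Relation.Unary using (Pred; Decidable)

-- The identities are therefore proved in an arbitrary commutative ring, where all that is known of
-- `q` is `q ^ n ≈ 1#` together with chosen inverses of `1 - q^m` for `0 < m < n`, and where `n` has
-- a chosen inverse. Such data pass along ring homomorphisms. This carries the argument through
-- three rings: the field, its extension by `t` modulo `t^(d+1)` when the coefficients of `t^d` are
-- compared, and the extension of that ring by `X` and `Y`. For most of the proof `t` is thus an
-- ordinary ring element. For the same reason the evaluation of the product of all `x - q^m` as
-- `1 + x + ⋯ + x^(n-1)` does not compare roots: the behaviour of the product under the substitution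
-- of `q x` for `x` forces neighbouring coefficients to agree.

module RingTools {c ℓ} (R : CommutativeRing c ℓ) where

  open CommutativeRing R public hiding (zero)
  open Algebra.Properties.Monoid.Mult +-monoid public
    using (×-homo-+) renaming (_×_ to infixr 8 _·_)
  open Algebra.Properties.Semiring.Mult semiring public using (×1-homo-*)
  open Algebra.Properties.Semiring.Exp semiring public
    using (_^_; ^-homo-*; ^-congˡ)
  open Algebra.Properties.CommutativeSemiring.Exp commutativeSemiring public
    using (^-distrib-*)
  open Algebra.Properties.Ring ring public
    using (-‿distribʳ-*; -0#≈0#)
  open Algebra.Properties.AbelianGroup +-abelianGroup public using (⁻¹-∙-comm)
  open Relation.Binary.Reasoning.Setoid setoid public

  -- A solver with integer coefficients, so that cancellation is recognised
  -- although equality in R need not be decidable.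

  private
    ⟦_⟧ : ℤ → Carrier
    ⟦ + 0 ⟧      = 0#
    ⟦ + 1 ⟧      = 1#
    ⟦ + n ⟧      = n · 1#
    ⟦ -[1+ 0 ] ⟧ = - 1#
    ⟦ -[1+ n ] ⟧ = - (suc n · 1#)

    ε : Sign.Sign → Carrier
    ε Sign.+ = 1#
    ε Sign.- = - 1#

    neg-involutive : ∀ x → - (- x) ≈ x
    neg-involutive = Algebra.Properties.Ring.-‿involutive ring

    -1*x≈-x : ∀ x → - 1# * x ≈ - x
    -1*x≈-x = Algebra.Properties.Ring.-1*x≈-x ring

    ⟦+_⟧ : ∀ n → ⟦ + n ⟧ ≈ n · 1#
    ⟦+ 0 ⟧           = refl
    ⟦+ 1 ⟧           = sym (+-identityʳ 1#)
    ⟦+ suc (suc n) ⟧ = refl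

    ⟦-[1+_]⟧ : ∀ n → ⟦ -[1+ n ] ⟧ ≈ - (suc n · 1#)
    ⟦-[1+ 0 ]⟧     = -‿cong (sym (+-identityʳ 1#))
    ⟦-[1+ suc n ]⟧ = refl

    ⟦-⟧ : ∀ i → ⟦ ℤ.- i ⟧ ≈ - ⟦ i ⟧
    ⟦-⟧ (+ 0)           = sym -0#≈0#
    ⟦-⟧ (+ 1)           = refl
    ⟦-⟧ (+ suc (suc n)) = refl
    ⟦-⟧ -[1+ 0 ]        = sym (neg-involutive _)
    ⟦-⟧ -[1+ suc n ]    = sym (neg-involutive _)

    ⟦⊖⟧ : ∀ m n → ⟦ m ℤ.⊖ n ⟧ ≈ m · 1# - n · 1#
    ⟦⊖⟧ m zero rewrite ℤ.⊖-≥ {m} {0} z≤n = trans ⟦+ m ⟧ (sym (trans (+-congˡ -0#≈0#) (+-identityʳ _)))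
    ⟦⊖⟧ zero (suc n) = trans ⟦-[1+ n ]⟧ (sym (+-identityˡ _))
    ⟦⊖⟧ (suc m) (suc n) rewrite ℤ.[1+m]⊖[1+n]≡m⊖n m n = begin
      ⟦ m ℤ.⊖ n ⟧                               ≈⟨ ⟦⊖⟧ m n ⟩
      m · 1# - n · 1#                           ≈⟨ +-congʳ (+-identityʳ _) ⟨
      m · 1# + 0# - n · 1#                      ≈⟨ +-congʳ (+-congˡ (-‿inverseʳ 1#)) ⟨
      m · 1# + (1# - 1#) - n · 1#               ≈⟨ +-congʳ (+-assoc _ _ _) ⟨
      m · 1# + 1# - 1# - n · 1#                 ≈⟨ +-assoc _ _ _ ⟩
      m · 1# + 1# + (- 1# - n · 1#)             ≈⟨ +-cong (+-comm _ _) (⁻¹-∙-comm _ _) ⟩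
      suc m · 1# - suc n · 1#                   ∎

    ⟦+⟧ : ∀ i j → ⟦ i ℤ.+ j ⟧ ≈ ⟦ i ⟧ + ⟦ j ⟧
    ⟦+⟧ (+ m)    (+ n)    = begin
      ⟦ + (m ℕ.+ n) ⟧    ≈⟨ ⟦+ m ℕ.+ n ⟧ ⟩
      (m ℕ.+ n) · 1#     ≈⟨ ×-homo-+ 1# m n ⟩
      m · 1# + n · 1#    ≈⟨ +-cong ⟦+ m ⟧ ⟦+ n ⟧ ⟨
      ⟦ + m ⟧ + ⟦ + n ⟧  ∎
    ⟦+⟧ (+ m)    -[1+ n ] = trans (⟦⊖⟧ m (suc n)) (+-cong (sym ⟦+ m ⟧) (sym ⟦-[1+ n ]⟧))
    ⟦+⟧ -[1+ m ] (+ n)    = begin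
      ⟦ n ℤ.⊖ suc m ⟧          ≈⟨ ⟦⊖⟧ n (suc m) ⟩
      n · 1# - suc m · 1#      ≈⟨ +-comm _ _ ⟩
      - (suc m · 1#) + n · 1#  ≈⟨ +-cong ⟦-[1+ m ]⟧ ⟦+ n ⟧ ⟨
      ⟦ -[1+ m ] ⟧ + ⟦ + n ⟧   ∎
    ⟦+⟧ -[1+ m ] -[1+ n ] = begin
      - (suc (suc (m ℕ.+ n)) · 1#)     ≡⟨ ≡.cong (λ k → - (suc k · 1#)) (ℕ.+-suc m n) ⟨
      - ((suc m ℕ.+ suc n) · 1#)       ≈⟨ -‿cong (×-homo-+ 1# (suc m) (suc n)) ⟩
      - (suc m · 1# + suc n · 1#)      ≈⟨ ⁻¹-∙-comm _ _ ⟨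
      - (suc m · 1#) - suc n · 1#      ≈⟨ +-cong ⟦-[1+ m ]⟧ ⟦-[1+ n ]⟧ ⟨
      ⟦ -[1+ m ] ⟧ + ⟦ -[1+ n ] ⟧      ∎

    ⟦◃⟧ : ∀ s n → ⟦ s ℤ.◃ n ⟧ ≈ ε s * (n · 1#)
    ⟦◃⟧ s      zero    = sym (zeroʳ _)
    ⟦◃⟧ Sign.+ (suc n) = trans ⟦+ suc n ⟧ (sym (*-identityˡ _))
    ⟦◃⟧ Sign.- (suc n) = trans ⟦-[1+ n ]⟧ (sym (-1*x≈-x _))

    ε-* : ∀ s t → ε (s Sign.* t) ≈ ε s * ε t
    ε-* Sign.+ t      = sym (*-identityˡ _)
    ε-* Sign.- Sign.+ = sym (*-identityʳ _)
    ε-* Sign.- Sign.- = sym (trans (-1*x≈-x _) (neg-involutive _))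

    sign-abs : ∀ i → ⟦ i ⟧ ≈ ε (ℤ.sign i) * (ℤ.∣ i ∣ · 1#)
    sign-abs (+ n)    = trans ⟦+ n ⟧ (sym (*-identityˡ _))
    sign-abs -[1+ n ] = trans ⟦-[1+ n ]⟧ (sym (-1*x≈-x _))

    *-interchange : ∀ a b c d → (a * b) * (c * d) ≈ (a * c) * (b * d)
    *-interchange a b c d = begin
      (a * b) * (c * d) ≈⟨ *-assoc _ _ _ ⟩
      a * (b * (c * d)) ≈⟨ *-congˡ (*-assoc _ _ _) ⟨
      a * ((b * c) * d) ≈⟨ *-congˡ (*-congʳ (*-comm _ _)) ⟩
      a * ((c * b) * d) ≈⟨ *-congˡ (*-assoc _ _ _) ⟩
      a * (c * (b * d)) ≈⟨ *-assoc _ _ _ ⟨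
      (a * c) * (b * d) ∎

    ⟦*⟧ : ∀ i j → ⟦ i ℤ.* j ⟧ ≈ ⟦ i ⟧ * ⟦ j ⟧
    ⟦*⟧ i j = begin
      ⟦ i ℤ.* j ⟧                                ≈⟨ ⟦◃⟧ (ℤ.sign i Sign.* ℤ.sign j) (ℤ.∣ i ∣ ℕ.* ℤ.∣ j ∣) ⟩
      ε (ℤ.sign i Sign.* ℤ.sign j) * ((ℤ.∣ i ∣ ℕ.* ℤ.∣ j ∣) · 1#)
        ≈⟨ *-cong (ε-* (ℤ.sign i) (ℤ.sign j)) (×1-homo-* ℤ.∣ i ∣ ℤ.∣ j ∣) ⟩
      (ε (ℤ.sign i) * ε (ℤ.sign j)) * ((ℤ.∣ i ∣ · 1#) * (ℤ.∣ j ∣ · 1#))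
        ≈⟨ *-interchange _ _ _ _ ⟩
      (ε (ℤ.sign i) * (ℤ.∣ i ∣ · 1#)) * (ε (ℤ.sign j) * (ℤ.∣ j ∣ · 1#))
        ≈⟨ *-cong (sign-abs i) (sign-abs j) ⟨
      ⟦ i ⟧ * ⟦ j ⟧ ∎

    ℤ⟶R : ℤ.+-*-rawRing -Raw-AlmostCommutative⟶ fromCommutativeRing R
    ℤ⟶R = record
      { ⟦_⟧ = ⟦_⟧ ; +-homo = ⟦+⟧ ; *-homo = ⟦*⟧ ; -‿homo = ⟦-⟧
      ; 0-homo = refl ; 1-homo = refl }

    _≟ᶜ_ : ∀ i j → Maybe (⟦ i ⟧ ≈ ⟦ j ⟧)
    i ≟ᶜ j with i ℤ.≟ j
    ... | yes i≡j = just (reflexive (≡.cong ⟦_⟧ i≡j))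
    ... | no  _   = nothing

  open Algebra.Solver.Ring ℤ.+-*-rawRing (fromCommutativeRing R) ℤ⟶R _≟ᶜ_ public
    using (solve; con; _:=_; _:+_; _:*_; _:-_; :-_)

-- Finite sums, indicators and powers in a commutative ring.

module Sums {c ℓ} (R : CommutativeRing c ℓ) where

  open RingTools R public

  private
    variable
      a b d p : Level
      A : Set a
      B : Set b
      D : Set d

  ∑ : List A → (A → Carrier) → Carrier
  ∑ xs f = List.foldr _+_ 0# (List.map f xs)

  ∑-cong : ∀ (xs : List A) {f g} → (∀ x → f x ≈ g x) → ∑ xs f ≈ ∑ xs g
  ∑-cong []       f≈g = refl
  ∑-cong (x ∷ xs) f≈g = +-cong (f≈g x) (∑-cong xs f≈g)

  ∑-zero : ∀ (xs : List A) {f} → (∀ x → f x ≈ 0#) → ∑ xs f ≈ 0#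
  ∑-zero []       f≈0 = refl
  ∑-zero (x ∷ xs) f≈0 = trans (+-cong (f≈0 x) (∑-zero xs f≈0)) (+-identityʳ 0#)

  ∑-+ : ∀ (xs : List A) f g → ∑ xs (λ x → f x + g x) ≈ ∑ xs f + ∑ xs g
  ∑-+ []       f g = sym (+-identityʳ 0#)
  ∑-+ (x ∷ xs) f g = trans (+-congˡ (∑-+ xs f g))
    (solve 4 (λ a b c d → (a :+ b) :+ (c :+ d) := (a :+ c) :+ (b :+ d)) refl _ _ _ _)

  *-∑ : ∀ y (xs : List A) f → y * ∑ xs f ≈ ∑ xs (λ x → y * f x)
  *-∑ y []       f = zeroʳ y
  *-∑ y (x ∷ xs) f = trans (distribˡ y _ _) (+-congˡ (*-∑ y xs f))

  ∑-* : ∀ (xs : List A) f y → ∑ xs f * y ≈ ∑ xs (λ x → f x * y)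
  ∑-* []       f y = zeroˡ y
  ∑-* (x ∷ xs) f y = trans (distribʳ y _ _) (+-congˡ (∑-* xs f y))

  ∑-neg : ∀ (xs : List A) f → - ∑ xs f ≈ ∑ xs (λ x → - f x)
  ∑-neg []       f = -0#≈0#
  ∑-neg (x ∷ xs) f = trans (sym (⁻¹-∙-comm _ _)) (+-congˡ (∑-neg xs f))

  ∑-++ : ∀ (xs ys : List A) f → ∑ (xs ++ ys) f ≈ ∑ xs f + ∑ ys f
  ∑-++ []       ys f = sym (+-identityˡ _)
  ∑-++ (x ∷ xs) ys f = trans (+-congˡ (∑-++ xs ys f)) (sym (+-assoc _ _ _))

  ∑-map : ∀ (h : A → B) xs f → ∑ (List.map h xs) f ≈ ∑ xs (f ∘ h)
  ∑-map h []       f = refl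
  ∑-map h (x ∷ xs) f = +-congˡ (∑-map h xs f)

  ∑-swap : ∀ (xs : List A) (ys : List B) (f : A → B → Carrier) →
           ∑ xs (λ x → ∑ ys (f x)) ≈ ∑ ys (λ y → ∑ xs (λ x → f x y))
  ∑-swap []       ys f = sym (∑-zero ys λ _ → refl)
  ∑-swap (x ∷ xs) ys f = trans (+-congˡ (∑-swap xs ys f)) (sym (∑-+ ys (f x) _))

  ∑-cartesianProductWith : ∀ (h : A → B → D) xs ys f →
    ∑ (cartesianProductWith h xs ys) f ≈ ∑ xs (λ x → ∑ ys (λ y → f (h x y)))
  ∑-cartesianProductWith h []       ys f = refl
  ∑-cartesianProductWith h (x ∷ xs) ys f = trans (∑-++ (List.map (h x) ys) _ f)
    (+-cong (∑-map (h x) ys f) (∑-cartesianProductWith h xs ys f))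

  ∑-*-∑ : ∀ (xs : List A) (ys : List B) f g →
          ∑ xs f * ∑ ys g ≈ ∑ xs (λ x → ∑ ys (λ y → f x * g y))
  ∑-*-∑ xs ys f g = trans (∑-* xs f _) (∑-cong xs λ x → *-∑ (f x) ys g)

  -- Indicators turn filters into factors. Filtered sums become sums over full boxes, which factor
  -- and commute freely, and a condition on a tuple splits into conditions on its entries.
  χ : Bool → Carrier
  χ false = 0#
  χ true  = 1#

  χ-∧ : ∀ x y → χ (x ∧ y) ≈ χ x * χ y
  χ-∧ false y = sym (zeroˡ _)
  χ-∧ true  y = sym (*-identityˡ _)

  χ-false : ∀ {P : Set p} (P? : Dec P) → ¬ P → χ (does P?) ≈ 0#
  χ-false (yes p) ¬p = ⊥-elim (¬p p)
  χ-false (no _)  ¬p = refl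

  -- Allows an equation that holds only under the filtering condition to be used inside an
  -- unfiltered sum.
  χ-guard : ∀ {P : Set p} (P? : Dec P) {x y} → (P → x ≈ y) →
            χ (does P?) * x ≈ χ (does P?) * y
  χ-guard (yes p) x≈y = *-congˡ (x≈y p)
  χ-guard (no ¬p) x≈y = trans (zeroˡ _) (sym (zeroˡ _))

  χ-redundant : ∀ {P : Set p} (P? : Dec P) {x} → (¬ P → x ≈ 0#) → χ (does P?) * x ≈ x
  χ-redundant (yes p) x≈0 = *-identityˡ _
  χ-redundant (no ¬p) x≈0 = trans (zeroˡ _) (sym (x≈0 ¬p))

  ∑-filter : ∀ {P : Pred A p} (P? : Decidable P) xs f →
             ∑ (filter P? xs) f ≈ ∑ xs (λ x → χ (does (P? x)) * f x)
  ∑-filter P? []       f = refl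
  ∑-filter P? (x ∷ xs) f with does (P? x)
  ... | false = trans (∑-filter P? xs f) (sym (trans (+-congʳ (zeroˡ _)) (+-identityˡ _)))
  ... | true  = +-cong (sym (*-identityˡ _)) (∑-filter P? xs f)

  ∑-tuples-suc : ∀ (xs : List A) r f →
    ∑ (tuples xs (suc r)) f ≈ ∑ xs (λ x → ∑ (tuples xs r) (λ v → f (x ∷ v)))
  ∑-tuples-suc xs r f = ∑-cartesianProductWith _∷_ xs (tuples xs r) f

  private
    ∑-applyUpTo : ∀ n (h : ℕ → ℕ) f → ∑ (applyUpTo h n) f ≈ ∑ (upTo n) (f ∘ h)
    ∑-applyUpTo zero    h f = refl
    ∑-applyUpTo (suc n) h f = +-congˡ (trans (∑-applyUpTo n (h ∘ suc) f)
      (sym (∑-applyUpTo n suc (f ∘ h))))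

  ∑-upTo-first : ∀ n f → ∑ (upTo (suc n)) f ≈ f 0 + ∑ (upTo n) (f ∘ suc)
  ∑-upTo-first n f = +-congˡ (∑-applyUpTo n suc f)

  ∑-upTo-last : ∀ n f → ∑ (upTo (suc n)) f ≈ ∑ (upTo n) f + f n
  ∑-upTo-last zero    f = +-comm _ _
  ∑-upTo-last (suc n) f = begin
    ∑ (upTo (suc (suc n))) f                ≈⟨ ∑-upTo-first (suc n) f ⟩
    f 0 + ∑ (upTo (suc n)) (f ∘ suc)        ≈⟨ +-congˡ (∑-upTo-last n (f ∘ suc)) ⟩
    f 0 + (∑ (upTo n) (f ∘ suc) + f (suc n)) ≈⟨ +-assoc _ _ _ ⟨
    f 0 + ∑ (upTo n) (f ∘ suc) + f (suc n)  ≈⟨ +-congʳ (∑-upTo-first n f) ⟨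
    ∑ (upTo (suc n)) f + f (suc n)          ∎

  ∑-upTo-cong : ∀ n {f g} → (∀ i → i < n → f i ≈ g i) → ∑ (upTo n) f ≈ ∑ (upTo n) g
  ∑-upTo-cong zero    f≈g = refl
  ∑-upTo-cong (suc n) {f} {g} f≈g = begin
    ∑ (upTo (suc n)) f ≈⟨ ∑-upTo-last n f ⟩
    ∑ (upTo n) f + f n ≈⟨ +-cong (∑-upTo-cong n λ i i<n → f≈g i (ℕ.m<n⇒m<1+n i<n)) (f≈g n (ℕ.n<1+n n)) ⟩
    ∑ (upTo n) g + g n ≈⟨ ∑-upTo-last n g ⟨
    ∑ (upTo (suc n)) g ∎

  ∑-upTo-extend : ∀ {m} n f → m ≤ n → (∀ i → m ≤ i → f i ≈ 0#) →
                  ∑ (upTo n) f ≈ ∑ (upTo m) f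
  ∑-upTo-extend {m} n f m≤n f≈0 = go (ℕ.≤⇒≤′ m≤n)
    where
    go : ∀ {n} → m ℕ.≤′ n → ∑ (upTo n) f ≈ ∑ (upTo m) f
    go (ℕ.≤′-reflexive ≡.refl) = refl
    go (ℕ.≤′-step {n} m≤n) = begin
      ∑ (upTo (suc n)) f ≈⟨ ∑-upTo-last n f ⟩
      ∑ (upTo n) f + f n ≈⟨ +-cong (go m≤n) (f≈0 n (ℕ.≤′⇒≤ m≤n)) ⟩
      ∑ (upTo m) f + 0#  ≈⟨ +-identityʳ _ ⟩
      ∑ (upTo m) f       ∎

  ∏ : ℕ → (ℕ → Carrier) → Carrier
  ∏ zero    f = 1#
  ∏ (suc n) f = ∏ n f * f n

  1^ : ∀ n → 1# ^ n ≈ 1#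
  1^ zero    = refl
  1^ (suc n) = trans (*-identityˡ _) (1^ n)

  ^-* : ∀ x m n → x ^ (m ℕ.* n) ≈ (x ^ n) ^ m
  ^-* x zero    n = refl
  ^-* x (suc m) n = trans (^-homo-* x n (m ℕ.* n)) (*-congˡ (^-* x m n))

  ^-comm : ∀ x m n → (x ^ m) ^ n ≈ (x ^ n) ^ m
  ^-comm x m n = begin
    (x ^ m) ^ n   ≈⟨ ^-* x n m ⟨
    x ^ (n ℕ.* m) ≡⟨ ≡.cong (x ^_) (ℕ.*-comm n m) ⟩
    x ^ (m ℕ.* n) ≈⟨ ^-* x m n ⟩
    (x ^ n) ^ m   ∎

  ^-vanish : ∀ {x m n} → m ≤ n → x ^ m ≈ 0# → x ^ n ≈ 0#
  ^-vanish {x} {m} {n} m≤n xᵐ≈0 = begin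
    x ^ n                   ≡⟨ ≡.cong (x ^_) (ℕ.m+[n∸m]≡n m≤n) ⟨
    x ^ (m ℕ.+ (n ℕ.∸ m))   ≈⟨ ^-homo-* x m (n ℕ.∸ m) ⟩
    x ^ m * x ^ (n ℕ.∸ m)   ≈⟨ *-congʳ xᵐ≈0 ⟩
    0# * x ^ (n ℕ.∸ m)      ≈⟨ zeroˡ _ ⟩
    0#                      ∎

  geometric : ∀ x n → (1# - x) * ∑ (upTo n) (x ^_) ≈ 1# - x ^ n
  geometric x zero    = trans (zeroʳ _) (sym (-‿inverseʳ 1#))
  geometric x (suc n) = begin
    (1# - x) * ∑ (upTo (suc n)) (x ^_)                ≈⟨ *-congˡ (∑-upTo-last n (x ^_)) ⟩
    (1# - x) * (∑ (upTo n) (x ^_) + x ^ n)            ≈⟨ distribˡ _ _ _ ⟩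
    (1# - x) * ∑ (upTo n) (x ^_) + (1# - x) * x ^ n   ≈⟨ +-congʳ (geometric x n) ⟩
    1# - x ^ n + (1# - x) * x ^ n
      ≈⟨ solve 2 (λ x y → con (+ 1) :- y :+ (con (+ 1) :- x) :* y := con (+ 1) :- x :* y) refl x (x ^ n) ⟩
    1# - x ^ suc n ∎

  -- `(d + y) e = 1 + y e`, and the geometric series in `- (y e)` terminates because `y` is
  -- nilpotent. Taken with `suc k` in place of `k`, its length is the origin of the range
  -- `0 ≤ m ≤ k` in both formulas.
  nilpotent-inverse : ∀ {d e y} k → d * e ≈ 1# → y ^ k ≈ 0# →
    (d + y) * ∑ (upTo k) (λ m → e * (- (y * e)) ^ m) ≈ 1#
  nilpotent-inverse {d} {e} {y} k de≈1 yᵏ≈0 = begin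
    (d + y) * ∑ (upTo k) (λ m → e * x ^ m) ≈⟨ *-congˡ (*-∑ e (upTo k) (x ^_)) ⟨
    (d + y) * (e * ∑ (upTo k) (x ^_))      ≈⟨ *-assoc _ _ _ ⟨
    (d + y) * e * ∑ (upTo k) (x ^_)        ≈⟨ *-congʳ (distribʳ e d y) ⟩
    (d * e + y * e) * ∑ (upTo k) (x ^_)
      ≈⟨ *-congʳ (trans (+-congʳ de≈1) (solve 1 (λ z → con (+ 1) :+ z := con (+ 1) :- (:- z)) refl (y * e))) ⟩
    (1# - x) * ∑ (upTo k) (x ^_)           ≈⟨ geometric x k ⟩
    1# - x ^ k                             ≈⟨ +-congˡ (-‿cong xᵏ≈0) ⟩
    1# - 0#                                ≈⟨ solve 0 (con (+ 1) :- con (+ 0) := con (+ 1)) refl ⟩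
    1#                                     ∎
    where
    x = - (y * e)
    xᵏ≈0 : x ^ k ≈ 0#
    xᵏ≈0 = begin
      (- (y * e)) ^ k   ≈⟨ ^-congˡ k (-‿distribʳ-* y e) ⟩
      (y * - e) ^ k     ≈⟨ ^-distrib-* y (- e) k ⟩
      y ^ k * (- e) ^ k ≈⟨ *-congʳ yᵏ≈0 ⟩
      0# * (- e) ^ k    ≈⟨ zeroˡ _ ⟩
      0#                ∎

  prod : ∀ {m} → Vec Carrier m → Carrier
  prod = Vec.foldr′ _*_ 1#

  product₂ : ∀ {m} → (ℕ → ℕ → Carrier) → Vec ℕ m → Vec ℕ m → Carrier
  product₂ w []       []       = 1#
  product₂ w (i ∷ is) (j ∷ js) = w i j * product₂ w is js

  product₃ : ∀ {m} → (ℕ → ℕ → ℕ → Carrier) → Vec ℕ m → Vec ℕ m → Vec ℕ m → Carrier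
  product₃ w []       []       []       = 1#
  product₃ w (i ∷ is) (j ∷ js) (e ∷ es) = w i j e * product₃ w is js es

-- Truncated power series and ring homomorphisms.

-- R[x] / (x^(K+1)): all power series, with equality up to degree K.

module Truncated {c ℓ} (R : CommutativeRing c ℓ) where

  open Sums R

  -- The Cauchy product. Shifting the first factor in the recursion avoids any subtraction of
  -- degrees.
  conv : (ℕ → Carrier) → (ℕ → Carrier) → ℕ → Carrier
  conv f g zero    = f 0 * g 0
  conv f g (suc d) = f 0 * g (suc d) + conv (f ∘ suc) g d

  -- Degree `d` of a product sees only degrees up to `d` of the factors; this makes agreement up to
  -- a fixed degree compatible with multiplication.
  conv-cong : ∀ d {f f′ g g′} → (∀ e → e ≤ d → f e ≈ f′ e) → (∀ e → e ≤ d → g e ≈ g′ e) →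
              conv f g d ≈ conv f′ g′ d
  conv-cong zero    f≈f′ g≈g′ = *-cong (f≈f′ 0 z≤n) (g≈g′ 0 z≤n)
  conv-cong (suc d) f≈f′ g≈g′ = +-cong
    (*-cong (f≈f′ 0 z≤n) (g≈g′ (suc d) ℕ.≤-refl))
    (conv-cong d (λ e e≤d → f≈f′ (suc e) (s≤s e≤d)) (λ e e≤d → g≈g′ e (ℕ.m≤n⇒m≤1+n e≤d)))

  -- Splits the sum at the end opposite to the definition, which is what the induction for
  -- commutativity meets after exchanging the factors.
  conv-last : ∀ f g d → conv f g (suc d) ≈ conv f (g ∘ suc) d + f (suc d) * g 0
  conv-last f g zero    = refl
  conv-last f g (suc d) = trans (+-congˡ (conv-last (f ∘ suc) g d)) (sym (+-assoc _ _ _))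

  conv-comm : ∀ f g d → conv f g d ≈ conv g f d
  conv-comm f g zero    = *-comm _ _
  conv-comm f g (suc d) = begin
    f 0 * g (suc d) + conv (f ∘ suc) g d ≈⟨ +-cong (*-comm _ _) (conv-comm (f ∘ suc) g d) ⟩
    g (suc d) * f 0 + conv g (f ∘ suc) d ≈⟨ +-comm _ _ ⟩
    conv g (f ∘ suc) d + g (suc d) * f 0 ≈⟨ conv-last g f d ⟨
    conv g f (suc d)                     ∎

  -- Scaling and addition are treated together because unfolding `conv f g (suc e)` in the proof of
  -- associativity produces this combination.
  conv-linear : ∀ a f f′ g d → conv (λ e → a * f e + f′ e) g d ≈ a * conv f g d + conv f′ g d
  conv-linear a f f′ g zero    =
    solve 4 (λ a b c d → (a :* b :+ c) :* d := a :* (b :* d) :+ c :* d) refl a (f 0) (f′ 0) (g 0)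
  conv-linear a f f′ g (suc d) = trans (+-congˡ (conv-linear a (f ∘ suc) (f′ ∘ suc) g d))
    (solve 6 (λ a b c d e h → (a :* b :+ c) :* d :+ (a :* e :+ h) := a :* (b :* d :+ e) :+ (c :* d :+ h)) refl
      a (f 0) (f′ 0) (g (suc d)) (conv (f ∘ suc) g d) (conv (f′ ∘ suc) g d))

  conv-zero : ∀ g d → conv (λ _ → 0#) g d ≈ 0#
  conv-zero g zero    = zeroˡ _
  conv-zero g (suc d) = trans (+-cong (zeroˡ _) (conv-zero g d)) (+-identityʳ 0#)

  conv-assoc : ∀ f g h d → conv (conv f g) h d ≈ conv f (conv g h) d
  conv-assoc f g h zero    = *-assoc _ _ _
  conv-assoc f g h (suc d) = begin
    f 0 * g 0 * h (suc d) + conv (λ e → f 0 * g (suc e) + conv (f ∘ suc) g e) h d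
      ≈⟨ +-congˡ (conv-linear (f 0) (g ∘ suc) (conv (f ∘ suc) g) h d) ⟩
    f 0 * g 0 * h (suc d) + (f 0 * conv (g ∘ suc) h d + conv (conv (f ∘ suc) g) h d)
      ≈⟨ +-congˡ (+-congˡ (conv-assoc (f ∘ suc) g h d)) ⟩
    f 0 * g 0 * h (suc d) + (f 0 * conv (g ∘ suc) h d + conv (f ∘ suc) (conv g h) d)
      ≈⟨ solve 5 (λ a b c e k → a :* b :* c :+ (a :* e :+ k) := a :* (b :* c :+ e) :+ k) refl
           (f 0) (g 0) (h (suc d)) (conv (g ∘ suc) h d) (conv (f ∘ suc) (conv g h) d) ⟩
    f 0 * conv g h (suc d) + conv (f ∘ suc) (conv g h) d ∎

  ι : Carrier → ℕ → Carrier
  ι a zero    = a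
  ι a (suc _) = 0#

  conv-ι : ∀ a g d → conv (ι a) g d ≈ a * g d
  conv-ι a g zero    = refl
  conv-ι a g (suc d) = trans (+-congˡ (conv-zero g d)) (+-identityʳ _)

  x : ℕ → Carrier
  x zero    = 0#
  x (suc d) = ι 1# d

  conv-x-zero : ∀ g → conv x g 0 ≈ 0#
  conv-x-zero g = zeroˡ _

  conv-x-suc : ∀ g d → conv x g (suc d) ≈ g d
  conv-x-suc g d = trans (+-cong (zeroˡ _) (conv-ι 1# g d)) (trans (+-identityˡ _) (*-identityˡ _))

  module _ (K : ℕ) where

    infix 4 _≈ᵗ_
    _≈ᵗ_ : (ℕ → Carrier) → (ℕ → Carrier) → Set ℓ
    f ≈ᵗ g = ∀ d → d ≤ K → f d ≈ g d

    truncated : CommutativeRing c ℓ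
    truncated = record
      { Carrier = ℕ → Carrier
      ; _≈_ = _≈ᵗ_
      ; _+_ = λ f g d → f d + g d
      ; _*_ = conv
      ; -_ = λ f d → - f d
      ; 0# = λ _ → 0#
      ; 1# = ι 1#
      ; isCommutativeRing = record
        { isRing = record
          { +-isAbelianGroup = record
            { isGroup = record
              { isMonoid = record
                { isSemigroup = record
                  { isMagma = record
                    { isEquivalence = record
                      { refl  = λ _ _ → refl
                      ; sym   = λ f≈g d d≤K → sym (f≈g d d≤K)
                      ; trans = λ f≈g g≈h d d≤K → trans (f≈g d d≤K) (g≈h d d≤K)
                      }
                    ; ∙-cong = λ f≈f′ g≈g′ d d≤K → +-cong (f≈f′ d d≤K) (g≈g′ d d≤K)
                    }
                  ; assoc = λ f g h d _ → +-assoc (f d) (g d) (h d)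
                  }
                ; identity = (λ f d _ → +-identityˡ (f d)) , (λ f d _ → +-identityʳ (f d))
                }
              ; inverse = (λ f d _ → -‿inverseˡ (f d)) , (λ f d _ → -‿inverseʳ (f d))
              ; ⁻¹-cong = λ f≈g d d≤K → -‿cong (f≈g d d≤K)
              }
            ; comm = λ f g d _ → +-comm (f d) (g d)
            }
          ; *-cong = λ f≈f′ g≈g′ d d≤K → conv-cong d
              (λ e e≤d → f≈f′ e (ℕ.≤-trans e≤d d≤K)) (λ e e≤d → g≈g′ e (ℕ.≤-trans e≤d d≤K))
          ; *-assoc = λ f g h d _ → conv-assoc f g h d
          ; *-identity = (λ f d _ → trans (conv-ι 1# f d) (*-identityˡ _))
                       , (λ f d _ → trans (conv-comm f (ι 1#) d) (trans (conv-ι 1# f d) (*-identityˡ _)))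
          ; distrib = (λ f g h d _ → trans (conv-comm f _ d) (trans (distribute g h f d)
                        (+-cong (conv-comm g f d) (conv-comm h f d))))
                    , (λ f g h d _ → distribute g h f d)
          }
        ; *-comm = λ f g d _ → conv-comm f g d
        }
      }
      where
      distribute : ∀ f g h d → conv (λ e → f e + g e) h d ≈ conv f h d + conv g h d
      distribute f g h d = begin
        conv (λ e → f e + g e) h d            ≈⟨ conv-cong d (λ e _ → +-congʳ (sym (*-identityˡ (f e)))) (λ _ _ → refl) ⟩
        conv (λ e → 1# * f e + g e) h d       ≈⟨ conv-linear 1# f g h d ⟩
        1# * conv f h d + conv g h d          ≈⟨ +-congʳ (*-identityˡ _) ⟩
        conv f h d + conv g h d               ∎

    private module T = Sums truncated

    ι-isRingHomomorphism : IsRingHomomorphism rawRing T.rawRing ι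
    ι-isRingHomomorphism = record
      { isSemiringHomomorphism = record
        { isNearSemiringHomomorphism = record
          { +-isMonoidHomomorphism = record
            { isMagmaHomomorphism = record
              { isRelHomomorphism = record { cong = λ { a≈b zero _ → a≈b ; a≈b (suc _) _ → refl } }
              ; homo = λ { a b zero _ → refl ; a b (suc _) _ → sym (+-identityʳ 0#) }
              }
            ; ε-homo = λ { zero _ → refl ; (suc _) _ → refl }
            }
          ; *-homo = λ { a b zero _ → refl
                       ; a b (suc d) _ → sym (trans (conv-ι a (ι b) (suc d)) (zeroʳ a)) }
          }
        ; 1#-homo = λ _ _ → refl
        }
      ; -‿homo = λ { a zero _ → refl ; a (suc _) _ → sym -0#≈0# }
      }

    x^-coefficient : ∀ a d → (x T.^ a) d ≈ χ (does (a ≟ d))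
    x^-coefficient zero    zero    = refl
    x^-coefficient zero    (suc d) = refl
    x^-coefficient (suc a) zero    = conv-x-zero (x T.^ a)
    x^-coefficient (suc a) (suc d) = trans (conv-x-suc (x T.^ a) d) (x^-coefficient a d)

    x-nilpotent : x T.^ suc K T.≈ T.0#
    x-nilpotent d d≤K = trans (x^-coefficient (suc K) d)
      (χ-false (suc K ≟ d) λ 1+K≡d → ℕ.1+n≰n (≡.subst (_≤ K) (≡.sym 1+K≡d) d≤K))

    coefficient-∑ : ∀ {a} {A : Set a} (xs : List A) f d → T.∑ xs f d ≈ ∑ xs (λ i → f i d)
    coefficient-∑ []       f d = refl
    coefficient-∑ (y ∷ xs) f d = +-congˡ (coefficient-∑ xs f d)

    coefficient-monomial : ∀ b a d → (ι b T.* x T.^ a) d ≈ χ (does (a ≟ d)) * b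
    coefficient-monomial b a d = trans (conv-ι b (x T.^ a) d)
      (trans (*-congˡ (x^-coefficient a d)) (*-comm _ _))

-- Only operations are asked of the source, so that coefficient lists can be mapped to power series
-- without ring laws for the lists.
module Homomorphism {c ℓ c′ ℓ′} (A : RawRing c ℓ) (B : CommutativeRing c′ ℓ′)
  {⟦_⟧ : RawRing.Carrier A → CommutativeRing.Carrier B}
  (isRingHomomorphism : IsRingHomomorphism A (CommutativeRing.rawRing B) ⟦_⟧) where

  private
    module A = RawRing A
    module A′ = Algebra.Definitions.RawSemiring A.rawSemiring
  open Sums B
  open IsRingHomomorphism isRingHomomorphism public
    using (⟦⟧-cong; +-homo; *-homo; 1#-homo; 0#-homo; -‿homo)

  ^-homo : ∀ x n → ⟦ x A′.^ n ⟧ ≈ ⟦ x ⟧ ^ n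
  ^-homo x zero    = 1#-homo
  ^-homo x (suc n) = trans (*-homo x (x A′.^ n)) (*-congˡ (^-homo x n))

  ×1-homo : ∀ n → ⟦ n A′.× A.1# ⟧ ≈ n · 1#
  ×1-homo zero    = 0#-homo
  ×1-homo (suc n) = trans (+-homo A.1# (n A′.× A.1#)) (+-cong 1#-homo (×1-homo n))

  ∑-homo : ∀ {i} {I : Set i} (xs : List I) f →
           ⟦ List.foldr A._+_ A.0# (List.map f xs) ⟧ ≈ ∑ xs (λ x → ⟦ f x ⟧)
  ∑-homo []       f = 0#-homo
  ∑-homo (x ∷ xs) f = trans (+-homo _ _) (+-congˡ (∑-homo xs f))

-- The product of `A - q^m B` and binomial sums of `h`.

module ProductFormula {c ℓ} (R : CommutativeRing c ℓ) where

  open Sums R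

  -- homog N c A B = Σ_{i ≤ N} c i A^i B^(N - i)
  homog : ℕ → (ℕ → Carrier) → Carrier → Carrier → Carrier
  homog zero    c A B = c 0
  homog (suc N) c A B = homog N c A B * B + c (suc N) * A ^ suc N

  -- The definition splits off the highest power of `A`. Splitting off the lowest one shows that
  -- multiplication by `A` shifts the coefficients by one place.
  homog-first : ∀ N c A B →
    homog (suc N) c A B ≈ c 0 * B ^ suc N + A * homog N (c ∘ suc) A B
  homog-first zero    c A B =
    solve 4 (λ a b A B → a :* B :+ b :* (A :* con (+ 1)) := a :* (B :* con (+ 1)) :+ A :* b) refl
      (c 0) (c 1) A B
  homog-first (suc N) c A B = begin
    homog (suc N) c A B * B + c (suc (suc N)) * A ^ suc (suc N)
      ≈⟨ +-congʳ (*-congʳ (homog-first N c A B)) ⟩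
    (c 0 * B ^ suc N + A * homog N (c ∘ suc) A B) * B + c (suc (suc N)) * A ^ suc (suc N)
      ≈⟨ solve 7 (λ a b A B h p q → (a :* p :+ A :* h) :* B :+ b :* (A :* q)
                := a :* (B :* p) :+ A :* (h :* B :+ b :* q)) refl
           (c 0) (c (suc (suc N))) A B (homog N (c ∘ suc) A B) (B ^ suc N) (A ^ suc N) ⟩
    c 0 * B ^ suc (suc N) + A * homog (suc N) (c ∘ suc) A B ∎

  homog-minus : ∀ N c d y A B → homog N (λ i → c i - y * d i) A B ≈ homog N c A B - y * homog N d A B
  homog-minus zero    c d y A B = refl
  homog-minus (suc N) c d y A B = begin
    homog N (λ i → c i - y * d i) A B * B + (c (suc N) - y * d (suc N)) * A ^ suc N
      ≈⟨ +-congʳ (*-congʳ (homog-minus N c d y A B)) ⟩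
    (homog N c A B - y * homog N d A B) * B + (c (suc N) - y * d (suc N)) * A ^ suc N
      ≈⟨ solve 7 (λ h h′ y B a b p → (h :- y :* h′) :* B :+ (a :- y :* b) :* p
                   := h :* B :+ a :* p :- y :* (h′ :* B :+ b :* p)) refl
           (homog N c A B) (homog N d A B) y B (c (suc N)) (d (suc N)) (A ^ suc N) ⟩
    homog (suc N) c A B - y * homog (suc N) d A B ∎

  homog-cong : ∀ N {c d} A B → (∀ i → i ≤ N → c i ≈ d i) → homog N c A B ≈ homog N d A B
  homog-cong zero    A B c≈d = c≈d 0 z≤n
  homog-cong (suc N) A B c≈d = +-cong
    (*-congʳ (homog-cong N A B λ i i≤N → c≈d i (ℕ.m≤n⇒m≤1+n i≤N)))
    (*-congʳ (c≈d (suc N) ℕ.≤-refl))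

  -- Σ_{i < n} A^i B^(n - 1 - i)
  h : Carrier → Carrier → ℕ → Carrier
  h A B zero    = 0#
  h A B (suc n) = A * h A B n + B ^ n

  homog-1 : ∀ N A B → homog N (λ _ → 1#) A B ≈ h A B (suc N)
  homog-1 zero    A B = sym (trans (+-congʳ (zeroʳ _)) (+-identityˡ _))
  homog-1 (suc N) A B = begin
    homog (suc N) (λ _ → 1#) A B                    ≈⟨ homog-first N (λ _ → 1#) A B ⟩
    1# * B ^ suc N + A * homog N (λ _ → 1#) A B     ≈⟨ +-cong (*-identityˡ _) (*-congˡ (homog-1 N A B)) ⟩
    B ^ suc N + A * h A B (suc N)                   ≈⟨ +-comm _ _ ⟩
    h A B (suc (suc N))                             ∎

  h-1 : ∀ B n → h 1# B n ≈ ∑ (upTo n) (B ^_)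
  h-1 B zero    = refl
  h-1 B (suc n) = begin
    1# * h 1# B n + B ^ n      ≈⟨ +-congʳ (trans (*-identityˡ _) (h-1 B n)) ⟩
    ∑ (upTo n) (B ^_) + B ^ n  ≈⟨ ∑-upTo-last n (B ^_) ⟨
    ∑ (upTo (suc n)) (B ^_)    ∎

  h-cong : ∀ {A A′ B B′} n → A ≈ A′ → B ≈ B′ → h A B n ≈ h A′ B′ n
  h-cong zero    A≈A′ B≈B′ = refl
  h-cong (suc n) A≈A′ B≈B′ = +-cong (*-cong A≈A′ (h-cong n A≈A′ B≈B′)) (^-congˡ n B≈B′)

  -- `h` with index `j + 1` is homogeneous of degree `j` in its two arguments, and both are
  -- multiples of `X`.
  h-scale : ∀ y X j → h (y * X) X (suc j) ≈ X ^ j * ∑ (upTo (suc j)) (y ^_)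
  h-scale y X zero    =
    solve 2 (λ y X → y :* X :* con (+ 0) :+ con (+ 1) := con (+ 1) :* (con (+ 1) :+ con (+ 0))) refl y X
  h-scale y X (suc j) = begin
    y * X * h (y * X) X (suc j) + X ^ suc j                        ≈⟨ +-congʳ (*-congˡ (h-scale y X j)) ⟩
    y * X * (X ^ j * ∑ (upTo (suc j)) (y ^_)) + X ^ suc j
      ≈⟨ solve 4 (λ y X p s → y :* X :* (p :* s) :+ X :* p := X :* p :* (con (+ 1) :+ y :* s)) refl
           y X (X ^ j) (∑ (upTo (suc j)) (y ^_)) ⟩
    X ^ suc j * (1# + y * ∑ (upTo (suc j)) (y ^_))                 ≈⟨ *-congˡ (+-congˡ (*-∑ y (upTo (suc j)) (y ^_))) ⟩
    X ^ suc j * (1# + ∑ (upTo (suc j)) (λ i → y ^ suc i))          ≈⟨ *-congˡ (∑-upTo-first (suc j) (y ^_)) ⟨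
    X ^ suc j * ∑ (upTo (suc (suc j))) (y ^_)                      ∎

  -- This is `Σ_j C(n,j) g(j)`, namely `(1 + E)^n` applied to `g` and evaluated at 0, where `E` is
  -- the shift. In this form Pascal's rule is the definition, and binomial coefficients are needed
  -- only at the end.
  umbral : ℕ → (ℕ → Carrier) → Carrier
  umbral zero    g = g 0
  umbral (suc n) g = umbral n g + umbral n (g ∘ suc)

  umbral-linear : ∀ n a f g → umbral n (λ j → a * f j + g j) ≈ a * umbral n f + umbral n g
  umbral-linear zero    a f g = refl
  umbral-linear (suc n) a f g = trans
    (+-cong (umbral-linear n a f g) (umbral-linear n a (f ∘ suc) (g ∘ suc)))
    (solve 5 (λ a u v w x → (a :* u :+ w) :+ (a :* v :+ x) := a :* (u :+ v) :+ (w :+ x)) refl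
      a (umbral n f) (umbral n (f ∘ suc)) (umbral n g) (umbral n (g ∘ suc)))

  umbral-* : ∀ n a f → umbral n (λ j → a * f j) ≈ a * umbral n f
  umbral-* zero    a f = refl
  umbral-* (suc n) a f = trans (+-cong (umbral-* n a f) (umbral-* n a (f ∘ suc))) (sym (distribˡ _ _ _))

  binomial : ∀ n X → umbral n (X ^_) ≈ (1# + X) ^ n
  binomial zero    X = refl
  binomial (suc n) X = begin
    umbral n (X ^_) + umbral n (λ j → X * X ^ j) ≈⟨ +-congˡ (umbral-* n X (X ^_)) ⟩
    umbral n (X ^_) + X * umbral n (X ^_)        ≈⟨ solve 2 (λ X u → u :+ X :* u := (con (+ 1) :+ X) :* u) refl X _ ⟩
    (1# + X) * umbral n (X ^_)                   ≈⟨ *-congˡ (binomial n X) ⟩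
    (1# + X) ^ suc n                             ∎

  -- Formally `h a X j = (a^j - X^j) / (a - X)`, and the binomial theorem applies to both powers
  -- while `a - X = (1 + a) - (1 + X)`. The induction along the recursion of `h` avoids the
  -- division.
  h-umbral : ∀ n a X → umbral n (h a X) ≈ h (1# + a) (1# + X) n
  h-umbral zero    a X = refl
  h-umbral (suc n) a X = begin
    umbral n (h a X) + umbral n (λ j → a * h a X j + X ^ j)
      ≈⟨ +-congˡ (umbral-linear n a (h a X) (X ^_)) ⟩
    umbral n (h a X) + (a * umbral n (h a X) + umbral n (X ^_))
      ≈⟨ solve 3 (λ a u v → u :+ (a :* u :+ v) := (con (+ 1) :+ a) :* u :+ v) refl a (umbral n (h a X)) (umbral n (X ^_)) ⟩
    (1# + a) * umbral n (h a X) + umbral n (X ^_)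
      ≈⟨ +-cong (*-congˡ (h-umbral n a X)) (binomial n X) ⟩
    h (1# + a) (1# + X) (suc n) ∎

  -- The range is cut at the degree where `g` dies out and not at `n`, in accordance with the boxes
  -- from which the index tuples are filtered. In the inductive step the extra top term of the
  -- shifted sum contains `g (suc K)`.
  umbral-∑ : ∀ n K g → (∀ j → K < j → g j ≈ 0#) →
             umbral n g ≈ ∑ (upTo (suc K)) (λ j → (n C j) · 1# * g j)
  umbral-∑ zero K g g≈0 = begin
    g 0                                                   ≈⟨ solve 1 (λ x → x := (con (+ 1) :+ con (+ 0)) :* x :+ con (+ 0)) refl (g 0) ⟩
    (0 C 0) · 1# * g 0 + 0#                               ≈⟨ +-congˡ (∑-zero (upTo K) (λ j → zeroˡ (g (suc j)))) ⟨
    (0 C 0) · 1# * g 0 + ∑ (upTo K) (λ j → (0 C suc j) · 1# * g (suc j))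
                                                          ≈⟨ ∑-upTo-first K (λ j → (0 C j) · 1# * g j) ⟨
    ∑ (upTo (suc K)) (λ j → (0 C j) · 1# * g j)           ∎
  umbral-∑ (suc n) K g g≈0 = begin
    umbral n g + umbral n (g ∘ suc)
      ≈⟨ +-cong (umbral-∑ n K g g≈0) (umbral-∑ n K (g ∘ suc) λ j K<j → g≈0 (suc j) (ℕ.m<n⇒m<1+n K<j)) ⟩
    ∑ (upTo (suc K)) (λ j → (n C j) · 1# * g j) + ∑ (upTo (suc K)) (λ j → (n C j) · 1# * g (suc j))
      ≈⟨ +-cong (∑-upTo-first K _) (trans (∑-upTo-last K _)
           (trans (+-congˡ (trans (*-congˡ (g≈0 (suc K) ℕ.≤-refl)) (zeroʳ _))) (+-identityʳ _))) ⟩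
    (n C 0) · 1# * g 0 + ∑ (upTo K) (λ j → (n C suc j) · 1# * g (suc j)) + ∑ (upTo K) (λ j → (n C j) · 1# * g (suc j))
      ≈⟨ +-assoc _ _ _ ⟩
    (n C 0) · 1# * g 0 + (∑ (upTo K) (λ j → (n C suc j) · 1# * g (suc j)) + ∑ (upTo K) (λ j → (n C j) · 1# * g (suc j)))
      ≈⟨ +-congˡ (∑-+ (upTo K) _ _) ⟨
    (n C 0) · 1# * g 0 + ∑ (upTo K) (λ j → (n C suc j) · 1# * g (suc j) + (n C j) · 1# * g (suc j))
      ≈⟨ +-congˡ (∑-cong (upTo K) pascal) ⟩
    (suc n C 0) · 1# * g 0 + ∑ (upTo K) (λ j → (suc n C suc j) · 1# * g (suc j))
      ≈⟨ ∑-upTo-first K _ ⟨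
    ∑ (upTo (suc K)) (λ j → (suc n C j) · 1# * g j) ∎
    where
    pascal : ∀ j → (n C suc j) · 1# * g (suc j) + (n C j) · 1# * g (suc j) ≈ (suc n C suc j) · 1# * g (suc j)
    pascal j = begin
      (n C suc j) · 1# * g (suc j) + (n C j) · 1# * g (suc j) ≈⟨ distribʳ _ _ _ ⟨
      ((n C suc j) · 1# + (n C j) · 1#) * g (suc j)           ≈⟨ *-congʳ (trans (+-comm _ _) (sym (×-homo-+ 1# (n C j) (n C suc j)))) ⟩
      (n C j ℕ.+ n C suc j) · 1# * g (suc j)                  ≡⟨ ≡.cong (λ x → x · 1# * g (suc j)) (nCk+nC[k+1]≡[n+1]C[k+1] n j) ⟩
      (suc n C suc j) · 1# * g (suc j)                        ∎

  module _ (q : Carrier) where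

    -- The coefficients of (x - q)(x - q²)⋯(x - q^N).
    coef : ℕ → ℕ → Carrier
    coef zero    zero    = 1#
    coef zero    (suc i) = 0#
    coef (suc N) zero    = 0# - q ^ suc N * coef N 0
    coef (suc N) (suc i) = coef N i - q ^ suc N * coef N (suc i)

    coef-> : ∀ {N i} → N < i → coef N i ≈ 0#
    coef-> {zero}  {suc i} _         = refl
    coef-> {suc N} {suc i} (s≤s N<i) = begin
      coef N i - q ^ suc N * coef N (suc i) ≈⟨ +-cong (coef-> N<i) (-‿cong (*-congˡ (coef-> (ℕ.m<n⇒m<1+n N<i)))) ⟩
      0# - q ^ suc N * 0#                   ≈⟨ solve 1 (λ x → con (+ 0) :- x :* con (+ 0) := con (+ 0)) refl (q ^ suc N) ⟩
      0#                                    ∎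

    coef-leading : ∀ N → coef N N ≈ 1#
    coef-leading zero    = refl
    coef-leading (suc N) = begin
      coef N N - q ^ suc N * coef N (suc N) ≈⟨ +-cong (coef-leading N) (-‿cong (*-congˡ (coef-> {N} ℕ.≤-refl))) ⟩
      1# - q ^ suc N * 0#                   ≈⟨ solve 1 (λ x → con (+ 1) :- x :* con (+ 0) := con (+ 1)) refl (q ^ suc N) ⟩
      1#                                    ∎

    ∏-homog : ∀ A B N → ∏ N (λ b → A - q ^ suc b * B) ≈ homog N (coef N) A B
    ∏-homog A B zero    = refl
    ∏-homog A B (suc N) = begin
      ∏ N (λ b → A - q ^ suc b * B) * (A - y * B)   ≈⟨ *-congʳ (∏-homog A B N) ⟩
      H * (A - y * B)                               ≈⟨ solve 4 (λ H A y B → H :* (A :- y :* B) := con (+ 0) :+ A :* H :- y :* (H :* B :+ con (+ 0))) refl H A y B ⟩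
      0# + A * H - y * (H * B + 0#)
        -- Zero coefficients are restored, the lowest one for `A * H` and the highest one for
        -- `H * B`, so that both become homogeneous sums of degree `suc N`.
        ≈⟨ +-cong (+-congʳ (sym (zeroˡ (B ^ suc N)))) (-‿cong (*-congˡ (+-congˡ
             (trans (sym (zeroˡ (A ^ suc N))) (*-congʳ (sym (coef-> {N} ℕ.≤-refl))))))) ⟩
      0# * B ^ suc N + A * H - y * homog (suc N) (coef N) A B ≈⟨ +-congʳ (homog-first N shifted A B) ⟨
      homog (suc N) shifted A B - y * homog (suc N) (coef N) A B
        ≈⟨ homog-minus (suc N) shifted (coef N) y A B ⟨
      homog (suc N) (λ i → shifted i - y * coef N i) A B
        ≈⟨ homog-cong (suc N) A B (λ { zero _ → refl ; (suc i) _ → refl }) ⟩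
      homog (suc N) (coef (suc N)) A B              ∎
      where
      y = q ^ suc N
      H = homog N (coef N) A B
      shifted : ℕ → Carrier
      shifted zero    = 0#
      shifted (suc i) = coef N i

    -- Compares coefficients in (x - q^N) P(qx) = q^N (x - 1) P(x), where
    -- P(x) = (x - q)(x - q²)⋯(x - q^N).
    coef-shift : ∀ N i → (q ^ suc i - q ^ suc N) * coef N i ≈ q ^ suc N * (q ^ suc i - 1#) * coef N (suc i)
    coef-shift zero zero =
      solve 1 (λ y → (y :- y) :* con (+ 1) := y :* (y :- con (+ 1)) :* con (+ 0)) refl (q ^ 1)
    coef-shift zero (suc i) = trans (zeroʳ _) (sym (zeroʳ _))
    coef-shift (suc N) zero = begin
      (q ^ 1 - q * y) * (0# - y * c₀)
        ≈⟨ solve 3 (λ q y c₀ → (q :* con (+ 1) :- q :* y) :* (con (+ 0) :- y :* c₀)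
             := q :* y :* ((q :* con (+ 1) :- con (+ 1)) :* c₀ :- (q :* con (+ 1) :- y) :* c₀)) refl q y c₀ ⟩
      q * y * ((q ^ 1 - 1#) * c₀ - (q ^ 1 - y) * c₀)
        ≈⟨ *-congˡ (+-congˡ (-‿cong (coef-shift N zero))) ⟩
      q * y * ((q ^ 1 - 1#) * c₀ - y * (q ^ 1 - 1#) * c₁)
        ≈⟨ solve 4 (λ q y c₀ c₁ → q :* y :* ((q :* con (+ 1) :- con (+ 1)) :* c₀ :- y :* (q :* con (+ 1) :- con (+ 1)) :* c₁)
             := q :* y :* (q :* con (+ 1) :- con (+ 1)) :* (c₀ :- y :* c₁)) refl q y c₀ c₁ ⟩
      q * y * (q ^ 1 - 1#) * (c₀ - y * c₁) ∎
      where
      y  = q ^ suc N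
      c₀ = coef N 0
      c₁ = coef N 1
    coef-shift (suc N) (suc i) = begin
      (q * u - q * y) * (c₀ - y * c₁)
        ≈⟨ solve 5 (λ q u y c₀ c₁ → (q :* u :- q :* y) :* (c₀ :- y :* c₁)
             := q :* ((u :- y) :* c₀) :- q :* y :* (u :- y) :* c₁) refl q u y c₀ c₁ ⟩
      q * ((u - y) * c₀) - q * y * (u - y) * c₁
        ≈⟨ +-congʳ (*-congˡ (coef-shift N i)) ⟩
      q * (y * (u - 1#) * c₁) - q * y * (u - y) * c₁
        ≈⟨ solve 4 (λ q u y c₁ → q :* (y :* (u :- con (+ 1)) :* c₁) :- q :* y :* (u :- y) :* c₁
             := q :* y :* (q :* u :- con (+ 1)) :* c₁ :- q :* y :* ((q :* u :- y) :* c₁)) refl q u y c₁ ⟩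
      q * y * (q * u - 1#) * c₁ - q * y * ((q * u - y) * c₁)
        ≈⟨ +-congˡ (-‿cong (*-congˡ (coef-shift N (suc i)))) ⟩
      q * y * (q * u - 1#) * c₁ - q * y * (y * (q * u - 1#) * c₂)
        ≈⟨ solve 5 (λ q u y c₁ c₂ → q :* y :* (q :* u :- con (+ 1)) :* c₁ :- q :* y :* (y :* (q :* u :- con (+ 1)) :* c₂)
             := q :* y :* (q :* u :- con (+ 1)) :* (c₁ :- y :* c₂)) refl q u y c₁ c₂ ⟩
      q * y * (q * u - 1#) * (c₁ - y * c₂) ∎
      where
      y  = q ^ suc N
      u  = q ^ suc i
      c₀ = coef N i
      c₁ = coef N (suc i)
      c₂ = coef N (suc (suc i))

  module RootOfUnity (q : Carrier) (M : ℕ) (qⁿ≈1 : q ^ suc M ≈ 1#) (r : ℕ → Carrier)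
    (r-inverse : ∀ b → b < M → (1# - q ^ suc b) * r b ≈ 1#) where

    cancel : ∀ {b x} → b < M → (1# - q ^ suc b) * x ≈ 0# → x ≈ 0#
    cancel {b} {x} b<M eq = begin
      x                            ≈⟨ *-identityˡ x ⟨
      1# * x                       ≈⟨ *-congʳ (r-inverse b b<M) ⟨
      (1# - q ^ suc b) * r b * x   ≈⟨ solve 3 (λ y r x → y :* r :* x := r :* (y :* x)) refl (1# - q ^ suc b) (r b) x ⟩
      r b * ((1# - q ^ suc b) * x) ≈⟨ *-congˡ eq ⟩
      r b * 0#                     ≈⟨ zeroʳ _ ⟩
      0#                           ∎

    x-y≈0⇒x≈y : ∀ {x y} → x - y ≈ 0# → x ≈ y
    x-y≈0⇒x≈y {x} {y} eq = trans (solve 2 (λ x y → x := x :- y :+ y) refl x y)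
      (trans (+-congʳ eq) (+-identityˡ y))

    -- Since `q ^ suc M` is 1, `coef-shift` for `N = M` reads `(u - 1) c₀ = (u - 1) c₁`, and `1 - u`
    -- is invertible for `i < M`. All coefficients thus equal the leading one.
    coef-step : ∀ i → i < M → coef q M i ≈ coef q M (suc i)
    coef-step i i<M = x-y≈0⇒x≈y (cancel i<M (begin
      (1# - u) * (c₀ - c₁)
        ≈⟨ solve 3 (λ u c₀ c₁ → (con (+ 1) :- u) :* (c₀ :- c₁) := con (+ 1) :* (u :- con (+ 1)) :* c₁ :- (u :- con (+ 1)) :* c₀) refl u c₀ c₁ ⟩
      1# * (u - 1#) * c₁ - (u - 1#) * c₀
        ≈⟨ +-cong (*-congʳ (*-congʳ (sym qⁿ≈1))) (-‿cong (*-congʳ (+-congˡ (-‿cong (sym qⁿ≈1))))) ⟩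
      q ^ suc M * (u - 1#) * c₁ - (u - q ^ suc M) * c₀
        ≈⟨ +-congʳ (coef-shift q M i) ⟨
      (u - q ^ suc M) * c₀ - (u - q ^ suc M) * c₀
        ≈⟨ -‿inverseʳ _ ⟩
      0# ∎))
      where
      u  = q ^ suc i
      c₀ = coef q M i
      c₁ = coef q M (suc i)

    coef-1 : ∀ d i → d ℕ.+ i ≡ M → coef q M i ≈ 1#
    coef-1 zero    i ≡.refl = coef-leading q M
    coef-1 (suc d) i eq     = trans
      (coef-step i (≡.subst (i <_) eq (s≤s (ℕ.m≤n+m i d))))
      (coef-1 d (suc i) (≡.trans (ℕ.+-suc d i) eq))

    cyclotomic-product : ∀ A B → ∏ M (λ b → A - q ^ suc b * B) ≈ h A B (suc M)
    cyclotomic-product A B = begin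
      ∏ M (λ b → A - q ^ suc b * B) ≈⟨ ∏-homog q A B M ⟩
      homog M (coef q M) A B        ≈⟨ homog-cong M A B (λ i i≤M → coef-1 (M ℕ.∸ i) i (ℕ.m∸n+n≡m i≤M)) ⟩
      homog M (λ _ → 1#) A B        ≈⟨ homog-1 M A B ⟩
      h A B (suc M)                 ∎

    -- After exchanging the exponents this is a full geometric series in `q ^ suc i`, annihilated by
    -- the invertible element `1 - q ^ suc i`.
    orthogonality : ∀ i → i < M → ∑ (upTo (suc M)) (λ m → (q ^ m) ^ suc i) ≈ 0#
    orthogonality i i<M = cancel i<M (begin
      (1# - q ^ suc i) * ∑ (upTo (suc M)) (λ m → (q ^ m) ^ suc i)
        ≈⟨ *-congˡ (∑-cong (upTo (suc M)) λ m → ^-comm q m (suc i)) ⟩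
      (1# - q ^ suc i) * ∑ (upTo (suc M)) ((q ^ suc i) ^_)
        ≈⟨ geometric (q ^ suc i) (suc M) ⟩
      1# - (q ^ suc i) ^ suc M
        ≈⟨ +-congˡ (-‿cong (trans (^-comm q (suc i) (suc M)) (trans (^-congˡ (suc i) qⁿ≈1) (1^ (suc i))))) ⟩
      1# - 1#
        ≈⟨ -‿inverseʳ 1# ⟩
      0# ∎)

-- Multiple harmonic sums and their interpolation.

fillings-length : ∀ {r} k (ks : Vec ℕ r) → ListAll.All (λ p → length p ≤ suc r) (fillings k ks)
fillings-length k []        = ℕ.≤-refl ListAll.∷ ListAll.[]
fillings-length k (k′ ∷ ks) = ListAll.++⁺
  (ListAll.map⁺ (ListAll.map s≤s (fillings-length k′ ks)))
  (ListAll.++⁺ (ListAll.map ℕ.m≤n⇒m≤1+n (fillings-length (k ℕ.+ k′) ks))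
               (ListAll.map ℕ.m≤n⇒m≤1+n (fillings-length (k ℕ.+ k′ ∸ 1) ks)))

module HarmonicSums {c ℓ} (R : CommutativeRing c ℓ) where

  open Sums R

  -- Here `n = suc M`. The conditions `i ≤ j ≤ n - 1` on a single pair are carried along as
  -- indicators, to be recognised as the filter on tuples once the sums have been multiplied out.
  weight : ℕ → ℕ → ℕ → Carrier
  weight M i j = χ (does (i ≤? j)) * χ (does (j ≤? M)) * ((suc M C suc j) · 1#)

  module _ (q : Carrier) (r : ℕ → Carrier) where

    -- As in the definition of z̄, the index b stands for m = b + 1; below,
    -- r b is 1 / (1 - q^(b + 1)).
    summand : ℕ → ℕ → Carrier
    summand a b = q ^ ((a ∸ 1) ℕ.* suc b) * r b ^ a

    harmonic₁ : ℕ → ℕ → Carrier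
    harmonic₁ b zero        = - 1#
    harmonic₁ b k@(suc _)   = ∑ (upTo b) (summand k)

    -- A strict bound `b` on the largest index takes the place of the fixed `n`, so that the range
    -- can grow by one value at a time; `harmonic-top` below is the increment, where the largest
    -- index equals `b`.
    harmonic : ℕ → List ℕ → Carrier
    harmonic b []       = 1#
    harmonic b (k ∷ ks) = ∑ (upTo b) λ m → summand k m * harmonic m ks

    harmonic-top : ℕ → List ℕ → Carrier
    harmonic-top b []       = 0#
    harmonic-top b (k ∷ ks) = summand k b * harmonic b ks

    harmonic-suc : ∀ b ks → harmonic (suc b) ks ≈ harmonic b ks + harmonic-top b ks
    harmonic-suc b []       = sym (+-identityʳ 1#)
    harmonic-suc b (k ∷ ks) = ∑-upTo-last b _

    summand-* : ∀ {k k′ b} → (1# - q ^ suc b) * r b ≈ 1# → 1 ≤ k → 1 ≤ k′ →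
      summand (k ℕ.+ k′) b + summand (k ℕ.+ k′ ∸ 1) b ≈ summand k b * summand k′ b
    summand-* {suc a} {suc a′} {b} inverse _ _ rewrite ℕ.+-suc a a′ = begin
      q ^ (suc (a ℕ.+ a′) ℕ.* suc b) * r b ^ suc (suc (a ℕ.+ a′)) + q ^ ((a ℕ.+ a′) ℕ.* suc b) * r b ^ suc (a ℕ.+ a′)
        ≈⟨ +-cong (*-congʳ (^-* q (suc (a ℕ.+ a′)) (suc b))) (*-congʳ (^-* q (a ℕ.+ a′) (suc b))) ⟩
      u * p * (v * (v * s)) + p * (v * s)
        ≈⟨ solve 4 (λ u p v s → u :* p :* (v :* (v :* s)) :+ p :* (v :* s) := p :* s :* v :* (u :* v :+ con (+ 1))) refl u p v s ⟩
      p * s * v * (u * v + 1#)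
        -- Writing 1 as `(1 - u) v` gives `u v + 1 = v`, the missing factor `v` of the second
        -- summand.
        ≈⟨ *-cong (*-congʳ (*-cong (^-homo-* u a a′) (^-homo-* v a a′))) (+-congˡ (sym inverse)) ⟩
      u ^ a * u ^ a′ * (v ^ a * v ^ a′) * v * (u * v + (1# - u) * v)
        ≈⟨ solve 6 (λ u v a b c d → a :* b :* (c :* d) :* v :* (u :* v :+ (con (+ 1) :- u) :* v) := a :* (v :* c) :* (b :* (v :* d))) refl
             u v (u ^ a) (u ^ a′) (v ^ a) (v ^ a′) ⟩
      u ^ a * (v * v ^ a) * (u ^ a′ * (v * v ^ a′))
        ≈⟨ *-cong (*-congʳ (^-* q a (suc b))) (*-congʳ (^-* q a′ (suc b))) ⟨
      summand (suc a) b * summand (suc a′) b ∎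
      where
      u = q ^ suc b
      v = r b
      p = u ^ (a ℕ.+ a′)
      s = v ^ (a ℕ.+ a′)

  module Fillings (t : Carrier) where

    -- Decides the first box: a comma commits `k` to the prefix, which is absorbed into `f`, while
    -- either merge costs one factor `t`. Keeping `f` arbitrary makes linearity in `f` available to
    -- the increments.
    filled : ∀ {r} → (List ℕ → Carrier) → ℕ → Vec ℕ r → Carrier
    filled f k []        = f (k ∷ [])
    filled f k (k′ ∷ ks) =
      filled (f ∘ (k ∷_)) k′ ks + t * (filled f (k ℕ.+ k′) ks + filled f (k ℕ.+ k′ ∸ 1) ks)

    ∑-fillings : ∀ {r} f k (ks : Vec ℕ r) →
      ∑ (fillings k ks) (λ p → f p * t ^ (suc r ∸ length p)) ≈ filled f k ks
    ∑-fillings f k [] = solve 1 (λ x → x :* con (+ 1) :+ con (+ 0) := x) refl (f (k ∷ []))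
    ∑-fillings {suc r} f k (k′ ∷ ks) = begin
      ∑ (List.map (k ∷_) (fillings k′ ks) ++ fillings (k ℕ.+ k′) ks ++ fillings (k ℕ.+ k′ ∸ 1) ks) g
        ≈⟨ trans (∑-++ (List.map (k ∷_) (fillings k′ ks)) _ g)
             (+-cong (∑-map (k ∷_) (fillings k′ ks) g) (∑-++ (fillings (k ℕ.+ k′) ks) _ g)) ⟩
      ∑ (fillings k′ ks) (g ∘ (k ∷_)) + (∑ (fillings (k ℕ.+ k′) ks) g + ∑ (fillings (k ℕ.+ k′ ∸ 1) ks) g)
        ≈⟨ +-cong (∑-fillings (f ∘ (k ∷_)) k′ ks)
                  (trans (+-cong (merged (k ℕ.+ k′)) (merged (k ℕ.+ k′ ∸ 1))) (sym (distribˡ t _ _))) ⟩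
      filled f k (k′ ∷ ks) ∎
      where
      g : List ℕ → Carrier
      g p = f p * t ^ (suc (suc r) ∸ length p)

      lower : ∀ {ps} → ListAll.All (λ p → length p ≤ suc r) ps →
              ∑ ps g ≈ ∑ ps (λ p → t * (f p * t ^ (suc r ∸ length p)))
      lower ListAll.[] = refl
      lower {p ∷ _} (le ListAll.∷ les) = +-cong (begin
        -- A filling of the shorter index has at most `suc r` entries, so the truncated difference
        -- does not truncate and grows by exactly one.
        f p * t ^ (suc (suc r) ∸ length p)   ≡⟨ ≡.cong (λ e → f p * t ^ e) (ℕ.+-∸-assoc 1 le) ⟩
        f p * (t * t ^ (suc r ∸ length p))
          ≈⟨ solve 3 (λ a t x → a :* (t :* x) := t :* (a :* x)) refl (f p) t _ ⟩
        t * (f p * t ^ (suc r ∸ length p))   ∎) (lower les)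

      merged : ∀ k → ∑ (fillings k ks) g ≈ t * filled f k ks
      merged k = begin
        ∑ (fillings k ks) g                                             ≈⟨ lower (fillings-length k ks) ⟩
        ∑ (fillings k ks) (λ p → t * (f p * t ^ (suc r ∸ length p)))    ≈⟨ *-∑ t (fillings k ks) _ ⟨
        t * ∑ (fillings k ks) (λ p → f p * t ^ (suc r ∸ length p))      ≈⟨ *-congˡ (∑-fillings f k ks) ⟩
        t * filled f k ks                                               ∎

    filled-cong : ∀ {r f g} k (ks : Vec ℕ r) → (∀ p → f p ≈ g p) → filled f k ks ≈ filled g k ks
    filled-cong k []        f≈g = f≈g _
    filled-cong k (k′ ∷ ks) f≈g = +-cong (filled-cong k′ ks λ p → f≈g (k ∷ p))
      (*-congˡ (+-cong (filled-cong (k ℕ.+ k′) ks f≈g) (filled-cong (k ℕ.+ k′ ∸ 1) ks f≈g)))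

    filled-+ : ∀ {r} f g k (ks : Vec ℕ r) → filled (λ p → f p + g p) k ks ≈ filled f k ks + filled g k ks
    filled-+ f g k []        = refl
    filled-+ f g k (k′ ∷ ks) = trans
      (+-cong (filled-+ (f ∘ (k ∷_)) (g ∘ (k ∷_)) k′ ks)
        (*-congˡ (+-cong (filled-+ f g (k ℕ.+ k′) ks) (filled-+ f g (k ℕ.+ k′ ∸ 1) ks))))
      (solve 7 (λ t a b c d e h → a :+ b :+ t :* (c :+ d :+ (e :+ h)) := a :+ t :* (c :+ e) :+ (b :+ t :* (d :+ h))) refl
        t (filled (f ∘ (k ∷_)) k′ ks) (filled (g ∘ (k ∷_)) k′ ks)
        (filled f (k ℕ.+ k′) ks) (filled g (k ℕ.+ k′) ks)
        (filled f (k ℕ.+ k′ ∸ 1) ks) (filled g (k ℕ.+ k′ ∸ 1) ks))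

    filled-* : ∀ {r} a f k (ks : Vec ℕ r) → filled (λ p → a * f p) k ks ≈ a * filled f k ks
    filled-* a f k []        = refl
    filled-* a f k (k′ ∷ ks) = trans
      (+-cong (filled-* a (f ∘ (k ∷_)) k′ ks)
        (*-congˡ (+-cong (filled-* a f (k ℕ.+ k′) ks) (filled-* a f (k ℕ.+ k′ ∸ 1) ks))))
      (solve 5 (λ t a x y z → a :* x :+ t :* (a :* y :+ a :* z) := a :* (x :+ t :* (y :+ z))) refl
        t a _ (filled f (k ℕ.+ k′) ks) (filled f (k ℕ.+ k′ ∸ 1) ks))

    module _ (q : Carrier) (r : ℕ → Carrier) where

      -- The empty index has value 1 for every bound, hence increment 0; this agrees with the
      -- convention for weight and depth zero.
      interpolated interpolated-top : ∀ {l} → ℕ → Vec ℕ l → Carrier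
      interpolated b []       = 1#
      interpolated b (k ∷ ks) = filled (harmonic q r b) k ks
      interpolated-top b []       = 0#
      interpolated-top b (k ∷ ks) = filled (harmonic-top q r b) k ks

      interpolated-suc : ∀ {l} b (ks : Vec ℕ l) →
        interpolated (suc b) ks ≈ interpolated b ks + interpolated-top b ks
      interpolated-suc b []       = sym (+-identityʳ 1#)
      interpolated-suc b (k ∷ ks) = trans (filled-cong k ks (harmonic-suc q r b)) (filled-+ _ _ k ks)

      interpolated-zero : ∀ {l} k (ks : Vec ℕ l) → interpolated 0 (k ∷ ks) ≈ 0#
      interpolated-zero k ks = go (λ _ _ → refl) k ks
        where
        go : ∀ {f l} → (∀ k p → f (k ∷ p) ≈ 0#) → ∀ k (ks : Vec ℕ l) → filled f k ks ≈ 0#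
        go f≈0 k []        = f≈0 k []
        go f≈0 k (k′ ∷ ks) = trans
          (+-cong (go (λ k″ p → f≈0 k (k″ ∷ p)) k′ ks)
            (*-congˡ (+-cong (go f≈0 (k ℕ.+ k′) ks) (go f≈0 (k ℕ.+ k′ ∸ 1) ks))))
          (solve 1 (λ t → con (+ 0) :+ t :* (con (+ 0) :+ con (+ 0)) := con (+ 0)) refl t)

      module _ {b : ℕ} (inverse : (1# - q ^ suc b) * r b ≈ 1#) where

        private
          top : ∀ {l} → ℕ → Vec ℕ l → Carrier
          top = filled (harmonic-top q r b)

        -- Two merged entries behave like a product since s(k) s(k′) = s(k + k′) + s(k + k′ - 1).
        top-merge : ∀ {l k k′} (ks : Vec ℕ l) → 1 ≤ k → 1 ≤ k′ → All (1 ≤_) ks →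
          top (k ℕ.+ k′) ks + top (k ℕ.+ k′ ∸ 1) ks ≈ summand q r k b * top k′ ks
        top-merge {k = k} {k′} [] 1≤k 1≤k′ [] = begin
          summand q r (k ℕ.+ k′) b * 1# + summand q r (k ℕ.+ k′ ∸ 1) b * 1# ≈⟨ distribʳ 1# _ _ ⟨
          (summand q r (k ℕ.+ k′) b + summand q r (k ℕ.+ k′ ∸ 1) b) * 1#    ≈⟨ *-congʳ (summand-* q r inverse 1≤k 1≤k′) ⟩
          summand q r k b * summand q r k′ b * 1#                           ≈⟨ *-assoc _ _ _ ⟩
          summand q r k b * (summand q r k′ b * 1#)                         ∎
        top-merge {k = k@(suc a)} {k′@(suc a′)} (k″ ∷ ks) 1≤k 1≤k′ (1≤k″ ∷ 1≤ks) = begin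
          top (k ℕ.+ k′) (k″ ∷ ks) + top (k ℕ.+ k′ ∸ 1) (k″ ∷ ks)
            ≈⟨ +-cong (+-congʳ (filled-* _ _ k″ ks)) (+-congʳ (filled-* _ _ k″ ks)) ⟩
          summand q r (k ℕ.+ k′) b * T + t * (top (k ℕ.+ k′ ℕ.+ k″) ks + top (k ℕ.+ k′ ℕ.+ k″ ∸ 1) ks)
          + (summand q r (k ℕ.+ k′ ∸ 1) b * T + t * (top (k ℕ.+ k′ ∸ 1 ℕ.+ k″) ks + top (k ℕ.+ k′ ∸ 1 ℕ.+ k″ ∸ 1) ks))
            ≈⟨ solve 8 (λ s s′ T t a b c d → s :* T :+ t :* (a :+ b) :+ (s′ :* T :+ t :* (c :+ d))
                 := (s :+ s′) :* T :+ t :* ((a :+ c) :+ (b :+ d))) refl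
                 (summand q r (k ℕ.+ k′) b) (summand q r (k ℕ.+ k′ ∸ 1) b) T t
                 (top (k ℕ.+ k′ ℕ.+ k″) ks) (top (k ℕ.+ k′ ℕ.+ k″ ∸ 1) ks)
                 (top (k ℕ.+ k′ ∸ 1 ℕ.+ k″) ks) (top (k ℕ.+ k′ ∸ 1 ℕ.+ k″ ∸ 1) ks) ⟩
          (summand q r (k ℕ.+ k′) b + summand q r (k ℕ.+ k′ ∸ 1) b) * T
          + t * ((top (k ℕ.+ k′ ℕ.+ k″) ks + top (k ℕ.+ k′ ∸ 1 ℕ.+ k″) ks)
               + (top (k ℕ.+ k′ ℕ.+ k″ ∸ 1) ks + top (k ℕ.+ k′ ∸ 1 ℕ.+ k″ ∸ 1) ks))
            ≈⟨ +-cong (*-congʳ (summand-* q r inverse 1≤k 1≤k′)) (*-congˡ (+-cong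
                 (+-cong (reindex e₁) (reindex e₂)) (+-cong (reindex e₃) (reindex e₄)))) ⟩
          summand q r k b * summand q r k′ b * T
          + t * ((top (k ℕ.+ (k′ ℕ.+ k″)) ks + top (k ℕ.+ (k′ ℕ.+ k″) ∸ 1) ks)
               + (top (k ℕ.+ (k′ ℕ.+ k″ ∸ 1)) ks + top (k ℕ.+ (k′ ℕ.+ k″ ∸ 1) ∸ 1) ks))
            ≈⟨ +-congˡ (*-congˡ (+-cong (top-merge ks 1≤k (s≤s z≤n) 1≤ks)
                 (top-merge ks 1≤k (ℕ.≤-trans 1≤k″ (ℕ.m≤n+m k″ a′)) 1≤ks))) ⟩
          summand q r k b * summand q r k′ b * T
          + t * (summand q r k b * top (k′ ℕ.+ k″) ks + summand q r k b * top (k′ ℕ.+ k″ ∸ 1) ks)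
            ≈⟨ solve 6 (λ s s′ T t x y → s :* s′ :* T :+ t :* (s :* x :+ s :* y) := s :* (s′ :* T :+ t :* (x :+ y))) refl
                 (summand q r k b) (summand q r k′ b) T t (top (k′ ℕ.+ k″) ks) (top (k′ ℕ.+ k″ ∸ 1) ks) ⟩
          summand q r k b * (summand q r k′ b * T + t * (top (k′ ℕ.+ k″) ks + top (k′ ℕ.+ k″ ∸ 1) ks))
            ≈⟨ *-congˡ (+-congʳ (filled-* _ _ k″ ks)) ⟨
          summand q r k b * top k′ (k″ ∷ ks) ∎
          where
          T = filled (harmonic q r b) k″ ks
          reindex : ∀ {i j} → i ≡ j → top i ks ≈ top j ks
          reindex i≡j = reflexive (≡.cong (λ i → top i ks) i≡j)
          e₁ : k ℕ.+ k′ ℕ.+ k″ ≡ k ℕ.+ (k′ ℕ.+ k″)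
          e₁ = ℕ.+-assoc k k′ k″
          e₂ : k ℕ.+ k′ ∸ 1 ℕ.+ k″ ≡ k ℕ.+ (k′ ℕ.+ k″) ∸ 1
          e₂ = ℕ.+-assoc a k′ k″
          e₃ : k ℕ.+ k′ ℕ.+ k″ ∸ 1 ≡ k ℕ.+ (k′ ℕ.+ k″ ∸ 1)
          e₃ = ≡.trans (≡.cong (_∸ 1) e₁) (ℕ.+-∸-assoc k {k′ ℕ.+ k″} (s≤s z≤n))
          e₄ : k ℕ.+ k′ ∸ 1 ℕ.+ k″ ∸ 1 ≡ k ℕ.+ (k′ ℕ.+ k″ ∸ 1) ∸ 1
          e₄ = ≡.cong (_∸ 1) (≡.trans e₂ (ℕ.+-∸-assoc k {k′ ℕ.+ k″} (s≤s z≤n)))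

        -- With `m₁ = b` fixed, a comma leaves indices below `b`, and the two merges together amount
        -- to `m₂ = b` at the price of a factor `t`. The first entry then contributes its own factor
        -- in both cases.
        interpolated-top-∷ : ∀ {l k} (ks : Vec ℕ l) → 1 ≤ k → All (1 ≤_) ks →
          interpolated-top b (k ∷ ks) ≈ summand q r k b * (interpolated b ks + t * interpolated-top b ks)
        interpolated-top-∷ {k = k} [] 1≤k [] =
          solve 2 (λ s t → s :* con (+ 1) := s :* (con (+ 1) :+ t :* con (+ 0))) refl (summand q r k b) t
        interpolated-top-∷ {k = k} (k′ ∷ ks) 1≤k (1≤k′ ∷ 1≤ks) = begin
          top k (k′ ∷ ks)
            ≈⟨ +-cong (filled-* _ _ k′ ks) (*-congˡ (top-merge ks 1≤k 1≤k′ 1≤ks)) ⟩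
          summand q r k b * T + t * (summand q r k b * top k′ ks)
            ≈⟨ solve 4 (λ s T t x → s :* T :+ t :* (s :* x) := s :* (T :+ t :* x)) refl (summand q r k b) T t (top k′ ks) ⟩
          summand q r k b * (T + t * top k′ ks) ∎
          where T = filled (harmonic q r b) k′ ks

module HarmonicHomomorphism {c ℓ c′ ℓ′} (R : CommutativeRing c ℓ) (S : CommutativeRing c′ ℓ′)
  {κ : CommutativeRing.Carrier R → CommutativeRing.Carrier S}
  (κ-isRingHomomorphism : IsRingHomomorphism (CommutativeRing.rawRing R) (CommutativeRing.rawRing S) κ)
  (q : CommutativeRing.Carrier R) (r : ℕ → CommutativeRing.Carrier R) where

  private
    module R  = Sums R
    module RH = HarmonicSums R
    module SH = HarmonicSums S
    r′ : ℕ → CommutativeRing.Carrier S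
    r′ b = κ (r b)
  open Sums S
  open Homomorphism (CommutativeRing.rawRing R) S κ-isRingHomomorphism

  χ-homo : ∀ b → κ (R.χ b) ≈ χ b
  χ-homo false = 0#-homo
  χ-homo true  = 1#-homo

  weight-homo : ∀ M i j → κ (RH.weight M i j) ≈ SH.weight M i j
  weight-homo M i j = trans (*-homo _ _) (*-cong
    (trans (*-homo _ _) (*-cong (χ-homo (does (i ≤? j))) (χ-homo (does (j ≤? M)))))
    (×1-homo (suc M C suc j)))

  summand-homo : ∀ a b → κ (RH.summand q r a b) ≈ SH.summand (κ q) r′ a b
  summand-homo a b = trans (*-homo _ _) (*-cong (^-homo q ((a ∸ 1) ℕ.* suc b)) (^-homo (r b) a))

  harmonic₁-homo : ∀ b k → κ (RH.harmonic₁ q r b k) ≈ SH.harmonic₁ (κ q) r′ b k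
  harmonic₁-homo b zero    = trans (-‿homo R.1#) (-‿cong 1#-homo)
  harmonic₁-homo b (suc a) = trans (∑-homo (upTo b) (RH.summand q r (suc a)))
    (∑-cong (upTo b) (summand-homo (suc a)))

  harmonic-homo : ∀ b ks → κ (RH.harmonic q r b ks) ≈ SH.harmonic (κ q) r′ b ks
  harmonic-homo b []       = 1#-homo
  harmonic-homo b (k ∷ ks) = trans (∑-homo (upTo b) _)
    (∑-cong (upTo b) λ m → trans (*-homo _ _) (*-cong (summand-homo k m) (harmonic-homo m ks)))

-- The generating function as a quotient of brackets, and its two expansions.

module Bracket {c ℓ} (R : CommutativeRing c ℓ) where

  open Sums R
  open ProductFormula R
  open HarmonicSums R

  private
    variable
      a : Level
      A : Set a

  -- Neither of `j` and `l` need be the larger one, so both sums are extended by zeros to a common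
  -- longer range.
  ∑-upTo-≤ : ∀ {l f} j → (∀ i → l < i → f i ≈ 0#) →
    ∑ (upTo (suc j)) f ≈ ∑ (upTo (suc l)) (λ i → χ (does (i ≤? j)) * f i)
  ∑-upTo-≤ {l} {f} j f≈0 = begin
    ∑ (upTo (suc j)) f                 ≈⟨ ∑-upTo-cong (suc j) (λ i i≤j → χ-redundant (i ≤? j) λ i≰j → ⊥-elim (i≰j (ℕ.s≤s⁻¹ i≤j))) ⟨
    ∑ (upTo (suc j)) g                 ≈⟨ ∑-upTo-extend (suc j ℕ.+ suc l) g (ℕ.m≤m+n _ _) (λ i j<i → trans
                                            (χ-guard (i ≤? j) λ i≤j → ⊥-elim (ℕ.<⇒≱ j<i i≤j)) (zeroʳ _)) ⟨
    ∑ (upTo (suc j ℕ.+ suc l)) g       ≈⟨ ∑-upTo-extend (suc j ℕ.+ suc l) g (ℕ.m≤n+m (suc l) (suc j)) (λ i l<i → trans (*-congˡ (f≈0 i l<i)) (zeroʳ _)) ⟩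
    ∑ (upTo (suc l)) g                 ∎
    where
    g : ℕ → Carrier
    g i = χ (does (i ≤? j)) * f i

  -- The remaining sum keeps the full range, with positivity as an indicator, because the index
  -- tuples are also drawn from the full box and filtered.
  ∑-upTo-positive : ∀ k f → ∑ (upTo (suc k)) f ≈ f 0 + ∑ (upTo (suc k)) (λ j → χ (does (1 ≤? j)) * f j)
  ∑-upTo-positive k f = begin
    ∑ (upTo (suc k)) f                                                    ≈⟨ ∑-upTo-first k f ⟩
    f 0 + ∑ (upTo k) (f ∘ suc)                                            ≈⟨ +-congˡ (+-identityˡ _) ⟨
    f 0 + (0# + ∑ (upTo k) (f ∘ suc))                                     ≈⟨ +-congˡ (+-cong (zeroˡ (f 0)) (∑-cong (upTo k) λ j → *-identityˡ (f (suc j)))) ⟨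
    f 0 + (0# * f 0 + ∑ (upTo k) (λ j → 1# * f (suc j)))                  ≈⟨ +-congˡ (∑-upTo-first k _) ⟨
    f 0 + ∑ (upTo (suc k)) (λ j → χ (does (1 ≤? j)) * f j)                ∎

  module _ (X : Carrier) where

    -- A sum of multiples of `X` inherits the nilpotency of `X` with the same exponent; this is how
    -- the remainders of the brackets are seen to be nilpotent.
    Divides : Carrier → Set _
    Divides x = ∃ λ y → x ≈ X * y

    ∑-Divides : ∀ (xs : List A) {f} → (∀ x → Divides (f x)) → Divides (∑ xs f)
    ∑-Divides []       X∣f = 0# , sym (zeroʳ X)
    ∑-Divides (x ∷ xs) X∣f with X∣f x | ∑-Divides xs X∣f
    ... | y , eq | y′ , eq′ = y + y′ , trans (+-cong eq eq′) (sym (distribˡ X y y′))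

    Divides-* : ∀ y {x} → Divides x → Divides (y * x)
    Divides-* y (z , eq) = y * z , trans (*-congˡ eq) (solve 3 (λ y X z → y :* (X :* z) := X :* (y :* z)) refl y X z)

    Divides-0 : ∀ x → Divides (0# * x)
    Divides-0 x = 0# , trans (zeroˡ x) (sym (zeroʳ X))

    Divides-nilpotent : ∀ {x} k → X ^ k ≈ 0# → Divides x → x ^ k ≈ 0#
    Divides-nilpotent {x} k Xᵏ≈0 (y , eq) = begin
      x ^ k         ≈⟨ ^-congˡ k eq ⟩
      (X * y) ^ k   ≈⟨ ^-distrib-* X y k ⟩
      X ^ k * y ^ k ≈⟨ *-congʳ Xᵏ≈0 ⟩
      0# * y ^ k    ≈⟨ zeroˡ _ ⟩
      0#            ∎

  -- The generating function of the sums is bracket (1 - t) / bracket (- t),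
  -- where bracket w collects the monomials C(n, j + 1) X^j (w Y)^i of the
  -- statement, in a ring where X^(k+1) = Y^(l+1) = 0.

  module Brackets (q : Carrier) (M : ℕ) (qⁿ≈1 : q ^ suc M ≈ 1#) (r : ℕ → Carrier)
    (r-inverse : ∀ b → b < M → (1# - q ^ suc b) * r b ≈ 1#)
    (X Y : Carrier) (k l : ℕ) (X-nilpotent : X ^ suc k ≈ 0#) (Y-nilpotent : Y ^ suc l ≈ 0#)
    where

    open RootOfUnity q M qⁿ≈1 r r-inverse

    private
      n = suc M

      X-vanish : ∀ {j} → k < j → X ^ j ≈ 0#
      X-vanish k<j = ^-vanish k<j X-nilpotent

    mono : Carrier → ℕ → ℕ → Carrier
    mono w i j = weight M i j * w ^ i * (X ^ j * Y ^ i)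

    bracket : Carrier → Carrier
    bracket w = ∑ (upTo (suc l)) λ i → ∑ (upTo (suc k)) λ j → mono w i j

    -- Both arguments of `h` are 1 plus a multiple of `X`. `h-umbral` removes the ones at the price
    -- of binomial coefficients, and `h-scale` then exposes the power of `X`.
    bracket-product : ∀ w → ∏ M (λ b → 1# + w * Y * X - q ^ suc b * (1# + X)) ≈ bracket w
    bracket-product w = begin
      ∏ M (λ b → 1# + w * Y * X - q ^ suc b * (1# + X))
        ≈⟨ cyclotomic-product (1# + w * Y * X) (1# + X) ⟩
      h (1# + w * Y * X) (1# + X) n
        ≈⟨ h-umbral n (w * Y * X) X ⟨
      umbral n (h (w * Y * X) X)
        -- The bound is `suc k` since `h` of positive index `j` carries only `X^(j-1)`. Its value at
        -- index 0 is zero, and dropping that term shifts the binomial coefficient to `C(n, j+1)`.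
        ≈⟨ umbral-∑ n (suc k) (h (w * Y * X) X) h-vanish ⟩
      ∑ (upTo (suc (suc k))) (λ j → (n C j) · 1# * h (w * Y * X) X j)
        ≈⟨ ∑-upTo-first (suc k) _ ⟩
      (n C 0) · 1# * 0# + ∑ (upTo (suc k)) (λ j → (n C suc j) · 1# * h (w * Y * X) X (suc j))
        ≈⟨ trans (+-congʳ (zeroʳ _)) (+-identityˡ _) ⟩
      ∑ (upTo (suc k)) (λ j → (n C suc j) · 1# * h (w * Y * X) X (suc j))
        ≈⟨ ∑-cong (upTo (suc k)) row ⟩
      ∑ (upTo (suc k)) (λ j → ∑ (upTo (suc l)) λ i → mono w i j)
        ≈⟨ ∑-swap (upTo (suc k)) (upTo (suc l)) (λ j i → mono w i j) ⟩
      bracket w ∎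
      where
      h-vanish : ∀ j → suc k < j → h (w * Y * X) X j ≈ 0#
      h-vanish (suc j) (s≤s k<j) = begin
        h (w * Y * X) X (suc j)                        ≈⟨ h-scale (w * Y) X j ⟩
        X ^ j * ∑ (upTo (suc j)) ((w * Y) ^_)          ≈⟨ *-congʳ (X-vanish k<j) ⟩
        0# * ∑ (upTo (suc j)) ((w * Y) ^_)             ≈⟨ zeroˡ _ ⟩
        0#                                             ∎

      wY-vanish : ∀ i → l < i → (w * Y) ^ i ≈ 0#
      wY-vanish i l<i = begin
        (w * Y) ^ i   ≈⟨ ^-distrib-* w Y i ⟩
        w ^ i * Y ^ i ≈⟨ *-congˡ (^-vanish l<i Y-nilpotent) ⟩
        w ^ i * 0#    ≈⟨ zeroʳ _ ⟩
        0#            ∎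

      -- The restriction `j ≤ n - 1` may be inserted freely because the binomial coefficient
      -- vanishes beyond it.
      C-bounded : ∀ j → χ (does (j ≤? M)) * ((n C suc j) · 1#) ≈ (n C suc j) · 1#
      C-bounded j = χ-redundant (j ≤? M) λ j≰M →
        reflexive (≡.cong (_· 1#) (k>n⇒nCk≡0 (s≤s (ℕ.≰⇒> j≰M))))

      row : ∀ j → (n C suc j) · 1# * h (w * Y * X) X (suc j) ≈ ∑ (upTo (suc l)) (λ i → mono w i j)
      row j = begin
        (n C suc j) · 1# * h (w * Y * X) X (suc j)
          ≈⟨ *-cong (sym (C-bounded j)) (h-scale (w * Y) X j) ⟩
        C′ * (X ^ j * ∑ (upTo (suc j)) ((w * Y) ^_))
          ≈⟨ *-assoc _ _ _ ⟨
        C′ * X ^ j * ∑ (upTo (suc j)) ((w * Y) ^_)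
          ≈⟨ *-congˡ (∑-upTo-≤ j wY-vanish) ⟩
        C′ * X ^ j * ∑ (upTo (suc l)) (λ i → χ (does (i ≤? j)) * (w * Y) ^ i)
          ≈⟨ *-∑ _ (upTo (suc l)) _ ⟩
        ∑ (upTo (suc l)) (λ i → C′ * X ^ j * (χ (does (i ≤? j)) * (w * Y) ^ i))
          ≈⟨ ∑-cong (upTo (suc l)) (λ i → trans (*-congˡ (*-congˡ (^-distrib-* w Y i)))
               (solve 6 (λ b c x e w y → b :* c :* x :* (e :* (w :* y)) := e :* b :* c :* w :* (x :* y)) refl
                 (χ (does (j ≤? M))) ((n C suc j) · 1#) (X ^ j) (χ (does (i ≤? j))) (w ^ i) (Y ^ i))) ⟩
        ∑ (upTo (suc l)) (λ i → mono w i j) ∎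
        where C′ = χ (does (j ≤? M)) * ((n C suc j) · 1#)

    bracket₀ : Carrier
    bracket₀ = ∑ (upTo (suc k)) λ j → weight M 0 j * X ^ j

    -- The nilpotent remainders of the two expansions. Their indicators are the source of the
    -- conditions `j_a ≥ 1` and `i_a ≥ 1` for `a ≥ 1`, respectively.
    bracket₁ bracket₂ : Carrier → Carrier
    bracket₁ w = ∑ (upTo (suc l)) λ i → ∑ (upTo (suc k)) λ j → χ (does (1 ≤? j)) * mono w i j
    bracket₂ w = ∑ (upTo (suc l)) λ i → ∑ (upTo (suc k)) λ j → χ (does (1 ≤? i)) * mono w i j

    -- For `j = 0` the condition `i ≤ j` leaves only `i = 0`, which contributes `C(n,1) = n`.
    bracket-split₁ : ∀ w → bracket w ≈ n · 1# + bracket₁ w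
    bracket-split₁ w = begin
      ∑ (upTo (suc l)) (λ i → ∑ (upTo (suc k)) λ j → mono w i j)
        ≈⟨ ∑-cong (upTo (suc l)) (λ i → ∑-upTo-positive k (mono w i)) ⟩
      ∑ (upTo (suc l)) (λ i → mono w i 0 + ∑ (upTo (suc k)) λ j → χ (does (1 ≤? j)) * mono w i j)
        ≈⟨ ∑-+ (upTo (suc l)) (λ i → mono w i 0) _ ⟩
      ∑ (upTo (suc l)) (λ i → mono w i 0) + bracket₁ w
        ≈⟨ +-congʳ (∑-upTo-first l (λ i → mono w i 0)) ⟩
      mono w 0 0 + ∑ (upTo l) (λ i → mono w (suc i) 0) + bracket₁ w
        ≈⟨ +-congʳ (+-cong constant (∑-zero (upTo l) λ i →
             solve 4 (λ a b c d → con (+ 0) :* a :* b :* c :* d := con (+ 0)) refl _ _ _ _)) ⟩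
      n · 1# + 0# + bracket₁ w
        ≈⟨ +-congʳ (+-identityʳ _) ⟩
      n · 1# + bracket₁ w ∎
      where
      constant : mono w 0 0 ≈ n · 1#
      constant = trans
        (solve 1 (λ x → con (+ 1) :* con (+ 1) :* x :* con (+ 1) :* (con (+ 1) :* con (+ 1)) := x) refl ((n C 1) · 1#))
        (reflexive (≡.cong (_· 1#) (nC1≡n n)))

    bracket-split₂ : ∀ w → bracket w ≈ bracket₀ + bracket₂ w
    bracket-split₂ w = begin
      bracket w
        ≈⟨ ∑-upTo-positive l _ ⟩
      ∑ (upTo (suc k)) (mono w 0) + ∑ (upTo (suc l)) (λ i → χ (does (1 ≤? i)) * ∑ (upTo (suc k)) (mono w i))
        ≈⟨ +-cong (∑-cong (upTo (suc k)) λ j → solve 2 (λ a x → a :* con (+ 1) :* (x :* con (+ 1)) := a :* x) refl (weight M 0 j) (X ^ j))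
                  (∑-cong (upTo (suc l)) λ i → *-∑ _ (upTo (suc k)) (mono w i)) ⟩
      bracket₀ + bracket₂ w ∎

    mono-Divides : ∀ w i j → Divides X (mono w i (suc j))
    mono-Divides w i j = weight M i (suc j) * w ^ i * (X ^ j * Y ^ i) ,
      solve 5 (λ a b x p y → a :* b :* (x :* p :* y) := x :* (a :* b :* (p :* y))) refl
        (weight M i (suc j)) (w ^ i) X (X ^ j) (Y ^ i)

    bracket₁-nilpotent : ∀ w → bracket₁ w ^ suc k ≈ 0#
    bracket₁-nilpotent w = Divides-nilpotent X (suc k) X-nilpotent
      (∑-Divides X (upTo (suc l)) λ i → ∑-Divides X (upTo (suc k)) (term i))
      where
      term : ∀ i j → Divides X (χ (does (1 ≤? j)) * mono w i j)
      term i zero    = Divides-0 X (mono w i 0)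
      term i (suc j) = Divides-* X 1# (mono-Divides w i j)

    -- `i ≥ 1` and `i ≤ j` force `j ≥ 1`, so `X` divides every term. Arguing with `X` instead of `Y`
    -- gives the range `m ≤ k` of the statement.
    bracket₂-nilpotent : ∀ w → bracket₂ w ^ suc k ≈ 0#
    bracket₂-nilpotent w = Divides-nilpotent X (suc k) X-nilpotent
      (∑-Divides X (upTo (suc l)) λ i → ∑-Divides X (upTo (suc k)) (term i))
      where
      term : ∀ i j → Divides X (χ (does (1 ≤? i)) * mono w i j)
      term zero    j       = Divides-0 X (mono w 0 j)
      term (suc i) zero    = 0# , solve 5 (λ a b c d x → con (+ 1) :* (con (+ 0) :* a :* b :* c :* d) := x :* con (+ 0)) refl
                               (χ (does (0 ≤? M))) ((n C 1) · 1#) (w ^ suc i) (X ^ 0 * Y ^ suc i) X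
      term (suc i) (suc j) = Divides-* X 1# (mono-Divides w (suc i) j)

    -- The part free of `Y` is the bracket at `w = 0`, where the product formula applies with
    -- `A = 1`.
    bracket₀≈∑ : bracket₀ ≈ ∑ (upTo n) ((1# + X) ^_)
    bracket₀≈∑ = begin
      bracket₀                 ≈⟨ +-identityʳ _ ⟨
      bracket₀ + 0#            ≈⟨ +-congˡ (∑-zero (upTo (suc l)) λ i → ∑-zero (upTo (suc k)) (term i)) ⟨
      bracket₀ + bracket₂ 0#   ≈⟨ bracket-split₂ 0# ⟨
      bracket 0#               ≈⟨ bracket-product 0# ⟨
      ∏ M (λ b → 1# + 0# * Y * X - q ^ suc b * (1# + X)) ≈⟨ cyclotomic-product _ _ ⟩
      h (1# + 0# * Y * X) (1# + X) n
        ≈⟨ h-cong n (solve 2 (λ Y X → con (+ 1) :+ con (+ 0) :* Y :* X := con (+ 1)) refl Y X) refl ⟩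
      h 1# (1# + X) n          ≈⟨ h-1 (1# + X) n ⟩
      ∑ (upTo n) ((1# + X) ^_) ∎
      where
      term : ∀ i j → χ (does (1 ≤? i)) * mono 0# i j ≈ 0#
      term zero    j = zeroˡ _
      term (suc i) j = solve 4 (λ a b c d → a :* (b :* (con (+ 0) :* c) :* d) := con (+ 0)) refl
                         1# (weight M (suc i) j) (0# ^ i) (X ^ j * Y ^ suc i)

    -- The contribution of `m = b + 1` to `1 + Z`. Summed in closed form it is `X / (1 - u (1 + X))`
    -- with `u = q^(b+1)`.
    summand-series : ℕ → Carrier
    summand-series b = ∑ (upTo (suc k)) λ a → χ (does (1 ≤? a)) * (summand q r a b * X ^ a)

    module _ (b : ℕ) (b<M : b < M) where

      private
        u = q ^ suc b
        -- `1 - u (1 + X)` equals `(1 - u) (1 - y)`, and `y` is nilpotent; `e` is the resulting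
        -- inverse.
        y = u * r b * X
        e = r b * ∑ (upTo (suc k)) (y ^_)

        y-power : ∀ a → summand q r (suc a) b * X ^ suc a ≈ X * (r b * y ^ a)
        y-power a = begin
          q ^ (a ℕ.* suc b) * (r b * r b ^ a) * (X * X ^ a)
            ≈⟨ *-congʳ (*-congʳ (^-* q a (suc b))) ⟩
          u ^ a * (r b * r b ^ a) * (X * X ^ a)
            ≈⟨ solve 5 (λ p r s X Z → p :* (r :* s) :* (X :* Z) := X :* (r :* (p :* s :* Z))) refl
                 (u ^ a) (r b) (r b ^ a) X (X ^ a) ⟩
          X * (r b * (u ^ a * r b ^ a * X ^ a))
            ≈⟨ *-congˡ (*-congˡ (trans (^-distrib-* (u * r b) X a) (*-congʳ (^-distrib-* u (r b) a)))) ⟨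
          X * (r b * y ^ a) ∎

        -- `summand-series b` stops at `X^k`, one term short of `X * e`; the missing term carries
        -- `X^(k+1)`.
        y-top : X * (r b * y ^ k) ≈ 0#
        y-top = begin
          X * (r b * y ^ k)                  ≈⟨ *-congˡ (*-congˡ (^-distrib-* (u * r b) X k)) ⟩
          X * (r b * ((u * r b) ^ k * X ^ k))
            ≈⟨ solve 4 (λ X r p Z → X :* (r :* (p :* Z)) := r :* p :* (X :* Z)) refl X (r b) _ _ ⟩
          r b * (u * r b) ^ k * X ^ suc k    ≈⟨ *-congˡ X-nilpotent ⟩
          r b * (u * r b) ^ k * 0#           ≈⟨ zeroʳ _ ⟩
          0#                                 ∎

        series≈Xe : summand-series b ≈ X * e
        series≈Xe = begin
          summand-series b
            ≈⟨ ∑-upTo-first k _ ⟩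
          0# * _ + ∑ (upTo k) (λ a → 1# * (summand q r (suc a) b * X ^ suc a))
            ≈⟨ +-cong (zeroˡ _) (∑-cong (upTo k) λ a → trans (*-identityˡ _) (y-power a)) ⟩
          0# + ∑ (upTo k) (λ a → X * (r b * y ^ a))
            ≈⟨ +-comm _ _ ⟩
          ∑ (upTo k) (λ a → X * (r b * y ^ a)) + 0#
            ≈⟨ +-congˡ y-top ⟨
          ∑ (upTo k) (λ a → X * (r b * y ^ a)) + X * (r b * y ^ k)
            ≈⟨ ∑-upTo-last k _ ⟨
          ∑ (upTo (suc k)) (λ a → X * (r b * y ^ a))
            ≈⟨ *-∑ X (upTo (suc k)) _ ⟨
          X * ∑ (upTo (suc k)) (λ a → r b * y ^ a)
            ≈⟨ *-congˡ (*-∑ (r b) (upTo (suc k)) (y ^_)) ⟨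
          X * e ∎

        e-inverse : (1# - u * (1# + X)) * e ≈ 1#
        e-inverse = begin
          (1# - u * (1# + X)) * (r b * Σy)
            ≈⟨ solve 4 (λ u X r s → (con (+ 1) :- u :* (con (+ 1) :+ X)) :* (r :* s)
                 := ((con (+ 1) :- u) :* r :- u :* r :* X) :* s) refl u X (r b) Σy ⟩
          ((1# - u) * r b - y) * Σy ≈⟨ *-congʳ (+-congʳ (r-inverse b b<M)) ⟩
          (1# - y) * Σy             ≈⟨ geometric y (suc k) ⟩
          1# - y ^ suc k            ≈⟨ +-congˡ (-‿cong (Divides-nilpotent X (suc k) X-nilpotent (u * r b , *-comm _ _))) ⟩
          1# - 0#                   ≈⟨ solve 0 (con (+ 1) :- con (+ 0) := con (+ 1)) refl ⟩
          1#                        ∎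
          where Σy = ∑ (upTo (suc k)) (y ^_)

      summand-series-equation : (1# - u * (1# + X)) * summand-series b ≈ X
      summand-series-equation = begin
        (1# - u * (1# + X)) * summand-series b ≈⟨ *-congˡ series≈Xe ⟩
        (1# - u * (1# + X)) * (X * e)          ≈⟨ solve 3 (λ a x e → a :* (x :* e) := x :* (a :* e)) refl _ X e ⟩
        X * ((1# - u * (1# + X)) * e)          ≈⟨ *-congˡ e-inverse ⟩
        X * 1#                                 ≈⟨ *-identityʳ X ⟩
        X                                      ∎

      -- The factor `X` turns the sum of powers of `1 + X` into `(1 + X)^n - 1`. As `u^n = 1`, this
      -- is also `(u (1 + X))^n - 1`, a multiple of the denominator `1 - u (1 + X)`.
      summand-series-∑ : ∑ (upTo n) ((1# + X) ^_) * summand-series b ≈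
                         - ∑ (upTo n) (λ i → (u * (1# + X)) ^ i)
      summand-series-∑ = begin
        P * summand-series b                      ≈⟨ *-congˡ series≈Xe ⟩
        P * (X * e)                               ≈⟨ solve 3 (λ P X e → P :* (X :* e) := :- (e :* ((con (+ 1) :- (con (+ 1) :+ X)) :* P))) refl P X e ⟩
        - (e * ((1# - (1# + X)) * P))             ≈⟨ -‿cong (*-congˡ (geometric (1# + X) n)) ⟩
        - (e * (1# - (1# + X) ^ n))               ≈⟨ -‿cong (*-congˡ (+-congˡ (-‿cong uB-power))) ⟨
        - (e * (1# - (u * (1# + X)) ^ n))         ≈⟨ -‿cong (*-congˡ (geometric (u * (1# + X)) n)) ⟨
        - (e * ((1# - u * (1# + X)) * S))         ≈⟨ solve 3 (λ e a S → :- (e :* (a :* S)) := :- (a :* e :* S)) refl e _ S ⟩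
        - ((1# - u * (1# + X)) * e * S)           ≈⟨ -‿cong (*-congʳ e-inverse) ⟩
        - (1# * S)                                ≈⟨ -‿cong (*-identityˡ S) ⟩
        - S                                       ∎
        where
        P = ∑ (upTo n) ((1# + X) ^_)
        S = ∑ (upTo n) (λ i → (u * (1# + X)) ^ i)
        uB-power : (u * (1# + X)) ^ n ≈ (1# + X) ^ n
        uB-power = begin
          (u * (1# + X)) ^ n          ≈⟨ ^-distrib-* u (1# + X) n ⟩
          u ^ n * (1# + X) ^ n        ≈⟨ *-congʳ (trans (^-comm q (suc b) n) (trans (^-congˡ (suc b) qⁿ≈1) (1^ (suc b)))) ⟩
          1# * (1# + X) ^ n           ≈⟨ *-identityˡ _ ⟩
          (1# + X) ^ n                ∎

    bracket₀-inverse : bracket₀ * (1# - ∑ (upTo M) summand-series) ≈ n · 1#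
    bracket₀-inverse = begin
      bracket₀ * (1# - ∑ (upTo M) summand-series)
        ≈⟨ *-congʳ bracket₀≈∑ ⟩
      P * (1# - ∑ (upTo M) summand-series)
        ≈⟨ solve 2 (λ P s → P :* (con (+ 1) :- s) := P :- P :* s) refl P _ ⟩
      P - P * ∑ (upTo M) summand-series
        ≈⟨ +-congˡ (-‿cong (trans (*-∑ P (upTo M) summand-series) (trans
             (∑-upTo-cong M summand-series-∑) (sym (∑-neg (upTo M) _))))) ⟩
      P - - ∑ (upTo M) (λ b → ∑ (upTo n) λ i → (q ^ suc b * (1# + X)) ^ i)
        ≈⟨ solve 2 (λ P s → P :- (:- s) := P :+ s) refl P _ ⟩
      P + ∑ (upTo M) (λ b → ∑ (upTo n) λ i → (q ^ suc b * (1# + X)) ^ i)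
        -- `P` supplies the missing term `m = 0`, since `q ^ 0` is 1. With `m` running over all
        -- residues, orthogonality leaves only `i = 0`.
        ≈⟨ +-congʳ (∑-cong (upTo n) λ i → ^-congˡ i (sym (*-identityˡ _))) ⟩
      ∑ (upTo n) (λ i → (q ^ 0 * (1# + X)) ^ i) + ∑ (upTo M) (λ b → ∑ (upTo n) λ i → (q ^ suc b * (1# + X)) ^ i)
        ≈⟨ ∑-upTo-first M _ ⟨
      ∑ (upTo n) (λ m → ∑ (upTo n) λ i → (q ^ m * (1# + X)) ^ i)
        ≈⟨ ∑-swap (upTo n) (upTo n) (λ m i → (q ^ m * (1# + X)) ^ i) ⟩
      ∑ (upTo n) (λ i → ∑ (upTo n) λ m → (q ^ m * (1# + X)) ^ i)
        ≈⟨ ∑-cong (upTo n) (λ i → trans (∑-cong (upTo n) λ m → ^-distrib-* (q ^ m) (1# + X) i)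
             (sym (∑-* (upTo n) (λ m → (q ^ m) ^ i) ((1# + X) ^ i)))) ⟩
      ∑ (upTo n) (λ i → ∑ (upTo n) (λ m → (q ^ m) ^ i) * (1# + X) ^ i)
        ≈⟨ ∑-upTo-first M _ ⟩
      ∑ (upTo n) (λ m → 1#) * 1# + ∑ (upTo M) (λ i → ∑ (upTo n) (λ m → (q ^ m) ^ suc i) * (1# + X) ^ suc i)
        ≈⟨ +-cong (trans (*-identityʳ _) (∑-1 n)) (trans
             (∑-upTo-cong M λ i i<M → trans (*-congʳ (orthogonality i i<M)) (zeroˡ _))
             (∑-zero (upTo M) λ _ → refl)) ⟩
      n · 1# + 0#
        ≈⟨ +-identityʳ _ ⟩
      n · 1# ∎
      where
      P = ∑ (upTo n) ((1# + X) ^_)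
      ∑-1 : ∀ n → ∑ (upTo n) (λ _ → 1#) ≈ n · 1#
      ∑-1 zero    = refl
      ∑-1 (suc n) = trans (∑-upTo-first n _) (+-congˡ (∑-1 n))

    z-series : Carrier
    z-series = ∑ (upTo (suc k)) λ a → harmonic₁ q r M a * X ^ a

    z-series≈ : z-series ≈ - (1# - ∑ (upTo M) summand-series)
    z-series≈ = begin
      z-series
        ≈⟨ ∑-upTo-positive k _ ⟩
      - 1# * 1# + ∑ (upTo (suc k)) (λ a → χ (does (1 ≤? a)) * (harmonic₁ q r M a * X ^ a))
        ≈⟨ +-congˡ (∑-cong (upTo (suc k)) term) ⟩
      - 1# * 1# + ∑ (upTo (suc k)) (λ a → ∑ (upTo M) λ b → χ (does (1 ≤? a)) * (summand q r a b * X ^ a))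
        ≈⟨ +-congˡ (∑-swap (upTo (suc k)) (upTo M) (λ a b → χ (does (1 ≤? a)) * (summand q r a b * X ^ a))) ⟩
      - 1# * 1# + ∑ (upTo M) summand-series
        ≈⟨ solve 1 (λ s → :- con (+ 1) :* con (+ 1) :+ s := :- (con (+ 1) :- s)) refl _ ⟩
      - (1# - ∑ (upTo M) summand-series) ∎
      where
      term : ∀ a → χ (does (1 ≤? a)) * (harmonic₁ q r M a * X ^ a) ≈ ∑ (upTo M) (λ b → χ (does (1 ≤? a)) * (summand q r a b * X ^ a))
      term zero    = trans (zeroˡ _) (sym (∑-zero (upTo M) λ b → zeroˡ _))
      term (suc a) = trans (*-congˡ (∑-* (upTo M) (summand q r (suc a)) (X ^ suc a))) (*-∑ 1# (upTo M) _)

    module _ (ν : Carrier) (ν-inverse : n · 1# * ν ≈ 1#) (G t : Carrier)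
      (G-bracket : G * bracket (- t) ≈ bracket (1# - t)) where

      private
        N = bracket (1# - t)

        divide : ∀ {e} → bracket (- t) * e ≈ 1# → G ≈ N * e
        divide {e} eq = begin
          G                       ≈⟨ *-identityʳ G ⟨
          G * 1#                  ≈⟨ *-congˡ eq ⟨
          G * (bracket (- t) * e) ≈⟨ *-assoc _ _ _ ⟨
          G * bracket (- t) * e   ≈⟨ *-congʳ G-bracket ⟩
          N * e                   ∎

        neg-* : ∀ x m → (- x) ^ m ≈ (- 1#) ^ m * x ^ m
        neg-* x m = trans (^-congˡ m (solve 1 (λ x → :- x := :- con (+ 1) :* x) refl x)) (^-distrib-* (- 1#) x m)

      expansion₁ : G ≈ ∑ (upTo (suc k)) λ m → (- 1#) ^ m * ν ^ suc m * (N * bracket₁ (- t) ^ m)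
      expansion₁ = begin
        G
          ≈⟨ divide (trans (*-congʳ (bracket-split₁ (- t))) (nilpotent-inverse (suc k) ν-inverse (bracket₁-nilpotent (- t)))) ⟩
        N * ∑ (upTo (suc k)) (λ m → ν * (- (y * ν)) ^ m)
          ≈⟨ *-∑ N (upTo (suc k)) _ ⟩
        ∑ (upTo (suc k)) (λ m → N * (ν * (- (y * ν)) ^ m))
          ≈⟨ ∑-cong (upTo (suc k)) (λ m → trans
               (*-congˡ (*-congˡ (trans (neg-* (y * ν) m) (*-congˡ (^-distrib-* y ν m)))))
               (solve 5 (λ N v s y w → N :* (v :* (s :* (y :* w))) := s :* (v :* w) :* (N :* y)) refl
                 N ν ((- 1#) ^ m) (y ^ m) (ν ^ m))) ⟩
        ∑ (upTo (suc k)) (λ m → (- 1#) ^ m * ν ^ suc m * (N * y ^ m)) ∎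
        where y = bracket₁ (- t)

      -- The inverse of `bracket₀` is `- (Z * ν)`, whose sign cancels that of the geometric series
      -- inside the `m`-th power; only the leading sign survives. Every factor, including the one of
      -- index 0, brings its own `Z` and hence its own `l_a`.
      expansion₂ : G ≈ - ∑ (upTo (suc k)) λ m → ν ^ suc m * (N * z-series * (bracket₂ (- t) * z-series) ^ m)
      expansion₂ = begin
        G
          ≈⟨ divide (trans (*-congʳ (bracket-split₂ (- t))) (nilpotent-inverse (suc k) inverse (bracket₂-nilpotent (- t)))) ⟩
        N * ∑ (upTo (suc k)) (λ m → - (Z * ν) * (- (y * - (Z * ν))) ^ m)
          ≈⟨ *-∑ N (upTo (suc k)) _ ⟩
        ∑ (upTo (suc k)) (λ m → N * (- (Z * ν) * (- (y * - (Z * ν))) ^ m))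
          ≈⟨ ∑-cong (upTo (suc k)) (λ m → trans
               (*-congˡ (*-congˡ (trans (^-congˡ m (solve 3 (λ y Z v → :- (y :* (:- (Z :* v))) := y :* Z :* v) refl y Z ν))
                 (^-distrib-* (y * Z) ν m))))
               (solve 5 (λ N v Z y w → N :* (:- (Z :* v) :* (y :* w)) := :- (v :* w :* (N :* Z :* y))) refl
                 N ν Z ((y * Z) ^ m) (ν ^ m))) ⟩
        ∑ (upTo (suc k)) (λ m → - (ν ^ suc m * (N * Z * (y * Z) ^ m)))
          ≈⟨ ∑-neg (upTo (suc k)) _ ⟨
        - ∑ (upTo (suc k)) (λ m → ν ^ suc m * (N * Z * (y * Z) ^ m)) ∎
        where
        y = bracket₂ (- t)
        Z = z-series
        inverse : bracket₀ * - (Z * ν) ≈ 1#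
        inverse = begin
          bracket₀ * - (Z * ν)        ≈⟨ solve 3 (λ a Z v → a :* (:- (Z :* v)) := a :* (:- Z) :* v) refl bracket₀ Z ν ⟩
          bracket₀ * - Z * ν          ≈⟨ *-congʳ (*-congˡ (trans (-‿cong z-series≈) (solve 1 (λ x → :- (:- x) := x) refl _))) ⟩
          bracket₀ * (1# - ∑ (upTo M) summand-series) * ν ≈⟨ *-congʳ bracket₀-inverse ⟩
          n · 1# * ν                  ≈⟨ ν-inverse ⟩
          1#                          ∎

    -- One more summation variable multiplies the generating function by
    -- (1 + (1 - t) Y X - u B) / (1 - t Y X - u B), where u = q^(b + 1) and B = 1 + X.
    module _ (t : Carrier) (G H : ℕ → Carrier) (G-zero : G 0 ≈ 1#)
      (G-suc : ∀ b → G (suc b) ≈ G b + H b)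
      (H-equation : ∀ b → b < M → H b ≈ summand-series b * (Y * (G b + t * H b)))
      where

      private
        factor : Carrier → ℕ → Carrier
        factor w b = 1# + w * Y * X - q ^ suc b * (1# + X)

        step : ∀ b → b < M → G (suc b) * factor (- t) b ≈ G b * factor (1# - t) b
        step b b<M = begin
          G (suc b) * factor (- t) b
            ≈⟨ *-congʳ (G-suc b) ⟩
          (G b + H b) * factor (- t) b
            ≈⟨ solve 6 (λ g h t X Y v → (g :+ h) :* (con (+ 1) :+ (:- t) :* Y :* X :- v)
                 := g :* (con (+ 1) :+ (:- t) :* Y :* X :- v) :+ (con (+ 1) :- v) :* h :- t :* h :* Y :* X) refl
                 (G b) (H b) t X Y (q ^ suc b * (1# + X)) ⟩
          G b * factor (- t) b + (1# - q ^ suc b * (1# + X)) * H b - t * H b * Y * X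
            ≈⟨ +-congʳ (+-congˡ (*-congˡ (H-equation b b<M))) ⟩
          G b * factor (- t) b + (1# - q ^ suc b * (1# + X)) * (summand-series b * (Y * (G b + t * H b))) - t * H b * Y * X
            ≈⟨ +-congʳ (+-congˡ (trans (sym (*-assoc _ _ _)) (*-congʳ (summand-series-equation b b<M)))) ⟩
          G b * factor (- t) b + X * (Y * (G b + t * H b)) - t * H b * Y * X
            ≈⟨ solve 6 (λ g h t X Y v → g :* (con (+ 1) :+ (:- t) :* Y :* X :- v) :+ X :* (Y :* (g :+ t :* h)) :- t :* h :* Y :* X
                 := g :* (con (+ 1) :+ (con (+ 1) :- t) :* Y :* X :- v)) refl
                 (G b) (H b) t X Y (q ^ suc b * (1# + X)) ⟩
          G b * factor (1# - t) b ∎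

        telescope : ∀ b → b ≤ M → G b * ∏ b (factor (- t)) ≈ ∏ b (factor (1# - t))
        telescope zero    _   = trans (*-identityʳ _) G-zero
        telescope (suc b) b<M = begin
          G (suc b) * (∏ b (factor (- t)) * factor (- t) b)
            ≈⟨ solve 3 (λ g p f → g :* (p :* f) := g :* f :* p) refl (G (suc b)) (∏ b (factor (- t))) (factor (- t) b) ⟩
          G (suc b) * factor (- t) b * ∏ b (factor (- t))
            ≈⟨ *-congʳ (step b b<M) ⟩
          G b * factor (1# - t) b * ∏ b (factor (- t))
            ≈⟨ solve 3 (λ g p f → g :* f :* p := g :* p :* f) refl (G b) (∏ b (factor (- t))) (factor (1# - t) b) ⟩
          G b * ∏ b (factor (- t)) * factor (1# - t) b
            ≈⟨ *-congʳ (telescope b (ℕ.<⇒≤ b<M)) ⟩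
          ∏ b (factor (1# - t)) * factor (1# - t) b ∎

      G-bracket : G M * bracket (- t) ≈ bracket (1# - t)
      G-bracket = begin
        G M * bracket (- t)          ≈⟨ *-congˡ (bracket-product (- t)) ⟨
        G M * ∏ M (factor (- t))     ≈⟨ telescope M ℕ.≤-refl ⟩
        ∏ M (factor (1# - t))        ≈⟨ bracket-product (1# - t) ⟩
        bracket (1# - t)             ∎

-- Powers of double and triple sums as sums over tuples.

module TupleSums {c ℓ c′ ℓ′} (R : CommutativeRing c ℓ) (S : CommutativeRing c′ ℓ′)
  {κ : CommutativeRing.Carrier R → CommutativeRing.Carrier S}
  (κ-isRingHomomorphism : IsRingHomomorphism (CommutativeRing.rawRing R) (CommutativeRing.rawRing S) κ)
  (X Y : CommutativeRing.Carrier S) where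

  private module R = Sums R
  open Sums S
  open Homomorphism (CommutativeRing.rawRing R) S κ-isRingHomomorphism

  private
    term₂ : R.Carrier → ℕ → ℕ → Carrier
    term₂ a i j = κ a * (X ^ j * Y ^ i)

    -- Both `l_a` and `j_a` count towards the degree in `X`; the order `e + j` is that of the weight
    -- condition in `Index₂`.
    term₃ : R.Carrier → ℕ → ℕ → ℕ → Carrier
    term₃ a i j e = κ a * (X ^ (e ℕ.+ j) * Y ^ i)

    term₂-* : ∀ a b i i′ j j′ →
      term₂ a i j * term₂ b i′ j′ ≈ term₂ (a R.* b) (i ℕ.+ i′) (j ℕ.+ j′)
    term₂-* a b i i′ j j′ = begin
      κ a * (X ^ j * Y ^ i) * (κ b * (X ^ j′ * Y ^ i′))
        ≈⟨ solve 6 (λ a x y b x′ y′ → a :* (x :* y) :* (b :* (x′ :* y′)) := a :* b :* (x :* x′ :* (y :* y′))) refl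
             (κ a) (X ^ j) (Y ^ i) (κ b) (X ^ j′) (Y ^ i′) ⟩
      κ a * κ b * (X ^ j * X ^ j′ * (Y ^ i * Y ^ i′))
        ≈⟨ *-cong (*-homo a b) (*-cong (^-homo-* X j j′) (^-homo-* Y i i′)) ⟨
      κ (a R.* b) * (X ^ (j ℕ.+ j′) * Y ^ (i ℕ.+ i′)) ∎

    term₃-* : ∀ a b i i′ j j′ e e′ →
      term₃ a i j e * term₃ b i′ j′ e′ ≈ term₃ (a R.* b) (i ℕ.+ i′) (j ℕ.+ j′) (e ℕ.+ e′)
    term₃-* a b i i′ j j′ e e′ = trans (term₂-* a b i i′ (e ℕ.+ j) (e′ ℕ.+ j′))
      (*-congˡ (*-congʳ (reflexive (≡.cong (X ^_) (interchange e j e′ j′)))))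

  module _ (I J : List ℕ) where

    double : (ℕ → ℕ → R.Carrier) → Carrier
    double w = ∑ I λ i → ∑ J λ j → term₂ (w i j) i j

    double-tuples : ∀ m → (Vec ℕ m → Vec ℕ m → R.Carrier) → Carrier
    double-tuples m w = ∑ (tuples I m) λ is → ∑ (tuples J m) λ js → term₂ (w is js) (Vec.sum is) (Vec.sum js)

    triple : (ℕ → ℕ → ℕ → R.Carrier) → Carrier
    triple w = ∑ I λ i → ∑ J λ j → ∑ J λ e → term₃ (w i j e) i j e

    triple-tuples : ∀ m → (Vec ℕ m → Vec ℕ m → Vec ℕ m → R.Carrier) → Carrier
    triple-tuples m w = ∑ (tuples I m) λ is → ∑ (tuples J m) λ js → ∑ (tuples J m) λ es →
      term₃ (w is js es) (Vec.sum is) (Vec.sum js) (Vec.sum es)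

    -- The head has a weight of its own, because the entry of index 0 comes from the numerator with
    -- `1 - t` and the others from the expanded denominator with `- t`.
    double-∷ : ∀ m w₀ (w : Vec ℕ m → Vec ℕ m → R.Carrier) → double w₀ * double-tuples m w ≈
      double-tuples (suc m) λ is js → w₀ (Vec.head is) (Vec.head js) R.* w (Vec.tail is) (Vec.tail js)
    double-∷ m w₀ w = begin
      double w₀ * double-tuples m w
        ≈⟨ ∑-*-∑ I (tuples I m) _ _ ⟩
      (∑ I λ i → ∑ (tuples I m) λ is → (∑ J λ j → term₂ (w₀ i j) i j) * (∑ (tuples J m) λ js → term₂ (w is js) (Vec.sum is) (Vec.sum js)))
        ≈⟨ ∑-cong I (λ i → ∑-cong (tuples I m) λ is → ∑-*-∑ J (tuples J m) _ _) ⟩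
      (∑ I λ i → ∑ (tuples I m) λ is → ∑ J λ j → ∑ (tuples J m) λ js → term₂ (w₀ i j) i j * term₂ (w is js) (Vec.sum is) (Vec.sum js))
        ≈⟨ ∑-cong I (λ i → ∑-cong (tuples I m) λ is → ∑-cong J λ j → ∑-cong (tuples J m) λ js →
             term₂-* (w₀ i j) (w is js) i (Vec.sum is) j (Vec.sum js)) ⟩
      (∑ I λ i → ∑ (tuples I m) λ is → ∑ J λ j → ∑ (tuples J m) λ js → term₂ (w₀ i j R.* w is js) (i ℕ.+ Vec.sum is) (j ℕ.+ Vec.sum js))
        ≈⟨ ∑-cong I (λ i → ∑-cong (tuples I m) λ is → ∑-tuples-suc J m _) ⟨
      (∑ I λ i → ∑ (tuples I m) λ is → ∑ (tuples J (suc m)) λ js →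
        term₂ (w₀ i (Vec.head js) R.* w is (Vec.tail js)) (i ℕ.+ Vec.sum is) (Vec.sum js))
        ≈⟨ ∑-tuples-suc I m _ ⟨
      (double-tuples (suc m) λ is js → w₀ (Vec.head is) (Vec.head js) R.* w (Vec.tail is) (Vec.tail js)) ∎

    triple-∷ : ∀ m w₀ (w : Vec ℕ m → Vec ℕ m → Vec ℕ m → R.Carrier) → triple w₀ * triple-tuples m w ≈
      triple-tuples (suc m) λ is js es →
        w₀ (Vec.head is) (Vec.head js) (Vec.head es) R.* w (Vec.tail is) (Vec.tail js) (Vec.tail es)
    triple-∷ m w₀ w = begin
      triple w₀ * triple-tuples m w
        ≈⟨ ∑-*-∑ I (tuples I m) _ _ ⟩
      (∑ I λ i → ∑ (tuples I m) λ is → (∑ J λ j → ∑ J λ e → term₃ (w₀ i j e) i j e) *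
        (∑ (tuples J m) λ js → ∑ (tuples J m) λ es → term₃ (w is js es) (Vec.sum is) (Vec.sum js) (Vec.sum es)))
        ≈⟨ ∑-cong I (λ i → ∑-cong (tuples I m) λ is → trans (∑-*-∑ J (tuples J m) _ _)
             (∑-cong J λ j → ∑-cong (tuples J m) λ js → ∑-*-∑ J (tuples J m) _ _)) ⟩
      (∑ I λ i → ∑ (tuples I m) λ is → ∑ J λ j → ∑ (tuples J m) λ js → ∑ J λ e → ∑ (tuples J m) λ es →
        term₃ (w₀ i j e) i j e * term₃ (w is js es) (Vec.sum is) (Vec.sum js) (Vec.sum es))
        ≈⟨ ∑-cong I (λ i → ∑-cong (tuples I m) λ is → ∑-cong J λ j → ∑-cong (tuples J m) λ js →
             ∑-cong J λ e → ∑-cong (tuples J m) λ es →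
             term₃-* (w₀ i j e) (w is js es) i (Vec.sum is) j (Vec.sum js) e (Vec.sum es)) ⟩
      (∑ I λ i → ∑ (tuples I m) λ is → ∑ J λ j → ∑ (tuples J m) λ js → ∑ J λ e → ∑ (tuples J m) λ es →
        term₃ (w₀ i j e R.* w is js es) (i ℕ.+ Vec.sum is) (j ℕ.+ Vec.sum js) (e ℕ.+ Vec.sum es))
        ≈⟨ ∑-cong I (λ i → ∑-cong (tuples I m) λ is → trans (∑-tuples-suc J m _)
             (∑-cong J λ j → ∑-cong (tuples J m) λ js → ∑-tuples-suc J m _)) ⟨
      (∑ I λ i → ∑ (tuples I m) λ is → ∑ (tuples J (suc m)) λ js → ∑ (tuples J (suc m)) λ es →
        term₃ (w₀ i (Vec.head js) (Vec.head es) R.* w is (Vec.tail js) (Vec.tail es)) (i ℕ.+ Vec.sum is) (Vec.sum js) (Vec.sum es))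
        ≈⟨ ∑-tuples-suc I m _ ⟨
      (triple-tuples (suc m) λ is js es →
        w₀ (Vec.head is) (Vec.head js) (Vec.head es) R.* w (Vec.tail is) (Vec.tail js) (Vec.tail es)) ∎

    double-^ : ∀ w m → double w ^ m ≈ double-tuples m (R.product₂ w)
    double-^ w zero    = trans
      (solve 0 (con (+ 1) := con (+ 1) :* (con (+ 1) :* con (+ 1)) :+ con (+ 0) :+ con (+ 0)) refl)
      (+-congʳ (+-congʳ (*-congʳ (sym 1#-homo))))
    double-^ w (suc m) = begin
      double w * double w ^ m                    ≈⟨ *-congˡ (double-^ w m) ⟩
      double w * double-tuples m (R.product₂ w)    ≈⟨ double-∷ m w (R.product₂ w) ⟩
      double-tuples (suc m) (λ is js → w (Vec.head is) (Vec.head js) R.* R.product₂ w (Vec.tail is) (Vec.tail js))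
        ≈⟨ ∑-cong (tuples I (suc m)) (λ { (i ∷ is) → ∑-cong (tuples J (suc m)) λ { (j ∷ js) → refl } }) ⟩
      double-tuples (suc m) (R.product₂ w)         ∎

    triple-^ : ∀ w m → triple w ^ m ≈ triple-tuples m (R.product₃ w)
    triple-^ w zero    = trans
      (solve 0 (con (+ 1) := con (+ 1) :* (con (+ 1) :* con (+ 1)) :+ con (+ 0) :+ con (+ 0) :+ con (+ 0)) refl)
      (+-congʳ (+-congʳ (+-congʳ (*-congʳ (sym 1#-homo)))))
    triple-^ w (suc m) = begin
      triple w * triple w ^ m                    ≈⟨ *-congˡ (triple-^ w m) ⟩
      triple w * triple-tuples m (R.product₃ w)    ≈⟨ triple-∷ m w (R.product₃ w) ⟩
      triple-tuples (suc m) (λ is js es → w (Vec.head is) (Vec.head js) (Vec.head es) R.* R.product₃ w (Vec.tail is) (Vec.tail js) (Vec.tail es))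
        ≈⟨ ∑-cong (tuples I (suc m)) (λ { (i ∷ is) → ∑-cong (tuples J (suc m)) λ { (j ∷ js) →
             ∑-cong (tuples J (suc m)) λ { (e ∷ es) → refl } } }) ⟩
      triple-tuples (suc m) (R.product₃ w)         ∎

-- Entrywise weights and the indicators of the index sets.

module IndexWeights {c ℓ} (R : CommutativeRing c ℓ) (M : ℕ) where

  open Sums R
  open HarmonicSums R

  private
    C′ : ℕ → Carrier
    C′ j = (suc M C suc j) · 1#

    below : ∀ {m} → Vec ℕ m → Vec ℕ m → Carrier
    below is js = χ (does (Pointwise.decidable _≤?_ is js))

    bounded positive : ∀ {m} → Vec ℕ m → Carrier
    bounded js = χ (does (All.all? (_≤? M) js))
    positive js = χ (does (All.all? (1 ≤?_) js))

    χ-index : ∀ a b c d e f g → χ (a ∧ (b ∧ ((c ∧ d) ∧ ((e ∧ f) ∧ g)))) ≈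
      χ a * (χ b * (χ c * χ d * (χ e * χ f * χ g)))
    χ-index a b c d e f g = trans (χ-∧ a _) (*-congˡ (trans (χ-∧ b _) (*-congˡ
      (trans (χ-∧ (c ∧ d) _) (*-cong (χ-∧ c d) (trans (χ-∧ (e ∧ f) g) (*-congʳ (χ-∧ e f))))))))

    l∸i≡ : ∀ {l m} i (is : Vec ℕ m) → i ℕ.+ Vec.sum is ≡ l → l ∸ i ≡ Vec.sum is
    l∸i≡ i is ≡.refl = ℕ.m+n∸m≡n i (Vec.sum is)

  factor₁ : Carrier → ℕ → ℕ → Carrier
  factor₁ w i j = weight M i j * w ^ i

  -- Deciding a condition on a vector is the conjunction of the decisions for head and tail, so
  -- entrywise indicators collect into one indicator for each condition on the whole vector.
  product₂-factor : ∀ {m} w (is js : Vec ℕ m) →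
    product₂ (λ i j → χ (does (1 ≤? j)) * factor₁ w i j) is js ≈
    below is js * (bounded js * positive js) * (prod (Vec.map C′ js) * w ^ Vec.sum is)
  product₂-factor w []       []       =
    solve 0 (con (+ 1) := con (+ 1) :* (con (+ 1) :* con (+ 1)) :* (con (+ 1) :* con (+ 1))) refl
  product₂-factor w (i ∷ is) (j ∷ js) = begin
    χ 1≤j * (χ i≤j * χ j≤M * C′ j * w ^ i) * product₂ _ is js
      ≈⟨ *-congˡ (product₂-factor w is js) ⟩
    χ 1≤j * (χ i≤j * χ j≤M * C′ j * w ^ i) * (below is js * (bounded js * positive js) * (p * w ^ Vec.sum is))
      ≈⟨ solve 10 (λ a b c d e f g h k l → a :* (b :* c :* d :* e) :* (f :* (g :* h) :* (k :* l))
           := b :* f :* (c :* g :* (a :* h)) :* (d :* k :* (e :* l))) refl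
           (χ 1≤j) (χ i≤j) (χ j≤M) (C′ j) (w ^ i) (below is js) (bounded js) (positive js) p (w ^ Vec.sum is) ⟩
    χ i≤j * below is js * (χ j≤M * bounded js * (χ 1≤j * positive js)) * (C′ j * p * (w ^ i * w ^ Vec.sum is))
      ≈⟨ *-cong (*-cong (χ-∧ i≤j _) (*-cong (χ-∧ j≤M _) (χ-∧ 1≤j _))) (*-congˡ (^-homo-* w i (Vec.sum is))) ⟨
    below (i ∷ is) (j ∷ js) * (bounded (j ∷ js) * positive (j ∷ js)) * (prod (Vec.map C′ (j ∷ js)) * w ^ Vec.sum (i ∷ is)) ∎
    where
    1≤j = does (1 ≤? j)
    i≤j = does (i ≤? j)
    j≤M = does (j ≤? M)
    p = prod (Vec.map C′ js)

  index-weight₁ : ∀ k l {m} w₀ w (is js : Vec ℕ (suc m)) →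
    χ (does (Vec.sum is ≟ l)) * (χ (does (Vec.sum js ≟ k)) *
      (factor₁ w₀ (head is) (head js) *
       product₂ (λ i j → χ (does (1 ≤? j)) * factor₁ w i j) (tail is) (tail js)))
    ≈ χ (does (index₁? (suc M) k l m (is , js))) *
      (prod (Vec.map C′ js) * w₀ ^ head is * w ^ (l ∸ head is))
  index-weight₁ k l w₀ w (i ∷ is) (j ∷ js) = begin
    χ sum-i * (χ sum-j * (χ i≤j * χ j≤M * C′ j * w₀ ^ i * product₂ _ is js))
      ≈⟨ *-congˡ (*-congˡ (*-congˡ (product₂-factor w is js))) ⟩
    χ sum-i * (χ sum-j * (χ i≤j * χ j≤M * C′ j * w₀ ^ i *
      (below is js * (bounded js * positive js) * (p * w ^ Vec.sum is))))
      -- The product yields the exponent `i_1 + ⋯ + i_m`; only where the indicator of the depth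
      -- condition is nonzero does it equal `l - i_0`.
      ≈⟨ χ-guard (i ℕ.+ Vec.sum is ≟ l) (λ eq → *-congˡ (*-congˡ (*-congˡ (*-congˡ
           (reflexive (≡.cong (w ^_) (≡.sym (l∸i≡ i is eq)))))))) ⟩
    χ sum-i * (χ sum-j * (χ i≤j * χ j≤M * C′ j * w₀ ^ i *
      (below is js * (bounded js * positive js) * (p * w ^ (l ∸ i)))))
      ≈⟨ solve 11 (λ s s′ b c d e f g h k l → s :* (s′ :* (b :* c :* d :* e :* (f :* (g :* h) :* (k :* l))))
           := s :* (s′ :* (b :* f :* (c :* g :* h))) :* (d :* k :* e :* l)) refl
           (χ sum-i) (χ sum-j) (χ i≤j) (χ j≤M) (C′ j) (w₀ ^ i) (below is js) (bounded js) (positive js) p (w ^ (l ∸ i)) ⟩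
    χ sum-i * (χ sum-j * (χ i≤j * below is js * (χ j≤M * bounded js * positive js))) * (C′ j * p * w₀ ^ i * w ^ (l ∸ i))
      ≈⟨ *-congʳ (χ-index sum-i sum-j i≤j (does (Pointwise.decidable _≤?_ is js))
           j≤M (does (All.all? (_≤? M) js)) (does (All.all? (1 ≤?_) js))) ⟨
    χ (does (index₁? (suc M) k l _ (i ∷ is , j ∷ js))) * (C′ j * p * w₀ ^ i * w ^ (l ∸ i)) ∎
    where
    sum-i = does (i ℕ.+ Vec.sum is ≟ l)
    sum-j = does (j ℕ.+ Vec.sum js ≟ k)
    i≤j = does (i ≤? j)
    j≤M = does (j ≤? M)
    p = prod (Vec.map C′ js)

  module _ (z : ℕ → Carrier) where

    private
      C′z : ℕ → ℕ → Carrier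
      C′z j e = C′ j * z e

    product₃-factor : ∀ {m} w (is js es : Vec ℕ m) →
      product₃ (λ i j e → χ (does (1 ≤? i)) * factor₁ w i j * z e) is js es ≈
      below is js * (bounded js * positive is) * (prod (Vec.zipWith C′z js es) * w ^ Vec.sum is)
    product₃-factor w []       []       []       =
      solve 0 (con (+ 1) := con (+ 1) :* (con (+ 1) :* con (+ 1)) :* (con (+ 1) :* con (+ 1))) refl
    product₃-factor w (i ∷ is) (j ∷ js) (e ∷ es) = begin
      χ 1≤i * (χ i≤j * χ j≤M * C′ j * w ^ i) * z e * product₃ _ is js es
        ≈⟨ *-congˡ (product₃-factor w is js es) ⟩
      χ 1≤i * (χ i≤j * χ j≤M * C′ j * w ^ i) * z e * (below is js * (bounded js * positive is) * (p * w ^ Vec.sum is))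
        ≈⟨ solve 11 (λ a b c d z e f g h k l → a :* (b :* c :* d :* e) :* z :* (f :* (g :* h) :* (k :* l))
             := b :* f :* (c :* g :* (a :* h)) :* (d :* z :* k :* (e :* l))) refl
             (χ 1≤i) (χ i≤j) (χ j≤M) (C′ j) (z e) (w ^ i) (below is js) (bounded js) (positive is) p (w ^ Vec.sum is) ⟩
      χ i≤j * below is js * (χ j≤M * bounded js * (χ 1≤i * positive is)) * (C′z j e * p * (w ^ i * w ^ Vec.sum is))
        ≈⟨ *-cong (*-cong (χ-∧ i≤j _) (*-cong (χ-∧ j≤M _) (χ-∧ 1≤i _))) (*-congˡ (^-homo-* w i (Vec.sum is))) ⟨
      below (i ∷ is) (j ∷ js) * (bounded (j ∷ js) * positive (i ∷ is)) *
        (prod (Vec.zipWith C′z (j ∷ js) (e ∷ es)) * w ^ Vec.sum (i ∷ is)) ∎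
      where
      1≤i = does (1 ≤? i)
      i≤j = does (i ≤? j)
      j≤M = does (j ≤? M)
      p = prod (Vec.zipWith C′z js es)

    index-weight₂ : ∀ k l {m} w₀ w (is js es : Vec ℕ (suc m)) →
      χ (does (Vec.sum is ≟ l)) * (χ (does (Vec.sum es ℕ.+ Vec.sum js ≟ k)) *
        (factor₁ w₀ (head is) (head js) * z (head es) *
         product₃ (λ i j e → χ (does (1 ≤? i)) * factor₁ w i j * z e) (tail is) (tail js) (tail es)))
      ≈ χ (does (index₂? (suc M) k l m (is , js , es))) *
        (prod (Vec.zipWith C′z js es) * w₀ ^ head is * w ^ (l ∸ head is))
    index-weight₂ k l w₀ w (i ∷ is) (j ∷ js) (e ∷ es) = begin
      χ sum-i * (χ sum-j * (χ i≤j * χ j≤M * C′ j * w₀ ^ i * z e * product₃ _ is js es))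
        ≈⟨ *-congˡ (*-congˡ (*-congˡ (product₃-factor w is js es))) ⟩
      χ sum-i * (χ sum-j * (χ i≤j * χ j≤M * C′ j * w₀ ^ i * z e *
        (below is js * (bounded js * positive is) * (p * w ^ Vec.sum is))))
        ≈⟨ χ-guard (i ℕ.+ Vec.sum is ≟ l) (λ eq → *-congˡ (*-congˡ (*-congˡ (*-congˡ
             (reflexive (≡.cong (w ^_) (≡.sym (l∸i≡ i is eq)))))))) ⟩
      χ sum-i * (χ sum-j * (χ i≤j * χ j≤M * C′ j * w₀ ^ i * z e *
        (below is js * (bounded js * positive is) * (p * w ^ (l ∸ i)))))
        ≈⟨ solve 12 (λ s s′ b c d e z f g h k l → s :* (s′ :* (b :* c :* d :* e :* z :* (f :* (g :* h) :* (k :* l))))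
             := s :* (s′ :* (b :* f :* (c :* g :* h))) :* (d :* z :* k :* e :* l)) refl
             (χ sum-i) (χ sum-j) (χ i≤j) (χ j≤M) (C′ j) (w₀ ^ i) (z e) (below is js) (bounded js) (positive is) p (w ^ (l ∸ i)) ⟩
      χ sum-i * (χ sum-j * (χ i≤j * below is js * (χ j≤M * bounded js * positive is))) * (C′z j e * p * w₀ ^ i * w ^ (l ∸ i))
        ≈⟨ *-congʳ (χ-index sum-i sum-j i≤j (does (Pointwise.decidable _≤?_ is js))
             j≤M (does (All.all? (_≤? M) js)) (does (All.all? (1 ≤?_) is))) ⟨
      χ (does (index₂? (suc M) k l _ (i ∷ is , j ∷ js , e ∷ es))) * (C′z j e * p * w₀ ^ i * w ^ (l ∸ i)) ∎
      where
      sum-i = does (i ℕ.+ Vec.sum is ≟ l)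
      sum-j = does (e ℕ.+ Vec.sum es ℕ.+ (j ℕ.+ Vec.sum js) ≟ k)
      i≤j = does (i ≤? j)
      j≤M = does (j ≤? M)
      p = prod (Vec.zipWith C′z js es)

-- Recursion for the generating function of the interpolated sums.

module GeneratingFunction {c ℓ c′ ℓ′} (R : CommutativeRing c ℓ) (S : CommutativeRing c′ ℓ′)
  {ι : CommutativeRing.Carrier R → CommutativeRing.Carrier S}
  (ι-isRingHomomorphism : IsRingHomomorphism (CommutativeRing.rawRing R) (CommutativeRing.rawRing S) ι)
  (X : CommutativeRing.Carrier S) (q t : CommutativeRing.Carrier R) (r : ℕ → CommutativeRing.Carrier R)
  (K : ℕ) where

  private
    module R = Sums R
  open HarmonicSums R using (summand; module Fillings)
  open Fillings t using (interpolated; interpolated-top; interpolated-suc; interpolated-zero; interpolated-top-∷)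
  open Sums S
  open Homomorphism (CommutativeRing.rawRing R) S ι-isRingHomomorphism

  positive : ∀ {l} → Vec ℕ l → R.Carrier
  positive ks = R.χ (does (All.all? (1 ≤?_) ks))

  -- The box and the positivity condition are those of `multiIndices`, so that for `K = k` the
  -- coefficient of `X^k` becomes a sum over multi-indices of weight `k`.
  series : ∀ l → (Vec ℕ l → R.Carrier) → Carrier
  series l f = ∑ (tuples (upTo (suc K)) l) λ ks → ι (positive ks R.* f ks) * X ^ Vec.sum ks

  -- For fixed `b`, the dependence on the depth `l` is itself a power series in `Y`: `G b` and `H b`
  -- serve directly as elements of the ring with two variables.
  G H : ℕ → ℕ → Carrier
  G b l = series l (interpolated q r b)
  H b l = series l (interpolated-top q r b)

  F : ℕ → Carrier
  F b = ∑ (upTo (suc K)) λ a → ι (R.χ (does (1 ≤? a)) R.* summand q r a b) * X ^ a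

  series-cong : ∀ l {f g} → (∀ (ks : Vec ℕ l) → f ks R.≈ g ks) → series l f ≈ series l g
  series-cong l f≈g = ∑-cong (tuples (upTo (suc K)) l) λ ks → *-congʳ (⟦⟧-cong (R.*-congˡ (f≈g ks)))

  series-+ : ∀ l (f g : Vec ℕ l → R.Carrier) → series l (λ ks → f ks R.+ g ks) ≈ series l f + series l g
  series-+ l f g = trans (∑-cong (tuples (upTo (suc K)) l) λ ks → begin
      ι (positive ks R.* (f ks R.+ g ks)) * X ^ Vec.sum ks
        ≈⟨ *-congʳ (trans (⟦⟧-cong (R.distribˡ (positive ks) (f ks) (g ks))) (+-homo _ _)) ⟩
      (ι (positive ks R.* f ks) + ι (positive ks R.* g ks)) * X ^ Vec.sum ks
        ≈⟨ distribʳ _ _ _ ⟩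
      ι (positive ks R.* f ks) * X ^ Vec.sum ks + ι (positive ks R.* g ks) * X ^ Vec.sum ks ∎)
    (∑-+ (tuples (upTo (suc K)) l) _ _)

  series-* : ∀ l a (f : Vec ℕ l → R.Carrier) → series l (λ ks → a R.* f ks) ≈ ι a * series l f
  series-* l a f = trans (∑-cong (tuples (upTo (suc K)) l) λ ks → begin
      ι (positive ks R.* (a R.* f ks)) * X ^ Vec.sum ks
        ≈⟨ *-congʳ (trans (⟦⟧-cong (R.solve 3 (λ p a f → p R.:* (a R.:* f) R.:= a R.:* (p R.:* f)) R.refl (positive ks) a (f ks)))
             (*-homo _ _)) ⟩
      ι a * ι (positive ks R.* f ks) * X ^ Vec.sum ks
        ≈⟨ *-assoc _ _ _ ⟩
      ι a * (ι (positive ks R.* f ks) * X ^ Vec.sum ks) ∎)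
    (sym (*-∑ (ι a) (tuples (upTo (suc K)) l) _))

  series-zero : ∀ l {f} → (∀ (ks : Vec ℕ l) → f ks R.≈ R.0#) → series l f ≈ 0#
  series-zero l f≈0 = ∑-zero (tuples (upTo (suc K)) l) λ ks →
    trans (*-congʳ (trans (⟦⟧-cong (R.trans (R.*-congˡ (f≈0 ks)) (R.zeroʳ _))) 0#-homo)) (zeroˡ _)

  G-suc : ∀ b l → G (suc b) l ≈ G b l + H b l
  G-suc b l = trans (series-cong l (interpolated-suc q r b)) (series-+ l _ _)

  G-zero-zero : G 0 0 ≈ 1#
  G-zero-zero = trans (+-identityʳ _) (trans (*-identityʳ _) (trans (⟦⟧-cong (R.*-identityˡ R.1#)) 1#-homo))

  G-zero-suc : ∀ l → G 0 (suc l) ≈ 0#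
  G-zero-suc l = series-zero (suc l) λ { (k ∷ ks) → interpolated-zero q r k ks }

  H-zero : ∀ b → H b 0 ≈ 0#
  H-zero b = series-zero 0 {interpolated-top q r b} λ { [] → R.refl }

  H-suc : ∀ {b} → (R.1# R.- q R.^ suc b) R.* r b R.≈ R.1# → ∀ l → H b (suc l) ≈ F b * (G b l + ι t * H b l)
  H-suc {b} inverse l = begin
    H b (suc l)
      ≈⟨ ∑-tuples-suc (upTo (suc K)) l _ ⟩
    (∑ (upTo (suc K)) λ a → ∑ (tuples (upTo (suc K)) l) λ ks →
      ι (positive (a ∷ ks) R.* interpolated-top q r b (a ∷ ks)) * X ^ (a ℕ.+ Vec.sum ks))
      ≈⟨ ∑-cong (upTo (suc K)) (λ a → ∑-cong (tuples (upTo (suc K)) l) λ ks → begin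
           ι (positive (a ∷ ks) R.* interpolated-top q r b (a ∷ ks)) * X ^ (a ℕ.+ Vec.sum ks)
             ≈⟨ *-cong (trans (⟦⟧-cong (split a ks)) (*-homo _ _)) (^-homo-* X a (Vec.sum ks)) ⟩
           ι (R.χ (does (1 ≤? a)) R.* summand q r a b) * ι (positive ks R.* next ks) * (X ^ a * X ^ Vec.sum ks)
             ≈⟨ solve 4 (λ a b x y → a :* b :* (x :* y) := a :* x :* (b :* y)) refl _ _ _ _ ⟩
           ι (R.χ (does (1 ≤? a)) R.* summand q r a b) * X ^ a * (ι (positive ks R.* next ks) * X ^ Vec.sum ks) ∎) ⟩
    (∑ (upTo (suc K)) λ a → ∑ (tuples (upTo (suc K)) l) λ ks →
      ι (R.χ (does (1 ≤? a)) R.* summand q r a b) * X ^ a * (ι (positive ks R.* next ks) * X ^ Vec.sum ks))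
      ≈⟨ ∑-*-∑ (upTo (suc K)) (tuples (upTo (suc K)) l) _ _ ⟨
    F b * series l next
      ≈⟨ *-congˡ (trans (series-+ l _ _) (+-congˡ (series-* l t (interpolated-top q r b)))) ⟩
    F b * (G b l + ι t * H b l) ∎
    where
    next : Vec ℕ l → R.Carrier
    next ks = interpolated q r b ks R.+ t R.* interpolated-top q r b ks

    split : ∀ a ks → positive (a ∷ ks) R.* interpolated-top q r b (a ∷ ks) R.≈
            R.χ (does (1 ≤? a)) R.* summand q r a b R.* (positive ks R.* next ks)
    split a ks = R.begin
      positive (a ∷ ks) R.* interpolated-top q r b (a ∷ ks)
        R.≈⟨ R.*-congʳ (R.χ-∧ (does (1 ≤? a)) _) ⟩
      R.χ (does (1 ≤? a)) R.* positive ks R.* interpolated-top q r b (a ∷ ks)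
        R.≈⟨ R.*-assoc _ _ _ ⟩
      R.χ (does (1 ≤? a)) R.* (positive ks R.* interpolated-top q r b (a ∷ ks))
        -- The box also contains tuples with zero entries, for which the merging identity is not
        -- claimed; the indicators supply the positivity it needs.
        R.≈⟨ R.χ-guard (1 ≤? a) (λ 1≤a → R.χ-guard (All.all? (1 ≤?_) ks) (λ 1≤ks → interpolated-top-∷ q r inverse ks 1≤a 1≤ks)) ⟩
      R.χ (does (1 ≤? a)) R.* (positive ks R.* (summand q r a b R.* next ks))
        R.≈⟨ R.solve 4 (λ x p s n → x R.:* (p R.:* (s R.:* n)) R.:= x R.:* s R.:* (p R.:* n)) R.refl
              (R.χ (does (1 ≤? a))) (positive ks) (summand q r a b) (next ks) ⟩
      R.χ (does (1 ≤? a)) R.* summand q r a b R.* (positive ks R.* next ks) R.∎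

-- Two truncated variables and the extraction of coefficients.

-- R[X, Y] / (X^(k+1), Y^(l+1)); an element is indexed first by the degree in Y.

module TwoVariables {c ℓ} (R : CommutativeRing c ℓ) (k l : ℕ) where

  private
    module R  = Sums R
    module RT = Truncated R

  inner : CommutativeRing c ℓ
  inner = RT.truncated k

  private
    module I  = Sums inner
    module IT = Truncated inner

  outer : CommutativeRing c ℓ
  outer = IT.truncated l

  private
    module O = Sums outer
    module IO = Homomorphism I.rawRing outer (IT.ι-isRingHomomorphism l)

  X Y : O.Carrier
  X = IT.ι RT.x
  Y = IT.x

  κ : R.Carrier → O.Carrier
  κ a = IT.ι (RT.ι a)

  κ-isRingHomomorphism : IsRingHomomorphism R.rawRing O.rawRing κ
  κ-isRingHomomorphism = Composition.isRingHomomorphism O.trans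
    (RT.ι-isRingHomomorphism k) (IT.ι-isRingHomomorphism l)

  X-nilpotent : X O.^ suc k O.≈ O.0#
  X-nilpotent = O.trans (O.sym (IO.^-homo RT.x (suc k)))
    (O.trans (IO.⟦⟧-cong (RT.x-nilpotent k)) IO.0#-homo)

  Y-nilpotent : Y O.^ suc l O.≈ O.0#
  Y-nilpotent = IT.x-nilpotent l

  coefficient-cong : ∀ {f g} → f O.≈ g → f l k R.≈ g l k
  coefficient-cong f≈g = f≈g l ℕ.≤-refl k ℕ.≤-refl

  coefficient-∑ : ∀ {a} {A : Set a} (xs : List A) f → O.∑ xs f l k R.≈ R.∑ xs (λ x → f x l k)
  coefficient-∑ xs f = R.trans (IT.coefficient-∑ l xs f l k ℕ.≤-refl) (RT.coefficient-∑ k xs (λ x → f x l) k)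

  coefficient-κ : ∀ a f → (κ a O.* f) l k R.≈ a R.* f l k
  coefficient-κ a f = R.trans (IT.conv-ι (RT.ι a) f l k ℕ.≤-refl) (RT.conv-ι a (f l) k)

  coefficient-monomial : ∀ i j → (X O.^ j O.* Y O.^ i) l k R.≈ R.χ (does (i ≟ l)) R.* R.χ (does (j ≟ k))
  coefficient-monomial i j = R.trans
    (coefficient-cong {X O.^ j O.* Y O.^ i} {IT.ι (RT.x I.^ j) O.* Y O.^ i}
      (O.*-congʳ {Y O.^ i} (O.sym (IO.^-homo RT.x j))))
    (R.trans (IT.coefficient-monomial l (RT.x I.^ j) i l k ℕ.≤-refl) (select (does (i ≟ l))))
    where
    select : ∀ b → (I.χ b I.* RT.x I.^ j) k R.≈ R.χ b R.* R.χ (does (j ≟ k))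
    select false = R.trans (RT.conv-zero (RT.x I.^ j) k) (R.sym (R.zeroˡ _))
    select true  = R.trans (RT.conv-ι R.1# (RT.x I.^ j) k) (R.*-congˡ (RT.x^-coefficient k j k))

  coefficient-term : ∀ a i j → (κ a O.* (X O.^ j O.* Y O.^ i)) l k R.≈
                     R.χ (does (i ≟ l)) R.* (R.χ (does (j ≟ k)) R.* a)
  coefficient-term a i j = R.trans (coefficient-κ a (X O.^ j O.* Y O.^ i))
    (R.trans (R.*-congˡ (coefficient-monomial i j)) (R.trans (R.*-comm _ _) (R.*-assoc _ _ _)))

-- Both formulas over a commutative ring containing `t`.

module Expansion {c ℓ} (R : CommutativeRing c ℓ) where

  open Sums R

  module AtRoot (k l : ℕ) (q : Carrier) (M : ℕ) (qⁿ≈1 : q ^ suc M ≈ 1#) (r : ℕ → Carrier)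
    (r-inverse : ∀ b → b < M → (1# - q ^ suc b) * r b ≈ 1#)
    (ν : Carrier) (ν-inverse : suc M · 1# * ν ≈ 1#) (t : Carrier) where

    open HarmonicSums R
    open Fillings t using (interpolated)
    open IndexWeights R M
    open TwoVariables R k l

    private
      module RT = Truncated R
      module I  = Sums inner
      module IT = Truncated inner
      module O  = Sums outer
      module IO = Homomorphism I.rawRing outer (IT.ι-isRingHomomorphism l)
      module RO = Homomorphism rawRing outer κ-isRingHomomorphism
      module OH = HarmonicSums outer
      open HarmonicHomomorphism R outer κ-isRingHomomorphism q r
      module GF = GeneratingFunction R inner (RT.ι-isRingHomomorphism k) RT.x q t r k
      module TS = TupleSums R outer κ-isRingHomomorphism X Y

      q′ ν′ t′ : O.Carrier
      q′ = κ q
      ν′ = κ ν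
      t′ = κ t
      r′ : ℕ → O.Carrier
      r′ b = κ (r b)

      qⁿ≈1′ : q′ O.^ suc M O.≈ O.1#
      qⁿ≈1′ = O.trans (O.sym (RO.^-homo q (suc M))) (O.trans (RO.⟦⟧-cong qⁿ≈1) RO.1#-homo)

      κ-1- : ∀ {a a′} → κ a O.≈ a′ → κ (1# - a) O.≈ O.1# O.- a′
      κ-1- {a} eq = O.trans (RO.+-homo 1# (- a)) (O.+-cong RO.1#-homo (O.trans (RO.-‿homo a) (O.-‿cong eq)))

      r-inverse′ : ∀ b → b < M → (O.1# O.- q′ O.^ suc b) O.* r′ b O.≈ O.1#
      r-inverse′ b b<M = O.trans (O.*-congʳ (O.sym (κ-1- (RO.^-homo q (suc b)))))
        (O.trans (O.sym (RO.*-homo _ (r b))) (O.trans (RO.⟦⟧-cong (r-inverse b b<M)) RO.1#-homo))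

      ν-inverse′ : suc M O.· O.1# O.* ν′ O.≈ O.1#
      ν-inverse′ = O.trans (O.*-congʳ (O.sym (RO.×1-homo (suc M))))
        (O.trans (O.sym (RO.*-homo _ ν)) (O.trans (RO.⟦⟧-cong ν-inverse) RO.1#-homo))

      module B = Bracket.Brackets outer q′ M qⁿ≈1′ r′ r-inverse′ X Y k l X-nilpotent Y-nilpotent

      factor₁-homo : ∀ {w w′} → κ w O.≈ w′ → ∀ i j → κ (factor₁ w i j) O.≈ OH.weight M i j O.* w′ O.^ i
      factor₁-homo {w} eq i j = O.trans (RO.*-homo _ _)
        (O.*-cong (weight-homo M i j) (O.trans (RO.^-homo w i) (O.^-congˡ i eq)))

      summand-series≈ : ∀ b → B.summand-series b O.≈ IT.ι (GF.F b)
      summand-series≈ b = O.sym (O.trans (IO.∑-homo (upTo (suc k)) _) (O.∑-cong (upTo (suc k)) λ a →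
        O.trans (IO.*-homo (RT.ι (χ (does (1 ≤? a)) * summand q r a b)) (RT.x I.^ a))
          (O.trans (O.*-cong (O.trans (RO.*-homo _ _) (O.*-cong (χ-homo (does (1 ≤? a))) (summand-homo a b))) (IO.^-homo RT.x a))
            (O.*-assoc _ _ _))))

      -- Multiplication by `Y` raises the depth by one, so this single equation collects `GF.H-suc`
      -- for all depths, with `GF.H-zero` at degree zero in `Y`.
      H-equation : ∀ b → b < M → GF.H b O.≈ B.summand-series b O.* (Y O.* (GF.G b O.+ t′ O.* GF.H b))
      H-equation b b<M = O.trans lemma (O.*-congʳ {Y O.* next} (O.sym (summand-series≈ b)))
        where
        next : O.Carrier
        next = GF.G b O.+ t′ O.* GF.H b
        lemma : GF.H b O.≈ IT.ι (GF.F b) O.* (Y O.* next)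
        lemma zero    _ = I.trans (GF.H-zero b) (I.sym (I.trans (I.*-congˡ {GF.F b} (IT.conv-x-zero next)) (I.zeroʳ (GF.F b))))
        lemma (suc d) _ = I.trans (GF.H-suc (r-inverse b b<M) d) (I.sym (I.trans
          (IT.conv-ι (GF.F b) (Y O.* next) (suc d))
          (I.*-congˡ {GF.F b} (I.trans (IT.conv-x-suc next d)
            (I.+-congˡ {GF.G b d} (IT.conv-ι (RT.ι t) (GF.H b) d))))))

      G-bracket : GF.G M O.* B.bracket (O.- t′) O.≈ B.bracket (O.1# O.- t′)
      G-bracket = B.G-bracket t′ GF.G GF.H
        (λ { zero _ → GF.G-zero-zero ; (suc d) _ → GF.G-zero-suc d })
        (λ b d _ → GF.G-suc b d) H-equation

    ∑-multiIndices : GF.G M l k ≈ ∑ (multiIndices k l) (interpolated q r M)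
    ∑-multiIndices = begin
      GF.G M l k
        ≈⟨ RT.coefficient-∑ k (tuples (upTo (suc k)) l) _ k ⟩
      ∑ (tuples (upTo (suc k)) l) (λ ks → (RT.ι (GF.positive ks * interpolated q r M ks) I.* RT.x I.^ Vec.sum ks) k)
        ≈⟨ ∑-cong (tuples (upTo (suc k)) l) (λ ks → trans (RT.coefficient-monomial k _ (Vec.sum ks) k)
             (trans (sym (*-assoc _ _ _)) (*-congʳ (sym (χ-∧ (does (Vec.sum ks ≟ k)) _))))) ⟩
      ∑ (tuples (upTo (suc k)) l) (λ ks → χ (does (isMultiIndex? k ks)) * interpolated q r M ks)
        ≈⟨ ∑-filter (isMultiIndex? k) (tuples (upTo (suc k)) l) _ ⟨
      ∑ (multiIndices k l) (interpolated q r M) ∎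

    private
      I J : List ℕ
      I = upTo (suc l)
      J = upTo (suc k)

      w₀ w : Carrier
      w₀ = 1# - t
      w = - t

      w₀-homo : κ w₀ O.≈ O.1# O.- t′
      w₀-homo = κ-1- O.refl

      w-homo : κ w O.≈ O.- t′
      w-homo = RO.-‿homo t

      p₁ : ℕ → ℕ → Carrier
      p₁ i j = χ (does (1 ≤? j)) * factor₁ w i j

      bracket≈ : B.bracket (O.1# O.- t′) O.≈ TS.double I J (factor₁ w₀)
      bracket≈ = O.∑-cong I λ i → O.∑-cong J λ j →
        O.*-congʳ {X O.^ j O.* Y O.^ i} (O.sym (factor₁-homo w₀-homo i j))

      bracket₁≈ : B.bracket₁ (O.- t′) O.≈ TS.double I J p₁
      bracket₁≈ = O.∑-cong I λ i → O.∑-cong J λ j → O.sym (O.trans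
        (O.*-congʳ {X O.^ j O.* Y O.^ i} (O.trans (RO.*-homo _ _)
          (O.*-cong (χ-homo (does (1 ≤? j))) (factor₁-homo w-homo i j))))
        (O.*-assoc _ _ _))

      scalar-homo : ∀ m → κ ((- 1#) ^ m * ν ^ suc m) O.≈ (O.- O.1#) O.^ m O.* ν′ O.^ suc m
      scalar-homo m = O.trans (RO.*-homo _ _) (O.*-cong
        (O.trans (RO.^-homo (- 1#) m) (O.^-congˡ m (O.trans (RO.-‿homo 1#) (O.-‿cong RO.1#-homo))))
        (RO.^-homo ν (suc m)))

    expansion₁ : ∑ (multiIndices k l) (interpolated q r M) ≈
      ∑ (upTo (suc k)) λ m → (- 1#) ^ m * ν ^ suc m * ∑ (indices₁ (suc M) k l m) λ (i , j) →
        prod (Vec.map (λ jₐ → (suc M C suc jₐ) · 1#) j) * (1# - t) ^ head i * (- t) ^ (l ∸ head i)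
    expansion₁ = begin
      ∑ (multiIndices k l) (interpolated q r M)
        ≈⟨ ∑-multiIndices ⟨
      GF.G M l k
        ≈⟨ coefficient-cong (B.expansion₁ ν′ ν-inverse′ (GF.G M) t′ G-bracket) ⟩
      O.∑ J (λ m → (O.- O.1#) O.^ m O.* ν′ O.^ suc m O.* product m) l k
        ≈⟨ coefficient-∑ J _ ⟩
      ∑ J (λ m → ((O.- O.1#) O.^ m O.* ν′ O.^ suc m O.* product m) l k)
        ≈⟨ ∑-cong J (λ m → trans
             (coefficient-cong (O.*-cong (O.sym (scalar-homo m)) (product≈ m)))
             (trans (coefficient-κ _ (tuple-sum m)) (*-congˡ (coefficient-tuple-sum m)))) ⟩
      ∑ J (λ m → (- 1#) ^ m * ν ^ suc m * ∑ (indices₁ (suc M) k l m) (value m)) ∎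
      where
      product : ℕ → O.Carrier
      product m = B.bracket (O.1# O.- t′) O.* B.bracket₁ (O.- t′) O.^ m

      coef : ∀ m → Vec ℕ (suc m) → Vec ℕ (suc m) → Carrier
      coef m is js = factor₁ w₀ (head is) (head js) * product₂ p₁ (tail is) (tail js)

      tuple-sum : ℕ → O.Carrier
      tuple-sum m = TS.double-tuples I J (suc m) (coef m)

      product≈ : ∀ m → product m O.≈ tuple-sum m
      product≈ m = O.trans
        (O.*-cong bracket≈ (O.trans (O.^-congˡ m bracket₁≈) (TS.double-^ I J p₁ m)))
        (TS.double-∷ I J m (factor₁ w₀) (product₂ p₁))

      value : ∀ m → Vec ℕ (suc m) × Vec ℕ (suc m) → Carrier
      value m (i , j) = prod (Vec.map (λ jₐ → (suc M C suc jₐ) · 1#) j) * w₀ ^ head i * w ^ (l ∸ head i)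

      coefficient-tuple-sum : ∀ m → tuple-sum m l k ≈ ∑ (indices₁ (suc M) k l m) (value m)
      coefficient-tuple-sum m = begin
        tuple-sum m l k
          ≈⟨ trans (coefficient-∑ (tuples I (suc m)) _) (∑-cong (tuples I (suc m)) λ is → coefficient-∑ (tuples J (suc m)) _) ⟩
        (∑ (tuples I (suc m)) λ is → ∑ (tuples J (suc m)) λ js →
          (κ (coef m is js) O.* (X O.^ Vec.sum js O.* Y O.^ Vec.sum is)) l k)
          ≈⟨ ∑-cong (tuples I (suc m)) (λ is → ∑-cong (tuples J (suc m)) λ js →
               trans (coefficient-term (coef m is js) (Vec.sum is) (Vec.sum js)) (index-weight₁ k l w₀ w is js)) ⟩
        (∑ (tuples I (suc m)) λ is → ∑ (tuples J (suc m)) λ js →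
          χ (does (index₁? (suc M) k l m (is , js))) * value m (is , js))
          ≈⟨ ∑-cartesianProductWith _,_ (tuples I (suc m)) (tuples J (suc m)) _ ⟨
        ∑ (cartesianProduct (tuples I (suc m)) (tuples J (suc m))) (λ ij → χ (does (index₁? (suc M) k l m ij)) * value m ij)
          ≈⟨ ∑-filter (index₁? (suc M) k l m) (cartesianProduct (tuples I (suc m)) (tuples J (suc m))) (value m) ⟨
        ∑ (indices₁ (suc M) k l m) (value m) ∎

    private
      z : ℕ → Carrier
      z = harmonic₁ q r M

      p₂ : ℕ → ℕ → ℕ → Carrier
      p₂ i j e = χ (does (1 ≤? i)) * factor₁ w i j * z e

      -- Attaches an index `l_a` to each pair `(i_a, j_a)`. It serves both the numerator and the
      -- remainder of the denominator, which differ only in their coefficients.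
      times-z-series : ∀ (a : ℕ → ℕ → Carrier) (f : ℕ → ℕ → O.Carrier) → (∀ i j → f i j O.≈ κ (a i j) O.* (X O.^ j O.* Y O.^ i)) →
        (O.∑ I λ i → O.∑ J λ j → f i j) O.* B.z-series O.≈ TS.triple I J (λ i j e → a i j * z e)
      times-z-series a f f≈ = O.trans (O.∑-* I (λ i → O.∑ J (f i)) B.z-series) (O.∑-cong I λ i → O.trans
        (O.∑-*-∑ J J (f i) (λ e → OH.harmonic₁ q′ r′ M e O.* X O.^ e)) (O.∑-cong J λ j → O.∑-cong J λ e → O.begin
          f i j O.* (OH.harmonic₁ q′ r′ M e O.* X O.^ e)
            O.≈⟨ O.*-cong (f≈ i j) (O.*-congʳ {X O.^ e} (O.sym (harmonic₁-homo M e))) ⟩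
          κ (a i j) O.* (X O.^ j O.* Y O.^ i) O.* (κ (z e) O.* X O.^ e)
            O.≈⟨ rearrange (κ (a i j)) (X O.^ j) (Y O.^ i) (κ (z e)) (X O.^ e) ⟩
          κ (a i j) O.* κ (z e) O.* (X O.^ e O.* X O.^ j O.* Y O.^ i)
            O.≈⟨ O.*-cong (RO.*-homo (a i j) (z e)) (O.*-congʳ {Y O.^ i} (O.^-homo-* X e j)) ⟨
          κ (a i j * z e) O.* (X O.^ (e ℕ.+ j) O.* Y O.^ i) O.∎))
        where
        rearrange : ∀ a x y b v → a O.* (x O.* y) O.* (b O.* v) O.≈ a O.* b O.* (v O.* x O.* y)
        rearrange = O.solve 5 (λ a x y b v → a O.:* (x O.:* y) O.:* (b O.:* v) O.:= a O.:* b O.:* (v O.:* x O.:* y)) O.refl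

      bracket-z≈ : B.bracket (O.1# O.- t′) O.* B.z-series O.≈ TS.triple I J (λ i j e → factor₁ w₀ i j * z e)
      bracket-z≈ = times-z-series (factor₁ w₀) (B.mono (O.1# O.- t′)) λ i j →
        O.*-congʳ {X O.^ j O.* Y O.^ i} (O.sym (factor₁-homo w₀-homo i j))

      bracket₂-z≈ : B.bracket₂ (O.- t′) O.* B.z-series O.≈ TS.triple I J p₂
      bracket₂-z≈ = times-z-series (λ i j → χ (does (1 ≤? i)) * factor₁ w i j)
        (λ i j → O.χ (does (1 ≤? i)) O.* B.mono (O.- t′) i j) λ i j → O.sym (O.trans
        (O.*-congʳ {X O.^ j O.* Y O.^ i} (O.trans (RO.*-homo _ _)
          (O.*-cong (χ-homo (does (1 ≤? i))) (factor₁-homo w-homo i j))))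
        (O.*-assoc _ _ _))

    expansion₂ : ∑ (multiIndices k l) (interpolated q r M) ≈
      - ∑ (upTo (suc k)) λ m → ν ^ suc m * ∑ (indices₂ (suc M) k l m) λ (i , j , ls) →
        prod (Vec.zipWith (λ jₐ lₐ → (suc M C suc jₐ) · 1# * harmonic₁ q r M lₐ) j ls)
        * (1# - t) ^ head i * (- t) ^ (l ∸ head i)
    expansion₂ = begin
      ∑ (multiIndices k l) (interpolated q r M)
        ≈⟨ ∑-multiIndices ⟨
      GF.G M l k
        ≈⟨ coefficient-cong (B.expansion₂ ν′ ν-inverse′ (GF.G M) t′ G-bracket) ⟩
      - O.∑ J (λ m → ν′ O.^ suc m O.* product m) l k
        ≈⟨ -‿cong (coefficient-∑ J _) ⟩
      - ∑ J (λ m → (ν′ O.^ suc m O.* product m) l k)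
        ≈⟨ -‿cong (∑-cong J (λ m → trans
             (coefficient-cong (O.*-cong (O.sym (RO.^-homo ν (suc m))) (product≈ m)))
             (trans (coefficient-κ _ (tuple-sum m)) (*-congˡ (coefficient-tuple-sum m))))) ⟩
      - ∑ J (λ m → ν ^ suc m * ∑ (indices₂ (suc M) k l m) (value m)) ∎
      where
      product : ℕ → O.Carrier
      product m = B.bracket (O.1# O.- t′) O.* B.z-series O.* (B.bracket₂ (O.- t′) O.* B.z-series) O.^ m

      coef : ∀ m → Vec ℕ (suc m) → Vec ℕ (suc m) → Vec ℕ (suc m) → Carrier
      coef m is js es = factor₁ w₀ (head is) (head js) * z (head es) * product₃ p₂ (tail is) (tail js) (tail es)

      tuple-sum : ℕ → O.Carrier
      tuple-sum m = TS.triple-tuples I J (suc m) (coef m)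

      product≈ : ∀ m → product m O.≈ tuple-sum m
      product≈ m = O.trans
        (O.*-cong bracket-z≈ (O.trans (O.^-congˡ m bracket₂-z≈) (TS.triple-^ I J p₂ m)))
        (TS.triple-∷ I J m (λ i j e → factor₁ w₀ i j * z e) (product₃ p₂))

      value : ∀ m → Vec ℕ (suc m) × Vec ℕ (suc m) × Vec ℕ (suc m) → Carrier
      value m (i , j , ls) = prod (Vec.zipWith (λ jₐ lₐ → (suc M C suc jₐ) · 1# * z lₐ) j ls)
        * w₀ ^ head i * w ^ (l ∸ head i)

      coefficient-tuple-sum : ∀ m → tuple-sum m l k ≈ ∑ (indices₂ (suc M) k l m) (value m)
      coefficient-tuple-sum m = begin
        tuple-sum m l k
          ≈⟨ trans (coefficient-∑ A _) (∑-cong A λ is → trans (coefficient-∑ E _) (∑-cong E λ js → coefficient-∑ E _)) ⟩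
        (∑ A λ is → ∑ E λ js → ∑ E λ es →
          (κ (coef m is js es) O.* (X O.^ (Vec.sum es ℕ.+ Vec.sum js) O.* Y O.^ Vec.sum is)) l k)
          ≈⟨ ∑-cong A (λ is → ∑-cong E λ js → ∑-cong E λ es → trans
               (coefficient-term (coef m is js es) (Vec.sum is) (Vec.sum es ℕ.+ Vec.sum js))
               (index-weight₂ z k l w₀ w is js es)) ⟩
        (∑ A λ is → ∑ E λ js → ∑ E λ es →
          χ (does (index₂? (suc M) k l m (is , js , es))) * value m (is , js , es))
          ≈⟨ ∑-cong A (λ is → ∑-cartesianProductWith _,_ E E _) ⟨
        (∑ A λ is → ∑ (cartesianProduct E E) λ je →
          χ (does (index₂? (suc M) k l m (is , je))) * value m (is , je))
          ≈⟨ ∑-cartesianProductWith _,_ A (cartesianProduct E E) _ ⟨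
        ∑ (cartesianProduct A (cartesianProduct E E)) (λ ije → χ (does (index₂? (suc M) k l m ije)) * value m ije)
          ≈⟨ ∑-filter (index₂? (suc M) k l m) (cartesianProduct A (cartesianProduct E E)) (value m) ⟨
        ∑ (indices₂ (suc M) k l m) (value m) ∎
        where
        A E : List (Vec ℕ (suc m))
        A = tuples I (suc m)
        E = tuples J (suc m)

-- Strictly decreasing tuples and nested sums.

decreasing-below : ∀ {M l} → ℕ → Vec (Fin M) l → Bool
decreasing-below b []       = true
decreasing-below b (m ∷ ms) = does (toℕ m <? b) ∧ decreasing-below (toℕ m) ms

-- `Linked` compares neighbours only. A bound above the first entry makes the condition recursive in
-- the tail, and the bound `M` holds automatically for elements of `Fin M`.
linked?-decreasing : ∀ {M l} (ms : Vec (Fin M) l) →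
  does (Linked.linked? (λ i j → j Fin.<? i) ms) ≡ decreasing-below M ms
linked?-decreasing []       = ≡.refl
linked?-decreasing {M} (m ∷ ms) = ≡.trans (go m ms)
  (≡.cong (_∧ decreasing-below (toℕ m) ms) (≡.sym (dec-true (toℕ m <? M) (Fin.toℕ<n m))))
  where
  go : ∀ {l} m (ms : Vec (Fin M) l) →
       does (Linked.linked? (λ i j → j Fin.<? i) (m ∷ ms)) ≡ decreasing-below (toℕ m) ms
  go m []        = ≡.refl
  go m (m′ ∷ ms) = ≡.cong (does (toℕ m′ <? toℕ m) ∧_) (go m′ ms)

module DecreasingSums {c ℓ} (R : CommutativeRing c ℓ) where

  open Sums R
  open HarmonicSums R

  ∑-tabulate : ∀ {a} {A : Set a} n (f : Fin n → A) h g → (∀ i → h (f i) ≈ g (toℕ i)) →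
               ∑ (tabulate f) h ≈ ∑ (upTo n) g
  ∑-tabulate zero    f h g h≈g = refl
  ∑-tabulate (suc n) f h g h≈g = trans
    (+-cong (h≈g Fin.zero) (∑-tabulate n (f ∘ Fin.suc) h (g ∘ suc) (h≈g ∘ Fin.suc)))
    (sym (∑-upTo-first n g))

  ∑-upTo-< : ∀ {b} M f → b ≤ M → ∑ (upTo M) (λ m → χ (does (m <? b)) * f m) ≈ ∑ (upTo b) f
  ∑-upTo-< {b} M f b≤M = trans
    (∑-upTo-extend M _ b≤M λ m b≤m → trans (*-congʳ (χ-false (m <? b) (ℕ.≤⇒≯ b≤m))) (zeroˡ _))
    (∑-upTo-cong b λ m m<b → χ-redundant (m <? b) λ m≮b → ⊥-elim (m≮b m<b))

  module _ (q : Carrier) (r : ℕ → Carrier) (M : ℕ) (s : ℕ → Fin M → Carrier)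
    (s≈summand : ∀ k m → s k m ≈ summand q r k (toℕ m)) where

    private
      F : List (Fin M)
      F = allFin M

    -- Stated for every bound, since fixing the first entry `m` leaves a sum of the same kind with
    -- bound `m`.
    ∑-decreasing-below : ∀ {b} → b ≤ M → ∀ ks →
      ∑ (tuples F (length ks)) (λ ms → χ (decreasing-below b ms) * prod (Vec.zipWith s (Vec.fromList ks) ms))
      ≈ harmonic q r b ks
    ∑-decreasing-below b≤M [] = solve 0 (con (+ 1) :* con (+ 1) :+ con (+ 0) := con (+ 1)) refl
    ∑-decreasing-below {b} b≤M (k ∷ ks) = begin
      ∑ (tuples F (suc (length ks))) (λ ms → χ (decreasing-below b ms) * prod (Vec.zipWith s (Vec.fromList (k ∷ ks)) ms))
        ≈⟨ ∑-tuples-suc F (length ks) _ ⟩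
      (∑ F λ m → ∑ (tuples F (length ks)) λ ms → χ (does (toℕ m <? b) ∧ decreasing-below (toℕ m) ms) * (s k m * rest ms))
        ≈⟨ ∑-cong F (λ m → trans
             (∑-cong (tuples F (length ks)) λ ms → trans (*-congʳ (χ-∧ (does (toℕ m <? b)) _))
               (solve 4 (λ x y s p → x :* y :* (s :* p) := x :* s :* (y :* p)) refl
                 (χ (does (toℕ m <? b))) (χ (decreasing-below (toℕ m) ms)) (s k m) (rest ms)))
             (sym (*-∑ _ (tuples F (length ks)) _))) ⟩
      (∑ F λ m → χ (does (toℕ m <? b)) * s k m * ∑ (tuples F (length ks)) λ ms → χ (decreasing-below (toℕ m) ms) * rest ms)
        ≈⟨ ∑-tabulate M id _ (λ m → χ (does (m <? b)) * (summand q r k m * harmonic q r m ks)) (λ m → trans (*-assoc _ _ _)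
             (*-congˡ (*-cong (s≈summand k m) (∑-decreasing-below (ℕ.<⇒≤ (Fin.toℕ<n m)) ks)))) ⟩
      ∑ (upTo M) (λ m → χ (does (m <? b)) * (summand q r k m * harmonic q r m ks))
        ≈⟨ ∑-upTo-< M _ b≤M ⟩
      harmonic q r b (k ∷ ks) ∎
      where
      rest : Vec (Fin M) (length ks) → Carrier
      rest ms = prod (Vec.zipWith s (Vec.fromList ks) ms)

    ∑-decreasing : ∀ ks →
      ∑ (List.filter (Linked.linked? (λ i j → j Fin.<? i)) (tuples F (length ks)))
        (λ ms → prod (Vec.zipWith s (Vec.fromList ks) ms)) ≈ harmonic q r M ks
    ∑-decreasing ks = trans (∑-filter _ (tuples F (length ks)) _) (trans
      (∑-cong (tuples F (length ks)) λ ms → *-congʳ (reflexive (≡.cong χ (linked?-decreasing ms))))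
      (∑-decreasing-below ℕ.≤-refl ks))

-- Polynomials in `t` as truncated power series.

module PolynomialCoefficients {c ℓ} (R : CommutativeRing c ℓ) (d : ℕ) where

  open Sums R
  open Polynomial rawRing
  open Truncated R

  coeff-+ : ∀ p q e → coeff (p +ₚ q) e ≈ coeff p e + coeff q e
  coeff-+ []      q       e       = sym (+-identityˡ _)
  coeff-+ (a ∷ p) []      e       = sym (+-identityʳ _)
  coeff-+ (a ∷ p) (b ∷ q) zero    = refl
  coeff-+ (a ∷ p) (b ∷ q) (suc e) = coeff-+ p q e

  coeff-scale : ∀ a p e → coeff (List.map (a *_) p) e ≈ a * coeff p e
  coeff-scale a []      e       = sym (zeroʳ a)
  coeff-scale a (b ∷ p) zero    = refl
  coeff-scale a (b ∷ p) (suc e) = coeff-scale a p e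

  coeff-* : ∀ p q e → coeff (p *ₚ q) e ≈ conv (coeff p) (coeff q) e
  coeff-* []      q e       = sym (conv-zero (coeff q) e)
  coeff-* (a ∷ p) q zero    = trans (coeff-+ (List.map (a *_) q) _ 0)
    (trans (+-identityʳ _) (coeff-scale a q 0))
  coeff-* (a ∷ p) q (suc e) = trans (coeff-+ (List.map (a *_) q) _ (suc e))
    (+-cong (coeff-scale a q (suc e)) (coeff-* p q e))

  coeff-neg : ∀ p e → coeff (-ₚ p) e ≈ - coeff p e
  coeff-neg []      e       = sym -0#≈0#
  coeff-neg (a ∷ p) zero    = refl
  coeff-neg (a ∷ p) (suc e) = coeff-neg p e

  coeff-const : ∀ a e → coeff (const a) e ≈ ι a e
  coeff-const a zero    = refl
  coeff-const a (suc e) = refl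

  coeff-isRingHomomorphism : IsRingHomomorphism rawRingₚ (CommutativeRing.rawRing (truncated d)) coeff
  coeff-isRingHomomorphism = record
    { isSemiringHomomorphism = record
      { isNearSemiringHomomorphism = record
        { +-isMonoidHomomorphism = record
          { isMagmaHomomorphism = record
            { isRelHomomorphism = record { cong = λ p≈q e _ → p≈q e }
            ; homo = λ p q e _ → coeff-+ p q e
            }
          ; ε-homo = λ _ _ → refl
          }
        ; *-homo = λ p q e _ → coeff-* p q e
        }
      ; 1#-homo = λ e _ → coeff-const 1# e
      }
    ; -‿homo = λ p e _ → coeff-neg p e
    }

-- From the field to the truncated ring in `t`.

module Transport {c ℓ₁ ℓ₂} (F : HeytingField c ℓ₁ ℓ₂) where

  open FieldNotions F

  module _ (char0 : CharacteristicZero) (M : ℕ) (ζ : Carrier) (ζ-primitive : IsPrimitiveRoot (suc M) ζ)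
    (k l d : ℕ) where

    open IsPrimitiveRoot ζ-primitive
    open MultipleHarmonicSums (suc M) ζ power-#1
    open HeytingField F using (#-sym; #⇒invertible)

    K : CommutativeRing c ℓ₁
    K = HeytingCommutativeRing.commutativeRing (HeytingField.heytingCommutativeRing F)

    private
      module K  = Sums K
      module KT = Truncated K
      module KH = HarmonicSums K

      T : CommutativeRing c ℓ₁
      T = KT.truncated d

      module T  = Sums T
      module TH = HarmonicSums T
      module PC = PolynomialCoefficients K d
      module PT = Homomorphism rawRingₚ T PC.coeff-isRingHomomorphism
      module KH⟶T = Homomorphism K.rawRing T (KT.ι-isRingHomomorphism d)

      1/n : Carrier
      1/n = recip- (char0 (suc M))

      1/n-inverse : suc M K.· 1# * 1/n ≈ 1#
      -- Apartness of `n` from 0 provides an inverse of the difference `n - 0`, from which the zero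
      -- has to be removed.
      1/n-inverse = K.trans (K.*-congʳ (K.sym (K.trans (K.+-congˡ K.-0#≈0#) (K.+-identityʳ _))))
        (proj₂ (proj₂ (#⇒invertible (char0 (suc M)))))

      -- `recip-` depends on the proof of apartness, so the proof term is the one occurring in the
      -- definition of `summand`.
      rᶠ : Fin M → Carrier
      rᶠ i = recip- (#-sym (power-#1 (suc (toℕ i)) (s≤s z≤n) (pred-cancel-< (Fin.toℕ<n i))))

      rᶠ-inverse : ∀ i → (1# K.- ζ ^ suc (toℕ i)) * rᶠ i ≈ 1#
      rᶠ-inverse i = proj₂ (proj₂ (#⇒invertible (#-sym (power-#1 (suc (toℕ i)) (s≤s z≤n) (pred-cancel-< (Fin.toℕ<n i))))))

      -- The nested sums run over natural numbers, so the inverses are extended by the default value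
      -- 0 outside `b < M`, where no inverse is claimed.
      r : ℕ → Carrier
      r b with b <? M
      ... | yes b<M = rᶠ (fromℕ< b<M)
      ... | no _    = 0#

      r-toℕ : ∀ i → r (toℕ i) ≡ rᶠ i
      r-toℕ i with toℕ i <? M
      ... | yes i<M = ≡.cong rᶠ (Fin.fromℕ<-toℕ i i<M)
      ... | no i≮M  = ⊥-elim (i≮M (Fin.toℕ<n i))

      r-inverse : ∀ b → b < M → (1# K.- ζ ^ suc b) * r b ≈ 1#
      r-inverse b b<M = ≡.subst (λ b → (1# K.- ζ ^ suc b) * r b ≈ 1#) (Fin.toℕ-fromℕ< b<M)
        (K.trans (K.*-congˡ (K.reflexive (r-toℕ (fromℕ< b<M)))) (rᶠ-inverse (fromℕ< b<M)))

      z̄≈harmonic : ∀ ks → z̄ ks ≈ KH.harmonic ζ r M ks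
      z̄≈harmonic = DecreasingSums.∑-decreasing K ζ r M summand
        (λ a m → K.*-congˡ (K.^-congˡ a (K.reflexive (≡.sym (r-toℕ m)))))

      z̄₁≈harmonic₁ : ∀ a → z̄₁ a ≈ KH.harmonic₁ ζ r M a
      z̄₁≈harmonic₁ zero    = K.refl
      z̄₁≈harmonic₁ (suc a) = K.trans (z̄≈harmonic (suc a ∷ []))
        (K.∑-cong (upTo M) λ m → K.*-identityʳ _)

      θ : Poly → T.Carrier
      θ = coeff

      q′ ν′ t′ : T.Carrier
      q′ = KT.ι ζ
      ν′ = KT.ι 1/n
      t′ = θ t
      r′ : ℕ → T.Carrier
      r′ b = KT.ι (r b)

      θ-const : ∀ {a b} → KT.ι a T.≈ b → θ (const a) T.≈ b
      θ-const {a} eq = T.trans (λ e _ → PC.coeff-const a e) eq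

      qⁿ≈1′ : q′ T.^ suc M T.≈ T.1#
      qⁿ≈1′ = T.trans (T.sym (KH⟶T.^-homo ζ (suc M))) (T.trans (KH⟶T.⟦⟧-cong power-n) KH⟶T.1#-homo)

      r-inverse′ : ∀ b → b < M → (T.1# T.- q′ T.^ suc b) T.* r′ b T.≈ T.1#
      r-inverse′ b b<M = T.trans
        (T.*-congʳ {r′ b} (T.sym (T.trans (KH⟶T.+-homo 1# _) (T.+-cong KH⟶T.1#-homo
          (T.trans (KH⟶T.-‿homo _) (T.-‿cong (KH⟶T.^-homo ζ (suc b))))))))
        (T.trans (T.sym (KH⟶T.*-homo _ (r b))) (T.trans (KH⟶T.⟦⟧-cong (r-inverse b b<M)) KH⟶T.1#-homo))

      ν-inverse′ : suc M T.· T.1# T.* ν′ T.≈ T.1#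
      ν-inverse′ = T.trans (T.*-congʳ {ν′} (T.sym (KH⟶T.×1-homo (suc M))))
        (T.trans (T.sym (KH⟶T.*-homo _ 1/n)) (T.trans (KH⟶T.⟦⟧-cong 1/n-inverse) KH⟶T.1#-homo))

      module E = Expansion.AtRoot T k l q′ M qⁿ≈1′ r′ r-inverse′ ν′ ν-inverse′ t′
      module KTH = HarmonicHomomorphism K T (KT.ι-isRingHomomorphism d) ζ r
      open TH.Fillings t′ using (interpolated; ∑-fillings)

      z̄ᵗ-homo : ∀ {l} a (ks : Vec ℕ l) → θ (z̄ᵗ (a ∷ ks)) T.≈ interpolated q′ r′ M (a ∷ ks)
      z̄ᵗ-homo {l} a ks = T.trans (PT.∑-homo (fillings a ks) _) (T.trans
        (T.∑-cong (fillings a ks) λ p → T.trans (PT.*-homo (const (z̄ p)) (t ^ₚ (suc l ∸ length p)))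
          (T.*-cong (θ-const (T.trans (KH⟶T.⟦⟧-cong (z̄≈harmonic p)) (KTH.harmonic-homo M p)))
            (PT.^-homo t (suc l ∸ length p))))
        (∑-fillings (TH.harmonic q′ r′ M) a ks))

      G-homo : θ (G k l) T.≈ T.∑ (multiIndices k l) (interpolated q′ r′ M)
      G-homo = go k l
        where
        go : ∀ k l → θ (G k l) T.≈ T.∑ (multiIndices k l) (interpolated q′ r′ M)
        positive-depth : ∀ k l → θ (Σₚ (multiIndices k (suc l)) z̄ᵗ) T.≈ T.∑ (multiIndices k (suc l)) (interpolated q′ r′ M)
        go zero    zero    = T.trans PT.1#-homo (T.sym (T.+-identityʳ T.1#))
        go (suc k) zero    = PT.0#-homo
        -- The clauses of `G` split on the weight before the depth, so `G` with positive depth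
        -- reduces only once the weight is a constructor; the two cases then share one argument.
        go zero    (suc l) = positive-depth 0 l
        go (suc k) (suc l) = positive-depth (suc k) l
        positive-depth k l = T.trans (PT.∑-homo (multiIndices k (suc l)) z̄ᵗ)
          (T.∑-cong (multiIndices k (suc l)) λ { (a ∷ ks) → z̄ᵗ-homo a ks })

      prod-map : ∀ {m} (f : ℕ → Carrier) g → (∀ x → KT.ι (f x) T.≈ g x) →
        ∀ (xs : Vec ℕ m) → KT.ι (prod (Vec.map f xs)) T.≈ T.prod (Vec.map g xs)
      prod-map f g f≈g []       = KH⟶T.1#-homo
      prod-map f g f≈g (x ∷ xs) = T.trans (KH⟶T.*-homo (f x) _) (T.*-cong (f≈g x) (prod-map f g f≈g xs))

      prod-zipWith : ∀ {m} (f : ℕ → ℕ → Carrier) g → (∀ x y → KT.ι (f x y) T.≈ g x y) →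
        ∀ (xs ys : Vec ℕ m) → KT.ι (prod (Vec.zipWith f xs ys)) T.≈ T.prod (Vec.zipWith g xs ys)
      prod-zipWith f g f≈g []       []       = KH⟶T.1#-homo
      prod-zipWith f g f≈g (x ∷ xs) (y ∷ ys) = T.trans (KH⟶T.*-homo (f x y) _) (T.*-cong (f≈g x y) (prod-zipWith f g f≈g xs ys))

      monomial-homo : ∀ {c c′} → KT.ι c T.≈ c′ → ∀ i j →
        θ (const c *ₚ (1ₚ +ₚ -ₚ t) ^ₚ i *ₚ (-ₚ t) ^ₚ j) T.≈ c′ T.* (T.1# T.- t′) T.^ i T.* (T.- t′) T.^ j
      monomial-homo {c} eq i j = T.trans (PT.*-homo (const c *ₚ (1ₚ +ₚ -ₚ t) ^ₚ i) ((-ₚ t) ^ₚ j)) (T.*-cong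
        (T.trans (PT.*-homo (const c) ((1ₚ +ₚ -ₚ t) ^ₚ i)) (T.*-cong (θ-const eq)
          (T.trans (PT.^-homo (1ₚ +ₚ -ₚ t) i) (T.^-congˡ i
            (T.trans (PT.+-homo 1ₚ (-ₚ t)) (T.+-cong PT.1#-homo (PT.-‿homo t)))))))
        (T.trans (PT.^-homo (-ₚ t) j) (T.^-congˡ j (PT.-‿homo t))))

      C-homo : ∀ j → KT.ι (fromℕ (suc M C suc j)) T.≈ (suc M C suc j) T.· T.1#
      C-homo j = KH⟶T.×1-homo (suc M C suc j)

    coefficient₁ : coeff (G k l) d ≈ coeff (Σₚ (upTo (suc k)) λ m →
        const ((- 1#) ^ m * 1/n ^ suc m) *ₚ
        Σₚ (indices₁ (suc M) k l m) λ (i , j) →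
          const (prod (map (λ jₐ → fromℕ (suc M C suc jₐ)) j))
          *ₚ (1ₚ +ₚ -ₚ t) ^ₚ head i *ₚ (-ₚ t) ^ₚ (l ∸ head i)) d
    coefficient₁ = T.trans G-homo (T.trans E.expansion₁ (T.sym (T.trans (PT.∑-homo (upTo (suc k)) outer)
      (T.∑-cong (upTo (suc k)) λ m → T.trans
        (PT.*-homo (const ((- 1#) ^ m * 1/n ^ suc m)) (Σₚ (indices₁ (suc M) k l m) inner))
        (T.*-cong (θ-const (scalar-homo m))
          (T.trans (PT.∑-homo (indices₁ (suc M) k l m) inner) (T.∑-cong (indices₁ (suc M) k l m) λ (i , j) →
            monomial-homo (prod-map _ _ C-homo j) (head i) (l ∸ head i))))))))
      d ℕ.≤-refl
      where
      inner : ∀ {m} → Vec ℕ (suc m) × Vec ℕ (suc m) → Poly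
      inner (i , j) = const (prod (map (λ jₐ → fromℕ (suc M C suc jₐ)) j))
        *ₚ (1ₚ +ₚ -ₚ t) ^ₚ head i *ₚ (-ₚ t) ^ₚ (l ∸ head i)

      outer : ℕ → Poly
      outer m = const ((- 1#) ^ m * 1/n ^ suc m) *ₚ Σₚ (indices₁ (suc M) k l m) inner

      scalar-homo : ∀ m → KT.ι ((- 1#) ^ m * 1/n ^ suc m) T.≈ (T.- T.1#) T.^ m T.* ν′ T.^ suc m
      scalar-homo m = T.trans (KH⟶T.*-homo ((- 1#) ^ m) (1/n ^ suc m)) (T.*-cong
        (T.trans (KH⟶T.^-homo (- 1#) m) (T.^-congˡ m (T.trans (KH⟶T.-‿homo 1#) (T.-‿cong KH⟶T.1#-homo))))
        (KH⟶T.^-homo 1/n (suc m)))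

    coefficient₂ : coeff (G k l) d ≈ coeff (-ₚ Σₚ (upTo (suc k)) λ m →
        const (1/n ^ suc m) *ₚ
        Σₚ (indices₂ (suc M) k l m) λ (i , j , ls) →
          const (prod (zipWith (λ jₐ lₐ → fromℕ (suc M C suc jₐ) * z̄₁ lₐ) j ls))
          *ₚ (1ₚ +ₚ -ₚ t) ^ₚ head i *ₚ (-ₚ t) ^ₚ (l ∸ head i)) d
    coefficient₂ = T.trans G-homo (T.trans E.expansion₂ (T.sym (T.trans (PT.-‿homo (Σₚ (upTo (suc k)) outer))
      (T.-‿cong (T.trans (PT.∑-homo (upTo (suc k)) outer) (T.∑-cong (upTo (suc k)) λ m → T.trans
        (PT.*-homo (const (1/n ^ suc m)) (Σₚ (indices₂ (suc M) k l m) inner))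
        (T.*-cong (θ-const (KH⟶T.^-homo 1/n (suc m)))
          (T.trans (PT.∑-homo (indices₂ (suc M) k l m) inner) (T.∑-cong (indices₂ (suc M) k l m) λ (i , j , ls) →
            monomial-homo (prod-zipWith _ _ weight-homo j ls) (head i) (l ∸ head i))))))))))
      d ℕ.≤-refl
      where
      inner : ∀ {m} → Vec ℕ (suc m) × Vec ℕ (suc m) × Vec ℕ (suc m) → Poly
      inner (i , j , ls) = const (prod (zipWith (λ jₐ lₐ → fromℕ (suc M C suc jₐ) * z̄₁ lₐ) j ls))
        *ₚ (1ₚ +ₚ -ₚ t) ^ₚ head i *ₚ (-ₚ t) ^ₚ (l ∸ head i)

      outer : ℕ → Poly
      outer m = const (1/n ^ suc m) *ₚ Σₚ (indices₂ (suc M) k l m) inner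

      weight-homo : ∀ jₐ lₐ → KT.ι (fromℕ (suc M C suc jₐ) * z̄₁ lₐ) T.≈
                    (suc M C suc jₐ) T.· T.1# T.* TH.harmonic₁ q′ r′ M lₐ
      weight-homo jₐ lₐ = T.trans (KH⟶T.*-homo (fromℕ (suc M C suc jₐ)) (z̄₁ lₐ)) (T.*-cong (C-homo jₐ)
        (T.trans (KH⟶T.⟦⟧-cong (z̄₁≈harmonic₁ lₐ)) (KTH.harmonic₁-homo M lₐ)))

corollary1p4 :
  ∀ {c ℓ₁ ℓ₂} (F : HeytingField c ℓ₁ ℓ₂) (let open FieldNotions F)
  (char0 : CharacteristicZero)
  (n : ℕ) .{{_ : NonZero n}}
  (ζ : Carrier) (ζ-primitive : IsPrimitiveRoot n ζ)
  (k l : ℕ) → l ≤ k →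
  let open MultipleHarmonicSums n ζ (IsPrimitiveRoot.power-#1 ζ-primitive)
      1/n = recip- (char0 n)
  in
    (G k l ≈ₚ
      Σₚ (upTo (suc k)) λ m →
        const ((- 1#) ^ m * 1/n ^ suc m) *ₚ
        Σₚ (indices₁ n k l m) λ (i , j) →
          const (prod (map (λ jₐ → fromℕ (n C suc jₐ)) j))
          *ₚ (1ₚ +ₚ -ₚ t) ^ₚ head i *ₚ (-ₚ t) ^ₚ (l ∸ head i))
    ×
    (G k l ≈ₚ
      -ₚ Σₚ (upTo (suc k)) λ m →
        const (1/n ^ suc m) *ₚ
        Σₚ (indices₂ n k l m) λ (i , j , ls) →
          const (prod (zipWith (λ jₐ lₐ → fromℕ (n C suc jₐ) * z̄₁ lₐ) j ls))
          *ₚ (1ₚ +ₚ -ₚ t) ^ₚ head i *ₚ (-ₚ t) ^ₚ (l ∸ head i))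
corollary1p4 F char0 (suc M) ζ ζ-primitive k l _ =
  (λ d → Transport.coefficient₁ F char0 M ζ ζ-primitive k l d) ,
  (λ d → Transport.coefficient₂ F char0 M ζ ζ-primitive k l d)
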